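{- Let $\Phi$ be any given separable center-based clustering objective. Suppose either (i) $\alpha \ge 3$ and the instances considered are over finite metrics defined only over the data points (so that centers must be data points), or (ii) $\alpha \ge 2+\sqrt{3}$ and the instances considered are over general metrics (so that centers may be points of the metric space that are not data points). Then there is a polynomial-time algorithm that, on every clustering instance that is $\alpha$-perturbation resilient for $\Phi$, finds the optimal clustering under $\Phi$.
   Context: A clustering instance consists of $n$ data points residing in a metric space $(S,d)$, a number of clusters $k$ (part of the input, not a constant), and an objective function $\Phi$ to be minimized over partitions of the data points into $k$ clusters. Two settings are distinguished. In a finite metric defined only over the data, $S$ is exactly the set of data points, so centers must be data points. In a general metric, $S$ may contain additional (Steiner) points, and centers may be any points of $S$. A clustering objective is center-based if the optimal solution can be defined by $k$ points $c_1^*,\dots,c_k^*$ of the metric space, called centers, such that every data point is assigned to its nearest center. A center-based objective is separable if in addition (1) the objective value of a clustering is either a (weighted) sum or the maximum of the individual cluster scores, and (2) given a proposed single cluster, its score can be computed in polynomial time. Examples are $k$-median (the sum of distances of points to their nearest center), $k$-means (the sum of squared distances) and $k$-center (the maximum distance). For $\alpha>1$, a function $d':S\times S\to\mathbb{R}_{\ge 0}$ (not necessarily a metric) is an $\alpha$-perturbation of $d$ if $d(x,y)\le d'(x,y)\le \alpha\, d(x,y)$ for all $x,y\in S$. A clustering instance in $(S,d)$ is $\alpha$-perturbation resilient for $\Phi$ if for every $\alpha$-perturbation $d'$ of $d$, the (only) optimal clustering of $(S,d')$ under $\Phi$ is identical, as a partition of the points into subsets, to the optimal clustering of $(S,d)$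 under $\Phi$. -}

module Defs where

open import Level using (Level; 0ℓ)
open import Algebra.Bundles using (CommutativeRing)
import Algebra.Construct.NaturalChoice.Max as Max
open import Data.Bool using (Bool; true; false; if_then_else_)
open import Data.Fin using (Fin; zero; suc; toℕ; _≟_)
open import Data.Fin.Subset using (Subset; _∈_; Nonempty)
open import Data.Nat as ℕ using (ℕ; zero; suc)
open import Data.Product using (Σ; ∃; ∃-syntax; Σ-syntax; _×_; _,_)
import Data.Vec as Vec
open import Data.Vec.Functional using (Vector; foldr)
open import Function using (_∘_; _⇔_)
open import Function.Definitions using (Injective; Surjective)
open import Function.Metric.Structures using (IsGeneralMetric)
open import Relation.Binary.Bundles using (DecTotalOrder)
open import Relation.Binary.Core using (Rel)
open import Relation.Binary.PropositionalEquality using (_≡_)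
open import Relation.Binary.Structures using (IsDecTotalOrder)
open import Relation.Nullary using (¬_; does)

-- The reals are not available, so distances live in an arbitrary ordered field,
-- of which ℝ (with classical logic) and ℚ are instances.
record OrderedField : Set₁ where
  infix 4 _≤_
  infix 8 _⁻¹
  field
    commutativeRing : CommutativeRing 0ℓ 0ℓ
  open CommutativeRing commutativeRing public hiding (zero)
  field
    _≤_             : Rel Carrier 0ℓ
    isDecTotalOrder : IsDecTotalOrder _≈_ _≤_
    +-monoˡ-≤       : ∀ z {x y} → x ≤ y → x + z ≤ y + z
    *-nonNegative   : ∀ {x y} → 0# ≤ x → 0# ≤ y → 0# ≤ x * y
    0≉1             : ¬ (0# ≈ 1#)
    _⁻¹             : Carrier → Carrier
    *-inverseʳ      : ∀ x → ¬ (x ≈ 0#) → x * x ⁻¹ ≈ 1#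

  decTotalOrder : DecTotalOrder 0ℓ 0ℓ 0ℓ
  decTotalOrder = record { isDecTotalOrder = isDecTotalOrder }

  open DecTotalOrder decTotalOrder public using (_≤?_; totalOrder)
  open Max totalOrder public using (_⊔_)

  2# 3# : Carrier
  2# = 1# + 1#
  3# = 2# + 1#

  -- α ≥ 2 + √3, for a field that need not contain √3.
  AtLeast2+√3 : Carrier → Set
  AtLeast2+√3 α = 2# ≤ α × 3# ≤ (α - 2#) * (α - 2#)

-- The space taken by a number. Constant length zero gives unit-cost arithmetic
-- (the real RAM); on ℚ the maximum of the bit lengths of numerator and
-- denominator gives, up to polynomial factors, the cost on a Turing machine.
record Length (F : OrderedField) : Set where
  open OrderedField F
  field
    len   : Carrier → ℕ
    slack : ℕ
    len-+ : ∀ x y → len (x + y) ℕ.≤ len x ℕ.+ len y ℕ.+ slack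
    len-* : ∀ x y → len (x * y) ℕ.≤ len x ℕ.+ len y ℕ.+ slack

module Computation (F : OrderedField) (L : Length F) where
  open OrderedField F
  open Length L

  infixr 5 _∷_

  data Val : Set where
    nil : Val
    num : Carrier → Val
    _∷_ : Val → Val → Val

  size : Val → ℕ
  size nil     = 1
  size (num x) = suc (len x)
  size (x ∷ y) = suc (size x ℕ.+ size y)

  bool : Bool → Val
  bool true  = nil ∷ nil
  bool false = nil

  unary : ℕ → Val
  unary zero    = nil
  unary (suc n) = nil ∷ unary n

  list : ∀ {n} → Vector Val n → Val
  list = foldr _∷_ nil

  data Prim : Set where
    idₚ nilₚ headₚ tailₚ isPairₚ 0ₚ 1ₚ +ₚ *ₚ -ₚ ⁻¹ₚ ≤ₚ : Prim

  -- A primitive applied to a value of the wrong shape returns nil.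
  apply : Prim → Val → Val
  apply idₚ     x               = x
  apply headₚ   (x ∷ _)         = x
  apply tailₚ   (_ ∷ y)         = y
  apply isPairₚ (_ ∷ _)         = bool true
  apply 0ₚ      _               = num 0#
  apply 1ₚ      _               = num 1#
  apply +ₚ      (num x ∷ num y) = num (x + y)
  apply *ₚ      (num x ∷ num y) = num (x * y)
  apply -ₚ      (num x)         = num (- x)
  apply ⁻¹ₚ     (num x)         = num (x ⁻¹)
  apply ≤ₚ      (num x ∷ num y) = bool (does (x ≤? y))
  apply _       _               = nil

  infixr 4 _⨾_

  data Prog : Set where
    prim  : Prim → Prog
    _⨾_   : Prog → Prog → Prog
    ⟨_,_⟩ : Prog → Prog → Prog
    cond  : Prog → Prog → Prog → Prog
    while : Prog → Prog → Prog

  data Truthy : Val → Set where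
    num  : ∀ x → Truthy (num x)
    pair : ∀ x y → Truthy (x ∷ y)

  infix 3 _⊢_⇓_⟨_⟩

  -- p ⊢ x ⇓ y ⟨ t ⟩: started on x, program p halts with result y in time t.
  -- Primitives are charged for the size of the data they read and write, so t is
  -- at least the size of every value occurring in the run.
  data _⊢_⇓_⟨_⟩ : Prog → Val → Val → ℕ → Set where
    prim       : ∀ {f x} → prim f ⊢ x ⇓ apply f x ⟨ size x ℕ.+ size (apply f x) ⟩
    seq        : ∀ {p q x y z s t} →
                 p ⊢ x ⇓ y ⟨ s ⟩ → q ⊢ y ⇓ z ⟨ t ⟩ →
                 (p ⨾ q) ⊢ x ⇓ z ⟨ suc (s ℕ.+ t) ⟩
    pair       : ∀ {p q x y z s t} →
                 p ⊢ x ⇓ y ⟨ s ⟩ → q ⊢ x ⇓ z ⟨ t ⟩ →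
                 ⟨ p , q ⟩ ⊢ x ⇓ y ∷ z ⟨ suc (s ℕ.+ t) ⟩
    cond-true  : ∀ {b p q x v y s t} →
                 b ⊢ x ⇓ v ⟨ s ⟩ → Truthy v → p ⊢ x ⇓ y ⟨ t ⟩ →
                 cond b p q ⊢ x ⇓ y ⟨ suc (s ℕ.+ t) ⟩
    cond-false : ∀ {b p q x y s t} →
                 b ⊢ x ⇓ nil ⟨ s ⟩ → q ⊢ x ⇓ y ⟨ t ⟩ →
                 cond b p q ⊢ x ⇓ y ⟨ suc (s ℕ.+ t) ⟩
    while-stop : ∀ {b p x s} →
                 b ⊢ x ⇓ nil ⟨ s ⟩ →
                 while b p ⊢ x ⇓ x ⟨ suc s ⟩
    while-step : ∀ {b p x v y z r s t} →
                 b ⊢ x ⇓ v ⟨ r ⟩ → Truthy v → p ⊢ x ⇓ y ⟨ s ⟩ →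
                 while b p ⊢ y ⇓ z ⟨ t ⟩ →
                 while b p ⊢ x ⇓ z ⟨ suc (r ℕ.+ s ℕ.+ t) ⟩

  -- One program, with one polynomial time bound, meets the specification on all
  -- inputs. Sizes are positive, so c * n ^ e bounds every polynomial.
  PolyTime : ∀ {ℓ : Level} {X : Set ℓ} → (X → Val) → (X → Val → Set) → Set ℓ
  PolyTime {X = X} input Spec =
    Σ[ p ∈ Prog ] Σ[ c ∈ ℕ ] Σ[ e ∈ ℕ ] ∀ (x : X) →
      ∃[ y ] ∃[ t ] (p ⊢ input x ⇓ y ⟨ t ⟩ × t ℕ.≤ c ℕ.* size (input x) ℕ.^ e × Spec x y)

module Clustering (F : OrderedField) (L : Length F) where
  open OrderedField F
  open Computation F L public

  -- The distance is an arbitrary function here, because perturbations of a metric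
  -- need not be metrics. The description carries whatever else an algorithm is
  -- told about the instance: a presentation of the points of S that are not data
  -- points, weights of the data points, and so on.
  record Instance : Set₁ where
    field
      S           : Set
      d           : S → S → Carrier
      n k         : ℕ
      point       : Fin n → S
      point-inj   : Injective _≡_ _≡_ point
      description : Val

  open Instance public

  NonNegative : Instance → Set
  NonNegative I = ∀ x y → 0# ≤ d I x y

  IsMetric : Instance → Set
  IsMetric I = IsGeneralMetric _≡_ _≈_ _≤_ 0# _+_ (d I)

  OnlyDataPoints : Instance → Set
  OnlyDataPoints I = Surjective _≡_ _≡_ (point I)

  _[_] : (I : Instance) → (S I → S I → Carrier) → Instance
  I [ d′ ] = record { Instance I hiding (d) ; d = d′ }

  code : Instance → Val
  code I = unary (k I)
         ∷ list (λ p → list (λ q → num (d I (point I p) (point I q))))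
         ∷ description I

  -- A partition into k clusters is a surjective labelling by Fin k, taken up to
  -- SamePartition; the clusters of a partition are nonempty.
  Labelling : Instance → Set
  Labelling I = Fin (n I) → Fin (k I)

  IsPartition : (I : Instance) → Labelling I → Set
  IsPartition I a = Surjective _≡_ _≡_ a

  SamePartition : (I : Instance) → Labelling I → Labelling I → Set
  SamePartition I a b = ∀ p q → a p ≡ a q ⇔ b p ≡ b q

  cluster : (I : Instance) → Labelling I → Fin (k I) → Subset (n I)
  cluster I a i = Vec.tabulate (λ p → does (a p ≟ i))

  codeSubset : ∀ {n} → Subset n → Val
  codeSubset C = list (bool ∘ Vec.lookup C)

  codeLabelling : (I : Instance) → Labelling I → Val
  codeLabelling I a = list (unary ∘ toℕ ∘ a)

  data Combination : Set where
    weightedSum maximum : Combination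

  sumOver : ∀ {k} → Vector Carrier k → Carrier
  sumOver = foldr _+_ 0#

  maxOver : ∀ {k} → Vector Carrier k → Carrier
  maxOver {zero}  f = 0#
  maxOver {suc k} f = foldr _⊔_ (f zero) (f ∘ suc)

  -- cost x C v is the cost of serving the cluster C from a center at distance v p
  -- from each data point p. Both cost and weight may use the description x.
  -- For k-median, k-means and k-center it is the sum of v p, the sum of (v p)² and
  -- the maximum of v p over p in C.
  record Objective : Set where
    field
      cost        : Val → ∀ {n} → Subset n → Vector Carrier n → Carrier
      weight      : Val → ∀ {n} → Subset n → Carrier
      combination : Combination

  module _ (Φ : Objective) where
    open Objective Φ

    costFrom : (I : Instance) → Subset (n I) → S I → Carrier
    costFrom I C c = cost (description I) C (λ p → d I (point I p) c)

    -- The score of a cluster is its cost from a best center.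
    IsScore : (I : Instance) → Subset (n I) → Carrier → Set
    IsScore I C v = (∃[ c ] costFrom I C c ≈ v) × (∀ c → v ≤ costFrom I C c)

    combine : Combination → (I : Instance) → Labelling I → Vector Carrier (k I) → Carrier
    combine weightedSum I a s = sumOver (λ i → weight (description I) (cluster I a i) * s i)
    combine maximum     I a s = maxOver s

    value : (I : Instance) → Labelling I → (Fin (k I) → S I) → Carrier
    value I a c = combine combination I a (λ i → costFrom I (cluster I a i) (c i))

    IsOptimalWith : (I : Instance) → Labelling I → (Fin (k I) → S I) → Set
    IsOptimalWith I a c =
      IsPartition I a × (∀ b e → IsPartition I b → value I a c ≤ value I b e)

    IsOptimal : (I : Instance) → Labelling I → Set
    IsOptimal I a = ∃[ c ] IsOptimalWith I a c

    record IsCenterBased : Set₁ where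
      field
        -- Bringing a center nearer to the points of its cluster does not make it
        -- worse; in particular only distances to members of the cluster matter.
        cost-mono :
          ∀ x {n} (C : Subset n) (u v : Vector Carrier n) →
          (∀ p → p ∈ C → 0# ≤ u p) → (∀ p → p ∈ C → u p ≤ v p) →
          cost x C u ≤ cost x C v
        nearest :
          ∀ I → NonNegative I → ∃ (IsOptimal I) →
          ∃[ a ] ∃[ c ] (IsOptimalWith I a c ×
            (∀ p i → d I (point I p) (c (a p)) ≤ d I (point I p) (c i)))
        -- Given optimal centers, reassigning points to centers at least as near
        -- keeps a clustering optimal; so ties may be broken arbitrarily.
        reassign :
          ∀ I → NonNegative I → ∀ a b c → IsOptimalWith I a c → IsPartition I b →
          (∀ p → d I (point I p) (c (b p)) ≤ d I (point I p) (c (a p))) →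
          IsOptimalWith I b c

    -- The class 𝓘 fixes which instances are considered and how the space is
    -- presented in their descriptions.
    record IsSeparable (𝓘 : Instance → Set) : Set₁ where
      ClusterOf : Set₁
      ClusterOf = Σ[ I ∈ Instance ] 𝓘 I × Σ[ C ∈ Subset (n I) ] Nonempty C

      input : ClusterOf → Val
      input (I , _ , C , _) = code I ∷ codeSubset C

      field
        weight-nonNegative :
          ∀ I → 𝓘 I → ∀ C → 0# ≤ weight (description I) {n I} C
        weight-polyTime :
          PolyTime {X = ClusterOf} input
            (λ { (I , _ , C , _) y → ∃[ w ] (y ≡ num w × w ≈ weight (description I) C) })
        score-polyTime :
          PolyTime {X = ClusterOf} input
            (λ { (I , _ , C , _) y → ∃[ v ] (y ≡ num v × IsScore I C v) })

    IsPerturbation : Carrier → (I : Instance) → (S I → S I → Carrier) → Set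
    IsPerturbation α I d′ = ∀ x y → d I x y ≤ d′ x y × d′ x y ≤ α * d I x y

    IsResilient : Carrier → Instance → Set
    IsResilient α I =
      ∃[ a ] (∀ d′ → IsPerturbation α I d′ →
        IsOptimal (I [ d′ ]) a ×
        (∀ b → IsOptimal (I [ d′ ]) b → SamePartition I b a))

    FindsOptimalClustering : Carrier → (Instance → Set) → Set₁
    FindsOptimalClustering α 𝓘 =
      PolyTime {X = Σ[ I ∈ Instance ] 𝓘 I × IsResilient α I}
        (λ { (I , _) → code I })
        (λ { (I , _) y → ∃[ a ] (y ≡ codeLabelling I a × IsOptimal I a) })

{-# OPTIONS --safe #-}

-- By resilience the optimal partition a stays optimal when all distances are multiplied by α;
-- let g be centers for it there. If a point p of a cluster with at least two points had
-- d(p, g j) ≤ α d(p, g (a p)) for another cluster j, then lowering αd at (p , g j) alone to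
-- α d(p, g (a p)) would keep a and g optimal, and moving p to j would give a second optimum.
-- So such points are more than α times farther from foreign centers than from their own.
-- For α ≥ 3 with centers among the data, and for α ≥ 2 + √3 in general, the triangle inequality
-- then shows that from every proper part of a cluster, the nearest remaining point lies in the
-- same cluster. Hence Prim's algorithm, which always adds the point nearest to the set reached
-- so far, visits the clusters one after the other, whatever point it starts from: each optimal
-- cluster is a difference of two sets of its chain V₁ ⊂ … ⊂ Vₙ. A dynamic program over the
-- chain finds a best partition into k such differences.

module Submission where

open import Defs
import Algebra.Construct.NaturalChoice.MaxOp as MaxOp
import Algebra.Properties.Monoid.Sum as MonoidSum
import Algebra.Properties.Ring as RingProperties
import Algebra.Solver.Ring.NaturalCoefficients.Default as Solver
open import Data.Bool using (Bool; true; false; if_then_else_; not; _∧_; _∨_)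
open import Data.Bool.ListAction using (any)
import Data.Bool.Properties as Bool
open import Data.Empty using (⊥; ⊥-elim)
open import Data.Fin using (Fin; zero; suc; toℕ; _≟_; fromℕ; fromℕ<; inject₁)
open import Data.Fin.Properties using (any?; toℕ-fromℕ; toℕ-fromℕ<; toℕ-inject₁; toℕ-injective; toℕ<n)
open import Data.Fin.Subset using (Subset; Nonempty; _∈_; _⊂_; ∣_∣)
open import Data.Fin.Subset.Properties using (p⊂q⇒∣p∣<∣q∣; x∈p⇒∣p-x∣<∣p∣; ∣p∣≤n)
open import Data.List as List using (List; []; _∷_; length; allFin; downFrom; reverse; _ʳ++_)
open import Data.List.Membership.Propositional using (_∉_) renaming (_∈_ to _∈ᴸ_)
open import Data.List.Membership.Propositional.Properties using (∈-allFin; ∈-map⁺; ∈-map⁻)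
open import Data.List.Membership.Propositional.Properties.WithK using (unique∧set⇒bag)
import Data.List.Properties as List
open import Data.List.Relation.Binary.BagAndSetEquality using (∼bag⇒↭)
open import Data.List.Relation.Binary.Permutation.Propositional as Perm using (_↭_)
open import Data.List.Relation.Binary.Permutation.Propositional.Properties using (↭-length)
open import Data.List.Relation.Unary.All.Properties.Core using (¬Any⇒All¬)
open import Data.List.Relation.Unary.AllPairs using ([]; _∷_)
open import Data.List.Relation.Unary.Any using (here; there)
open import Data.List.Relation.Unary.Unique.Propositional using (Unique)
open import Data.List.Relation.Unary.Unique.Propositional.Properties using (allFin⁺)
open import Data.Maybe using (Maybe; just; nothing; is-just; maybe)
open import Data.Nat as ℕ using (ℕ; zero; suc)
import Data.Nat.Properties as ℕ
open import Data.Nat.Tactic.RingSolver using (solve-∀)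
open import Data.Product using (Σ; ∃; ∃-syntax; Σ-syntax; _×_; _,_; proj₁; proj₂)
open import Data.Sum as Sum using (_⊎_; inj₁; inj₂; [_,_]′)
open import Data.Unit using (⊤; tt)
open import Data.Vec using (tabulate; lookup)
open import Data.Vec.Functional using (Vector; foldr)
open import Data.Vec.Properties using (lookup∘tabulate; tabulate∘lookup; tabulate-cong; []=⇒lookup; lookup⇒[]=)
open import Function using (_∘_; id; mk⇔; Equivalence)
open import Function.Metric.Structures using (module IsGeneralMetric)
open import Relation.Binary.Bundles using (DecTotalOrder)
open import Relation.Binary.Definitions using (DecidableEquality)
open import Relation.Binary.PropositionalEquality as ≡ using (_≡_; _≢_)
import Relation.Binary.Reasoning.PartialOrder as PartialOrderReasoning
open import Relation.Nullary using (¬_; Dec; yes; no; does; contradiction; _×-dec_; ¬?)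
open import Relation.Nullary.Decidable using (map′)

-- A perturbation may only raise distances, so multiplying all of them by α first makes room for
-- lowering a single one; and since it need be neither symmetric nor a metric, one ordered pair of a
-- point and a center can be changed alone. Resilience then makes a optimal with some centers,
-- perhaps not g, and optimality has to be carried over to g. A point alone in its cluster escapes
-- the argument, as moving it would leave a cluster empty. With γ = α - 1, the triangle inequality
-- calls for γ² ≥ γ + 2, that is γ ≥ 2, if the center is itself a point that the search can reach,
-- and for γ² ≥ 2γ + 2, that is γ ≥ 1 + √3, if two points are compared only through their center.
-- The order of the visit does not show where one cluster ends and the next begins, and no threshold
-- on distances tells it; hence the dynamic program. On the side of complexity the obstacle is
-- growth: a loop whose body is fast in the size of its state may still double that state in each
-- round. So all times are measured against the size of the outermost input, and the numbers in the
-- table need a bound on their length.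

module _ (F : OrderedField) (L : Length F) where

  -- Families of programs that run in polynomial time

  module Feasible where
    open import Data.Nat using (_+_; _*_; _^_; _≤_; z≤n; s≤s; s≤s⁻¹; >-nonZero)
    open import Data.Nat.Properties
    open import Relation.Binary.PropositionalEquality
    open Computation F L
    open Length L using (len; slack; len-+; len-*)
    open ≤-Reasoning

    -- An index may contain what no program sees, such as proofs or a space `S`; `input` fixes the
    -- scale on which time is measured.
    record Family : Set₂ where
      constructor family
      field
        Index : Set₁
        input : Index → Val
    open Family public

    infixl 5 _▸_
    -- Local data (a position in a list, a point, a hypothesis) extends the index but not `input`.
    -- The body of a loop is thus charged against the outer input, uniformly in the local data.
    _▸_ : (Γ : Family) → (Index Γ → Set) → Family
    Γ ▸ B = family (Σ (Index Γ) B) (input Γ ∘ proj₁)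

    size>0 : ∀ v → 1 ≤ size v
    size>0 nil     = s≤s z≤n
    size>0 (num x) = s≤s z≤n
    size>0 (x ∷ y) = s≤s z≤n

    Poly : (Γ : Family) → (Index Γ → ℕ) → Set₁
    Poly Γ f = Σ[ c ∈ ℕ ] Σ[ e ∈ ℕ ] ∀ x → f x ≤ c * size (input Γ x) ^ e

    module _ {Γ : Family} where

      poly-≤ : ∀ {f g} → (∀ x → f x ≤ g x) → Poly Γ g → Poly Γ f
      poly-≤ f≤g (c , e , g≤) = c , e , λ x → ≤-trans (f≤g x) (g≤ x)

      poly-const : ∀ n → Poly Γ (λ _ → n)
      poly-const n = n , 0 , λ x → ≤-reflexive (sym (*-identityʳ n))

      poly-input : Poly Γ (size ∘ input Γ)
      poly-input = 1 , 1 , λ x → ≤-reflexive (sym (trans (*-identityˡ _) (^-identityʳ _)))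

      private
        ^-grow : ∀ v {i j} → i ≤ j → size v ^ i ≤ size v ^ j
        ^-grow v i≤j = ^-monoʳ-≤ (size v) {{>-nonZero (size>0 v)}} i≤j

      -- Adding the exponents dominates both powers, because sizes are positive; this spares a
      -- maximum.
      poly-+ : ∀ {f g} → Poly Γ f → Poly Γ g → Poly Γ (λ x → f x + g x)
      poly-+ {f} {g} (c , e , f≤) (c′ , e′ , g≤) = c + c′ , e + e′ , λ x →
        let v = input Γ x ; n = size v in begin
        f x + g x                          ≤⟨ +-mono-≤ (f≤ x) (g≤ x) ⟩
        c * n ^ e + c′ * n ^ e′            ≤⟨ +-mono-≤ (*-monoʳ-≤ c (^-grow v (m≤m+n e e′)))
                                                       (*-monoʳ-≤ c′ (^-grow v (m≤n+m e′ e))) ⟩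
        c * n ^ (e + e′) + c′ * n ^ (e + e′) ≡⟨ sym (*-distribʳ-+ (n ^ (e + e′)) c c′) ⟩
        (c + c′) * n ^ (e + e′)            ∎

      poly-* : ∀ {f g} → Poly Γ f → Poly Γ g → Poly Γ (λ x → f x * g x)
      poly-* {f} {g} (c , e , f≤) (c′ , e′ , g≤) = c * c′ , e + e′ , λ x →
        let n = size (input Γ x) in begin
        f x * g x                     ≤⟨ *-mono-≤ (f≤ x) (g≤ x) ⟩
        c * n ^ e * (c′ * n ^ e′)     ≡⟨ [m*n]*[o*p]≡[m*o]*[n*p] c (n ^ e) c′ (n ^ e′) ⟩
        c * c′ * (n ^ e * n ^ e′)     ≡⟨ cong (c * c′ *_) (sym (^-distribˡ-+-* n e e′)) ⟩
        c * c′ * n ^ (e + e′)         ∎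

      poly-^ : ∀ {f} k → Poly Γ f → Poly Γ (λ x → f x ^ k)
      poly-^ zero    P = poly-const 1
      poly-^ (suc k) P = poly-* P (poly-^ k P)

      poly-suc : ∀ {f} → Poly Γ f → Poly Γ (suc ∘ f)
      poly-suc = poly-+ (poly-const 1)

    poly-▸ : ∀ {Γ B f} → Poly Γ f → Poly (Γ ▸ B) (f ∘ proj₁)
    poly-▸ (c , e , f≤) = c , e , f≤ ∘ proj₁

    -- Primitives are charged for the data they read and write, so every bound on time is a bound on
    -- sizes as well. With `writes` this supplies `poly-in` and `poly-out`.
    reads : ∀ {p x y t} → p ⊢ x ⇓ y ⟨ t ⟩ → size x ≤ t
    reads (prim {f} {x})       = m≤m+n (size x) _
    reads (seq r _)            = m≤n⇒m≤1+n (m≤n⇒m≤n+o _ (reads r))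
    reads (pair r _)           = m≤n⇒m≤1+n (m≤n⇒m≤n+o _ (reads r))
    reads (cond-true r _ _)    = m≤n⇒m≤1+n (m≤n⇒m≤n+o _ (reads r))
    reads (cond-false r _)     = m≤n⇒m≤1+n (m≤n⇒m≤n+o _ (reads r))
    reads (while-stop r)       = m≤n⇒m≤1+n (reads r)
    reads (while-step r _ _ _) = m≤n⇒m≤1+n (m≤n⇒m≤n+o _ (m≤n⇒m≤n+o _ (reads r)))

    writes : ∀ {p x y t} → p ⊢ x ⇓ y ⟨ t ⟩ → size y ≤ t
    writes (prim {f} {x})       = m≤n+m _ (size x)
    writes (seq {s = s} _ r)    = m≤n⇒m≤1+n (m≤n⇒m≤o+n s (writes r))
    writes (pair r r′)          = s≤s (+-mono-≤ (writes r) (writes r′))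
    writes (cond-true {s = s} _ _ r) = m≤n⇒m≤1+n (m≤n⇒m≤o+n s (writes r))
    writes (cond-false {s = s} _ r)  = m≤n⇒m≤1+n (m≤n⇒m≤o+n s (writes r))
    writes (while-stop r)       = m≤n⇒m≤1+n (reads r)
    writes (while-step {r = s} {s = t} _ _ _ r) = m≤n⇒m≤1+n (m≤n⇒m≤o+n (s + t) (writes r))

    -- One program takes i x to o x for every member x of the family, in time polynomial
    -- in the size of input Γ x, not of i x. So these derivations compose.
    infix 3 _⊩_↝_
    record _⊩_↝_ (Γ : Family) (i o : Index Γ → Val) : Set₁ where
      field
        prog : Prog
        time : Index Γ → ℕ
        poly : Poly Γ time
        run  : ∀ x → ∃[ t ] (prog ⊢ i x ⇓ o x ⟨ t ⟩ × t ≤ time x)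

      reads-≤ : ∀ x → size (i x) ≤ time x
      reads-≤ x = let _ , r , t≤ = run x in ≤-trans (reads r) t≤

      writes-≤ : ∀ x → size (o x) ≤ time x
      writes-≤ x = let _ , r , t≤ = run x in ≤-trans (writes r) t≤
    open _⊩_↝_

    module _ {Γ : Family} where

      poly-in : ∀ {i o} → Γ ⊩ i ↝ o → Poly Γ (size ∘ i)
      poly-in e = poly-≤ (reads-≤ e) (poly e)

      poly-out : ∀ {i o} → Γ ⊩ i ↝ o → Poly Γ (size ∘ o)
      poly-out e = poly-≤ (writes-≤ e) (poly e)

      convert : ∀ {i o o′} → (∀ x → o x ≡ o′ x) → Γ ⊩ i ↝ o → Γ ⊩ i ↝ o′
      convert {i} eq e = record
        { prog = prog e ; time = time e ; poly = poly e
        ; run = λ x → subst (λ v → ∃[ t ] (prog e ⊢ i x ⇓ v ⟨ t ⟩ × t ≤ time e x)) (eq x) (run e x) }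

      var : ∀ {i} → Poly Γ (size ∘ i) → Γ ⊩ i ↝ i
      var P = record
        { prog = prim idₚ ; poly = poly-+ P P ; run = λ x → _ , prim , ≤-refl }

      infixr 4 _⨟_
      _⨟_ : ∀ {i h o} → Γ ⊩ i ↝ h → Γ ⊩ h ↝ o → Γ ⊩ i ↝ o
      e ⨟ e′ = record
        { prog = prog e ⨾ prog e′
        ; poly = poly-suc (poly-+ (poly e) (poly e′))
        ; run = λ x → let _ , r , s≤ = run e x ; _ , r′ , t≤ = run e′ x in
            _ , seq r r′ , s≤s (+-mono-≤ s≤ t≤) }

      infixr 5 _,ₑ_
      _,ₑ_ : ∀ {i o o′} → Γ ⊩ i ↝ o → Γ ⊩ i ↝ o′ → Γ ⊩ i ↝ (λ x → o x ∷ o′ x)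
      e ,ₑ e′ = record
        { prog = ⟨ prog e , prog e′ ⟩
        ; poly = poly-suc (poly-+ (poly e) (poly e′))
        ; run = λ x → let _ , r , s≤ = run e x ; _ , r′ , t≤ = run e′ x in
            _ , pair r r′ , s≤s (+-mono-≤ s≤ t≤) }

      private
        primitive-app : ∀ f {i o} → Γ ⊩ i ↝ o → Poly Γ (size ∘ apply f ∘ o) → Γ ⊩ i ↝ apply f ∘ o
        primitive-app f e P = e ⨟ record
          { prog = prim f ; poly = poly-+ (poly-out e) P ; run = λ x → _ , prim , ≤-refl }

      headₑ : ∀ {i} o → Γ ⊩ i ↝ o → Γ ⊩ i ↝ apply headₚ ∘ o
      headₑ o e = primitive-app headₚ e (poly-≤ (λ x → bound (o x)) (poly-out e))
        where
        bound : ∀ v → size (apply headₚ v) ≤ size v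
        bound nil     = ≤-refl
        bound (num x) = s≤s z≤n
        bound (x ∷ y) = m≤n⇒m≤1+n (m≤m+n _ _)

      tailₑ : ∀ {i} o → Γ ⊩ i ↝ o → Γ ⊩ i ↝ apply tailₚ ∘ o
      tailₑ o e = primitive-app tailₚ e (poly-≤ (λ x → bound (o x)) (poly-out e))
        where
        bound : ∀ v → size (apply tailₚ v) ≤ size v
        bound nil     = ≤-refl
        bound (num x) = s≤s z≤n
        bound (x ∷ y) = m≤n⇒m≤1+n (m≤n+m _ _)

      fst : ∀ {i} {a b : Index Γ → Val} → Γ ⊩ i ↝ (λ x → a x ∷ b x) → Γ ⊩ i ↝ a
      fst {a = a} {b} e = headₑ (λ x → a x ∷ b x) e

      snd : ∀ {i} {a b : Index Γ → Val} → Γ ⊩ i ↝ (λ x → a x ∷ b x) → Γ ⊩ i ↝ b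
      snd {a = a} {b} e = tailₑ (λ x → a x ∷ b x) e

      nilₑ : ∀ {i h} → Γ ⊩ i ↝ h → Γ ⊩ i ↝ (λ _ → nil)
      nilₑ e = primitive-app nilₚ e (poly-const 1)

      zeroₑ : ∀ {i h} → Γ ⊩ i ↝ h → Γ ⊩ i ↝ (λ _ → num (OrderedField.0# F))
      zeroₑ e = primitive-app 0ₚ e (poly-const _)

      isPairₑ : ∀ {i} o → Γ ⊩ i ↝ o → Γ ⊩ i ↝ apply isPairₚ ∘ o
      isPairₑ o e = primitive-app isPairₚ e (poly-≤ (λ x → bound (o x)) (poly-const 3))
        where
        bound : ∀ v → size (apply isPairₚ v) ≤ 3
        bound nil     = s≤s z≤n
        bound (num x) = s≤s z≤n
        bound (x ∷ y) = ≤-refl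

      module _ where
        open OrderedField F using () renaming (Carrier to K; _+_ to _⊕_; _*_ to _⊗_; _≤?_ to _⊑?_)

        leₑ : ∀ {i} {a b : Index Γ → Val} → Γ ⊩ i ↝ a → Γ ⊩ i ↝ b →
              Γ ⊩ i ↝ (λ x → apply ≤ₚ (a x ∷ b x))
        leₑ {a = a} {b} e e′ =
          primitive-app ≤ₚ (e ,ₑ e′) (poly-≤ (λ x → bound (a x) (b x)) (poly-const 3))
          where
          bound-bool : ∀ t → size (bool t) ≤ 3
          bound-bool false = s≤s z≤n
          bound-bool true  = ≤-refl
          bound : ∀ u v → size (apply ≤ₚ (u ∷ v)) ≤ 3
          bound (num x) (num y) = bound-bool (does (x ⊑? y))
          bound (num x) nil     = s≤s z≤n
          bound (num x) (_ ∷ _) = s≤s z≤n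
          bound nil     _       = s≤s z≤n
          bound (_ ∷ _) _       = s≤s z≤n

        addₑ : ∀ {i} {a b : Index Γ → K} → Γ ⊩ i ↝ num ∘ a → Γ ⊩ i ↝ num ∘ b →
               Γ ⊩ i ↝ (λ x → num (a x ⊕ b x))
        addₑ {a = a} {b} e e′ = primitive-app +ₚ (e ,ₑ e′)
          (poly-≤ (λ x → s≤s (≤-trans (len-+ (a x) (b x))
                    (+-monoˡ-≤ slack (+-mono-≤ (n≤1+n _) (n≤1+n _)))))
            (poly-suc (poly-+ (poly-+ (poly-out e) (poly-out e′)) (poly-const slack))))

        mulₑ : ∀ {i} {a b : Index Γ → K} → Γ ⊩ i ↝ num ∘ a → Γ ⊩ i ↝ num ∘ b →
               Γ ⊩ i ↝ (λ x → num (a x ⊗ b x))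
        mulₑ {a = a} {b} e e′ = primitive-app *ₚ (e ,ₑ e′)
          (poly-≤ (λ x → s≤s (≤-trans (len-* (a x) (b x))
                    (+-monoˡ-≤ slack (+-mono-≤ (n≤1+n _) (n≤1+n _)))))
            (poly-suc (poly-+ (poly-+ (poly-out e) (poly-out e′)) (poly-const slack))))

    pull : ∀ {Γ Γ′ i o} (h : Index Γ′ → Index Γ) → (∀ y → input Γ (h y) ≡ input Γ′ y) →
           Γ ⊩ i ↝ o → Γ′ ⊩ i ∘ h ↝ o ∘ h
    pull h eq record { prog = p ; poly = (c , e , ≤P) ; run = run } = record
      { prog = p
      ; poly = c , e , λ y → subst (λ v → _ ≤ c * size v ^ e) (eq y) (≤P (h y))
      ; run  = run ∘ h }

    under : ∀ {Γ B i o} → Γ ⊩ i ↝ o → Γ ▸ B ⊩ i ∘ proj₁ ↝ o ∘ proj₁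
    under = pull proj₁ (λ _ → refl)

    ifV : Val → Val → Val → Val
    ifV nil u v = v
    ifV _   u v = u

    module _ {Γ : Family} where

      ifₑ : ∀ {i c u v} → Γ ⊩ i ↝ c → Γ ⊩ i ↝ u → Γ ⊩ i ↝ v → Γ ⊩ i ↝ (λ x → ifV (c x) (u x) (v x))
      ifₑ {i} {c} {u} {v} e e₁ e₂ = record
        { prog = p
        ; poly = poly-suc (poly-+ (poly e) (poly-+ (poly e₁) (poly e₂)))
        ; run = λ x → branch x (c x) (run e x) }
        where
        p = cond (prog e) (prog e₁) (prog e₂)
        branch : ∀ x w → ∃[ t ] (prog e ⊢ i x ⇓ w ⟨ t ⟩ × t ≤ time e x) →
                 ∃[ t ] (p ⊢ i x ⇓ ifV w (u x) (v x) ⟨ t ⟩ ×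
                         t ≤ suc (time e x + (time e₁ x + time e₂ x)))
        branch x nil (_ , r , s≤) = let _ , r′ , t≤ = run e₂ x in
          _ , cond-false r r′ , s≤s (+-mono-≤ s≤ (m≤n⇒m≤o+n _ t≤))
        branch x (num _) (_ , r , s≤) = let _ , r′ , t≤ = run e₁ x in
          _ , cond-true r (num _) r′ , s≤s (+-mono-≤ s≤ (m≤n⇒m≤n+o _ t≤))
        branch x (_ ∷ _) (_ , r , s≤) = let _ , r′ , t≤ = run e₁ x in
          _ , cond-true r (pair _ _) r′ , s≤s (+-mono-≤ s≤ (m≤n⇒m≤n+o _ t≤))

      -- Here the first branch only has to run on the members that reach it.
      whenₑ : ∀ {i o} (c : Index Γ → Bool) → Γ ⊩ i ↝ bool ∘ c →
              Γ ▸ (λ x → c x ≡ true) ⊩ i ∘ proj₁ ↝ o ∘ proj₁ →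
              (∀ x → c x ≡ false → o x ≡ nil) → Γ ⊩ i ↝ o
      whenₑ {i} {o} c e e₁@(record { poly = c₁ , k₁ , ≤₁ }) o≡nil = record
        { prog = p
        -- The time of the first branch is defined only where the condition holds; its polynomial
        -- bound makes sense everywhere and stands in for it.
        ; poly = poly-suc (poly-+ (poly e) (poly-+ (c₁ , k₁ , λ _ → ≤-refl) (poly d)))
        ; run = λ x → branch x (c x) refl (run e x) }
        where
        d = nilₑ (var (poly-in e))
        p = cond (prog e) (prog e₁) (prog d)
        branch : ∀ x w → c x ≡ w → ∃[ t ] (prog e ⊢ i x ⇓ bool w ⟨ t ⟩ × t ≤ time e x) →
                 ∃[ t ] (p ⊢ i x ⇓ o x ⟨ t ⟩ ×
                         t ≤ suc (time e x + (c₁ * size (input Γ x) ^ k₁ + time d x)))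
        branch x true  eq (_ , r , s≤) = let _ , r′ , t≤ = run e₁ (x , eq) in
          _ , cond-true r (pair _ _) r′ , s≤s (+-mono-≤ s≤ (m≤n⇒m≤n+o _ (≤-trans t≤ (≤₁ (x , eq)))))
        branch x false eq (_ , r , s≤) rewrite o≡nil x eq = let _ , r′ , t≤ = run d x in
          _ , cond-false r r′ , s≤s (+-mono-≤ s≤ (m≤n⇒m≤o+n _ t≤))

    -- Loops over coded lists

    listV : List Val → Val
    listV = List.foldr _∷_ nil

    list-allFin : ∀ {n} (f : Fin n → Val) → list f ≡ listV (List.map f (allFin n))
    list-allFin f = trans (go f) (cong listV (sym (List.map-tabulate id f)))
      where
      go : ∀ {n} (f : Fin n → Val) → list f ≡ listV (List.tabulate f)
      go {zero}  f = refl
      go {suc n} f = cong (f zero ∷_) (go (f ∘ suc))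

    -- A zipper: the position of a loop in its list, with the consumed elements in reverse, as an
    -- accumulator holds them. As part of an index it lets one derivation treat the body at all
    -- positions.
    record Split {A : Set} (xs : List A) : Set where
      constructor split
      field
        done : List A
        this : A
        rest : List A
        eq   : done ʳ++ (this ∷ rest) ≡ xs
    open Split public

    this∈ : ∀ {A : Set} {xs : List A} (s : Split xs) → this s ∈ᴸ xs
    this∈ (split done a rest refl) = go done (here refl)
      where
      go : ∀ {A : Set} {a : A} {ys} zs → a ∈ᴸ ys → a ∈ᴸ zs ʳ++ ys
      go []       a∈ = a∈
      go (z ∷ zs) a∈ = go zs (there a∈)

    size-listV-∈ : ∀ {A : Set} (enc : A → Val) {a} xs → a ∈ᴸ xs → size (enc a) ≤ size (listV (List.map enc xs))
    size-listV-∈ enc (x ∷ xs) (here refl) = m≤n⇒m≤1+n (m≤m+n _ _)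
    size-listV-∈ enc (x ∷ xs) (there a∈)  = m≤n⇒m≤1+n (m≤n⇒m≤o+n _ (size-listV-∈ enc xs a∈))

    size-listV-ʳ++ : ∀ {A : Set} (enc : A → Val) xs ys →
                     size (listV (List.map enc ys)) ≤ size (listV (List.map enc (xs ʳ++ ys)))
    size-listV-ʳ++ enc []       ys = ≤-refl
    size-listV-ʳ++ enc (x ∷ xs) ys =
      ≤-trans (m≤n⇒m≤1+n (m≤n+m _ _)) (size-listV-ʳ++ enc xs (x ∷ ys))

    size-listV-≤ : ∀ {A : Set} (enc : A → Val) B xs → (∀ {a} → a ∈ᴸ xs → size (enc a) ≤ B) →
                   size (listV (List.map enc xs)) ≤ suc (length xs * suc B)
    size-listV-≤ enc B []       h = ≤-refl
    size-listV-≤ enc B (x ∷ xs) h = s≤s (begin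
      size (enc x) + size (listV (List.map enc xs)) ≤⟨ +-mono-≤ (h (here refl)) (size-listV-≤ enc B xs (h ∘ there)) ⟩
      B + suc (length xs * suc B)                   ≡⟨ +-suc B _ ⟩
      suc B + length xs * suc B                     ∎)

    length≤size : ∀ {A : Set} (enc : A → Val) xs → length xs ≤ size (listV (List.map enc xs))
    length≤size enc []       = z≤n
    length≤size enc (x ∷ xs) = s≤s (m≤n⇒m≤o+n _ (length≤size enc xs))

    module _ {Γ : Family} {i : Index Γ → Val} {A : Index Γ → Set}
             (enc : ∀ x → A x → Val) (xs : ∀ x → List (A x)) where

      private
        code-xs : Index Γ → Val
        code-xs x = listV (List.map (enc x) (xs x))

      poly-this : Poly Γ (size ∘ code-xs) → Poly (Γ ▸ Split ∘ xs) (λ (x , s) → size (enc x (this s)))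
      poly-this P = poly-≤ {Γ ▸ Split ∘ xs} (λ (x , s) → size-listV-∈ (enc x) (xs x) (this∈ s)) (poly-▸ {B = Split ∘ xs} P)

      -- Sizes cannot compound over the rounds: the time of the body is polynomial in the outer
      -- input at every position, so by `writes` each state it produces is too. The total is then
      -- the number of rounds times a common bound.
      loopₑ : (st : ∀ x → List (A x) → List (A x) → Val) →
              Γ ⊩ i ↝ code-xs → Γ ⊩ i ↝ (λ x → st x [] (xs x)) →
              Γ ▸ Split ∘ xs ⊩
                (λ (x , s) → enc x (this s) ∷ st x (done s) (this s ∷ rest s) ∷ i x) ↝
                (λ (x , s) → st x (this s ∷ done s) (rest s)) →
              Γ ⊩ i ↝ (λ x → st x (reverse (xs x)) [])
      loopₑ st l z b@(record { poly = cb , kb , ≤b }) =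
        (l ,ₑ z ,ₑ var (poly-in l)) ⨟ loop ⨟ fst (snd (var (poly-≤ final-size
          (poly-suc (poly-+ (poly-const 1) (poly-suc (poly-+ poly-W (poly l))))))))
        where
        -- Bounds for a run of the given body, for the state, for the whole value that the loop
        -- carries, for one primitive, and for one pass through `body`.
        B W Z P K : Index Γ → ℕ
        B x = cb * size (input Γ x) ^ kb
        W x = time z x + B x
        Z x = suc (time l x + suc (W x + time l x))
        P x = Z x + Z x
        K x = suc (suc (P x + P x) + suc (suc (suc (suc (P x + P x) + P x) + B x) + suc (P x + P x)))

        poly-B : Poly Γ B
        poly-B = cb , kb , λ _ → ≤-refl
        poly-W : Poly Γ W
        poly-W = poly-+ (poly z) poly-B
        poly-P : Poly Γ P
        poly-P = poly-+ poly-Z poly-Z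
          where
          poly-Z : Poly Γ Z
          poly-Z = poly-suc (poly-+ (poly l) (poly-suc (poly-+ poly-W (poly l))))
        poly-PP : Poly Γ (λ x → suc (P x + P x))
        poly-PP = poly-suc (poly-+ poly-P poly-P)
        poly-K : Poly Γ K
        poly-K = poly-suc (poly-+ poly-PP
          (poly-suc (poly-+ (poly-suc (poly-+ (poly-suc (poly-+ poly-PP poly-P)) poly-B)) poly-PP)))

        test body : Prog
        -- The head of the carried value is the code of the remaining list, which is `nil` exactly
        -- when no element is left.
        test = prim headₚ
        body = ⟨ prim headₚ ⨾ prim tailₚ
               , ⟨ ⟨ prim headₚ ⨾ prim headₚ , prim tailₚ ⟩ ⨾ prog b , prim tailₚ ⨾ prim tailₚ ⟩ ⟩

        state : ∀ x → List (A x) → List (A x) → Val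
        state x ds rs = listV (List.map (enc x) rs) ∷ st x ds rs ∷ i x

        size-rest : ∀ x ds rs → ds ʳ++ rs ≡ xs x → size (listV (List.map (enc x) rs)) ≤ time l x
        size-rest x ds rs eq = ≤-trans (size-listV-ʳ++ (enc x) ds rs)
          (subst (λ ys → size (listV (List.map (enc x) ys)) ≤ time l x) (sym eq) (writes-≤ l x))

        iterate : ∀ x ds rs → ds ʳ++ rs ≡ xs x → size (st x ds rs) ≤ W x →
          ∃[ t ] (while test body ⊢ state x ds rs ⇓ state x (reverse (xs x)) [] ⟨ t ⟩ ×
                  t ≤ suc (length rs) * suc (P x + K x) × size (st x (reverse (xs x)) []) ≤ W x)
        iterate x ds [] eq st≤ = subst (λ es →
            ∃[ t ] (while test body ⊢ state x ds [] ⇓ state x es [] ⟨ t ⟩ ×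
                    t ≤ 1 * suc (P x + K x) × size (st x es []) ≤ W x))
          (trans (sym (List.reverse-involutive ds)) (cong reverse eq))
          (_ , while-stop prim ,
           ≤-trans (s≤s (≤-trans (+-mono-≤ Z≤ (≤-trans (s≤s z≤n) Z≤)) (m≤m+n (P x) (K x))))
                   (≤-reflexive (sym (*-identityˡ _))) ,
           st≤)
          where
          Z≤ : size (state x ds []) ≤ Z x
          Z≤ = s≤s (+-mono-≤ (size-rest x ds [] eq) (s≤s (+-mono-≤ st≤ (reads-≤ l x))))
        iterate x ds (a ∷ rs) eq st≤ =
          let y = x , split ds a rs eq
              _ , r , t≤ = run b y
              B≤ = ≤b y
              _ , r′ , t′≤ , fin≤ = iterate x (a ∷ ds) rs eq
                (≤-trans (writes-≤ b y) (≤-trans B≤ (m≤n+m (B x) (time z x))))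
          in _
           , while-step prim (pair _ _)
               (pair (seq prim prim) (pair (seq (pair (seq prim prim) prim) r) (seq prim prim))) r′
           , s≤s (+-mono-≤ (+-mono-≤ (pp Z≤ h≤)
               (s≤s (+-mono-≤ (s≤s (+-mono-≤ (pp Z≤ h≤) (pp h≤ t≤Z)))
                 (s≤s (+-mono-≤ (s≤s (+-mono-≤ (s≤s (+-mono-≤ (s≤s (+-mono-≤ (pp Z≤ h≤) (pp h≤ a≤)))
                      (pp Z≤ s≤))) (≤-trans t≤ B≤)))
                   (s≤s (+-mono-≤ (pp Z≤ s≤) (pp s≤ i≤)))))))) t′≤)
           , fin≤
          where
          h = size-rest x ds (a ∷ rs) eq
          pp : ∀ {m n} → m ≤ Z x → n ≤ Z x → m + n ≤ P x
          pp = +-mono-≤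
          Z≤ : size (state x ds (a ∷ rs)) ≤ Z x
          Z≤ = s≤s (+-mono-≤ h (s≤s (+-mono-≤ st≤ (reads-≤ l x))))
          h≤ : size (listV (List.map (enc x) (a ∷ rs))) ≤ Z x
          h≤ = ≤-trans (m≤n⇒m≤1+n (m≤m+n _ _)) Z≤
          t≤Z : size (listV (List.map (enc x) rs)) ≤ Z x
          t≤Z = ≤-trans (m≤n⇒m≤1+n (m≤n+m _ _)) h≤
          a≤ : size (enc x a) ≤ Z x
          a≤ = ≤-trans (m≤n⇒m≤1+n (m≤m+n _ _)) h≤
          s≤ : size (st x ds (a ∷ rs) ∷ i x) ≤ Z x
          s≤ = ≤-trans (m≤n⇒m≤1+n (m≤n+m _ (size (listV (List.map (enc x) (a ∷ rs)))))) Z≤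
          i≤ : size (i x) ≤ Z x
          i≤ = ≤-trans (m≤n⇒m≤1+n (m≤n+m _ (size (st x ds (a ∷ rs))))) s≤

        outcome = λ x → iterate x [] (xs x) refl (≤-trans (writes-≤ z x) (m≤m+n (time z x) (B x)))

        final-size : ∀ x → size (state x (reverse (xs x)) []) ≤ suc (1 + suc (W x + time l x))
        final-size x = let _ , _ , _ , st≤ = outcome x in
          s≤s (+-mono-≤ (≤-refl {1}) (s≤s (+-mono-≤ st≤ (reads-≤ l x))))

        loop : Γ ⊩ (λ x → state x [] (xs x)) ↝ (λ x → state x (reverse (xs x)) [])
        loop = record
          { prog = while test body
          ; poly = poly-* (poly-suc (poly-≤ (λ x → ≤-trans (length≤size (enc x) (xs x)) (writes-≤ l x)) (poly l)))
                          (poly-suc (poly-+ poly-P poly-K))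
          ; run  = λ x → let t , r , t≤ , _ = outcome x in t , r , t≤ }

    size-ʳ++ : ∀ {A : Set} (enc : A → Val) xs ys →
               suc (size (listV (List.map enc (xs ʳ++ ys)))) ≡
               size (listV (List.map enc xs)) + size (listV (List.map enc ys))
    size-ʳ++ enc []       ys = refl
    size-ʳ++ enc (x ∷ xs) ys = begin-equality
      suc (size (code (xs ʳ++ (x ∷ ys))))           ≡⟨ size-ʳ++ enc xs (x ∷ ys) ⟩
      size (code xs) + suc (size (enc x) + size (code ys)) ≡⟨ +-suc _ _ ⟩
      suc (size (code xs) + (size (enc x) + size (code ys))) ≡⟨ cong suc (sym (+-assoc (size (code xs)) _ _)) ⟩
      suc (size (code xs) + size (enc x) + size (code ys))
        ≡⟨ cong (λ n → suc (n + size (code ys))) (+-comm (size (code xs)) (size (enc x))) ⟩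
      suc (size (enc x) + size (code xs)) + size (code ys) ∎
      where
      code : List _ → Val
      code = listV ∘ List.map enc

    size-done : ∀ {A : Set} (enc : A → Val) {xs} (s : Split xs) →
                size (listV (List.map enc (done s))) ≤ size (listV (List.map enc xs))
    size-done enc (split ds a rs refl) = s≤s⁻¹ (begin
      suc (size (listV (List.map enc ds)))                      ≡⟨ +-comm 1 _ ⟩
      size (listV (List.map enc ds)) + 1                        ≤⟨ +-monoʳ-≤ _ (size>0 (enc a ∷ listV (List.map enc rs))) ⟩
      size (listV (List.map enc ds)) + size (listV (List.map enc (a ∷ rs))) ≡⟨ size-ʳ++ enc ds (a ∷ rs) ⟨
      suc (size (listV (List.map enc (ds ʳ++ (a ∷ rs)))))       ∎)

    size-rest : ∀ {A : Set} (enc : A → Val) {xs} (s : Split xs) →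
                size (listV (List.map enc (rest s))) ≤ size (listV (List.map enc xs))
    size-rest enc (split ds a rs refl) =
      ≤-trans (m≤n⇒m≤1+n (m≤n+m _ _)) (size-listV-ʳ++ enc ds (a ∷ rs))

    ∈-ʳ++⁺ʳ : ∀ {A : Set} {a : A} ds {rs} → a ∈ᴸ rs → a ∈ᴸ ds ʳ++ rs
    ∈-ʳ++⁺ʳ []       a∈ = a∈
    ∈-ʳ++⁺ʳ (d ∷ ds) a∈ = ∈-ʳ++⁺ʳ ds (there a∈)

    rest⊆ : ∀ {A : Set} {xs : List A} (s : Split xs) → ∀ {a} → a ∈ᴸ rest s → a ∈ᴸ xs
    rest⊆ (split ds _ _ refl) a∈ = ∈-ʳ++⁺ʳ ds (there a∈)

    Split-reverse : ∀ {A : Set} {xs : List A} → Split (reverse xs) → Split xs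
    Split-reverse {xs = xs} (split ds a rs eq) = split rs a ds (
      trans (cong (λ es → rs ʳ++ (a ∷ es)) (sym (List.++-identityʳ ds)))
        (trans (sym (List.ʳ++-ʳ++ ds)) (trans (cong reverse eq) (List.reverse-involutive xs))))

    reindex : ∀ {Γ B B′ i o} (h : ∀ {x} → B′ x → B x) → Γ ▸ B ⊩ i ↝ o →
              Γ ▸ B′ ⊩ (λ (x , b) → i (x , h b)) ↝ (λ (x , b) → o (x , h b))
    reindex h = pull (λ (x , b) → x , h b) (λ _ → refl)

    module _ {Γ : Family} {i : Index Γ → Val} {A : Index Γ → Set}
             (enc : ∀ x → A x → Val) (xs : ∀ x → List (A x)) where

      private
        code : (∀ x → List (A x)) → Index Γ → Val
        code ys x = listV (List.map (enc x) (ys x))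

      reverseₑ : Γ ⊩ i ↝ code xs → Γ ⊩ i ↝ code (reverse ∘ xs)
      reverseₑ l = loopₑ enc xs (λ x ds rs → listV (List.map (enc x) ds)) l (nilₑ l)
        (fst v ,ₑ fst (snd v))
        where
        v = var (poly-suc (poly-+ (poly-this {i = i} enc xs (poly-out l)) (poly-suc (poly-+
              (poly-≤ (λ (x , s) → size-done (enc x) s) (poly-▸ {B = Split ∘ xs} (poly-out l)))
              (poly-▸ {B = Split ∘ xs} (poly-in l))))))

    module _ {Γ : Family} {i : Index Γ → Val} {A : Index Γ → Set}
             (enc : ∀ x → A x → Val) (xs : ∀ x → List (A x)) where

      private
        code : Index Γ → Val
        code x = listV (List.map (enc x) (xs x))

      -- Loops consume lists from the left, so a right fold runs over the reversed list.
      foldₑ : (st : ∀ x → List (A x) → Val) → Γ ⊩ i ↝ code → Γ ⊩ i ↝ (λ x → st x []) →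
              Γ ▸ Split ∘ xs ⊩ (λ (x , s) → enc x (this s) ∷ st x (rest s) ∷ i x) ↝
                               (λ (x , s) → st x (this s ∷ rest s)) →
              Γ ⊩ i ↝ (λ x → st x (xs x))
      foldₑ st l z b =
        convert (λ x → cong (st x) (List.reverse-involutive (xs x)))
          (loopₑ enc (reverse ∘ xs) (λ x ds _ → st x ds) (reverseₑ enc xs l) z (reindex Split-reverse b))

      poly-fold-input : {st : ∀ x → List (A x) → Val} → Γ ⊩ i ↝ code →
                        Poly (Γ ▸ Split ∘ xs) (λ (x , s) → size (st x (rest s))) →
                        Poly (Γ ▸ Split ∘ xs) (λ (x , s) → size (enc x (this s) ∷ st x (rest s) ∷ i x))
      poly-fold-input l P = poly-suc (poly-+ (poly-this {i = i} enc xs (poly-out l))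
        (poly-suc (poly-+ P (poly-▸ {B = Split ∘ xs} (poly-in l)))))

      Member : Index Γ → Set
      Member x = Σ[ a ∈ A x ] a ∈ᴸ xs x

      poly-member : Γ ⊩ i ↝ code → Poly (Γ ▸ Member) (λ (x , a , _) → size (enc x a ∷ i x))
      poly-member l = poly-suc (poly-+
        (poly-≤ {Γ ▸ Member} (λ (x , a , a∈) → size-listV-∈ (enc x) (xs x) a∈) (poly-▸ {B = Member} (poly-out l)))
        (poly-▸ {B = Member} (poly-in l)))

      mapₑ : (g : ∀ x → A x → Val) → Γ ⊩ i ↝ code →
             Γ ▸ Member ⊩ (λ (x , a , _) → enc x a ∷ i x) ↝ (λ (x , a , _) → g x a) →
             Γ ⊩ i ↝ (λ x → listV (List.map (g x) (xs x)))
      mapₑ g l b = foldₑ (λ x ys → listV (List.map (g x) ys)) l (nilₑ l)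
        (((fst v ,ₑ snd (snd v)) ⨟ reindex (λ s → this s , this∈ s) b) ,ₑ fst (snd v))
        where
        P = poly-out b
        c = proj₁ P
        e = proj₁ (proj₂ P)
        B : Index Γ → ℕ
        B x = c * size (input Γ x) ^ e
        poly-L : Poly Γ (λ x → suc (size (code x) * suc (B x)))
        poly-L = poly-suc (poly-* (poly-out l) (poly-suc (c , e , λ _ → ≤-refl)))
        v = var (poly-fold-input l (poly-≤
              (λ (x , s) → ≤-trans
                (size-listV-≤ (g x) (B x) (rest s) (λ {a} a∈ → proj₂ (proj₂ P) (x , a , rest⊆ s a∈)))
                (s≤s (*-monoˡ-≤ (suc (B x))
                  (≤-trans (length≤size (enc x) (rest s)) (size-rest (enc x) s)))))
              (poly-▸ {B = Split ∘ xs} poly-L)))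

    -- Unlike list, which is a fold, an abstract name lets Agda infer the vector.
    abstract
      vec : ∀ {n} → (Fin n → Val) → Val
      vec = list

      vec≡list : ∀ {n} (f : Fin n → Val) → vec f ≡ list f
      vec≡list f = refl

    vec-allFin : ∀ {n} (f : Fin n → Val) → vec f ≡ listV (List.map f (allFin n))
    vec-allFin f = trans (vec≡list f) (list-allFin f)

    module _ {Γ : Family} {i : Index Γ → Val} {n : Index Γ → ℕ} where

      private
        points : ∀ x → List (Fin (n x))
        points x = allFin (n x)

        toList : ∀ {f : ∀ x → Fin (n x) → Val} → Γ ⊩ i ↝ (λ x → vec (f x)) →
                 Γ ⊩ i ↝ (λ x → listV (List.map (f x) (points x)))
        toList {f} = convert (λ x → vec-allFin (f x))

        fromList : ∀ {f : ∀ x → Fin (n x) → Val} → Γ ⊩ i ↝ (λ x → listV (List.map (f x) (points x))) →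
                   Γ ⊩ i ↝ (λ x → vec (f x))
        fromList {f} = convert (λ x → sym (vec-allFin (f x)))

      poly-entry : {f : ∀ x → Fin (n x) → Val} → Γ ⊩ i ↝ (λ x → vec (f x)) →
                   Poly (Γ ▸ Fin ∘ n) (λ (x , p) → size (f x p ∷ i x))
      poly-entry {f} l =
        let c , e , ≤P = poly-member f points (toList l) in c , e , λ (x , p) → ≤P (x , p , ∈-allFin p)

      vmapₑ : {f : ∀ x → Fin (n x) → Val} (g : ∀ x → Fin (n x) → Val) → Γ ⊩ i ↝ (λ x → vec (f x)) →
              Γ ▸ Fin ∘ n ⊩ (λ (x , p) → f x p ∷ i x) ↝ (λ (x , p) → g x p) →
              Γ ⊩ i ↝ (λ x → vec (g x))
      vmapₑ {f} g l b = fromList (mapₑ f points g (toList l) (reindex proj₁ b))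

      -- The loop runs over the first list and keeps the rest of the second in its state; the pairs
      -- pile up in reverse order and are turned around at the end.
      vzipₑ : {f g : ∀ x → Fin (n x) → Val} → Γ ⊩ i ↝ (λ x → vec (f x)) → Γ ⊩ i ↝ (λ x → vec (g x)) →
              Γ ⊩ i ↝ (λ x → vec (λ p → f x p ∷ g x p))
      vzipₑ {f} {g} l m = fromList (convert
        (λ x → cong (λ ps → listV (List.map (h x) ps)) (List.reverse-involutive (points x)))
        (reverseₑ h (reverse ∘ points) (snd (loopₑ f points
          (λ x ds rs → listV (List.map (g x) rs) ∷ listV (List.map (h x) ds)) (toList l)
          (toList m ,ₑ nilₑ l)
          (snd (fst (fst (snd v))) ,ₑ (fst v ,ₑ fst (fst (fst (snd v)))) ,ₑ snd (fst (snd v)))))))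
        where
        h : ∀ x → Fin (n x) → Val
        h x p = f x p ∷ g x p
        up : ∀ {k} → Poly Γ k → Poly (Γ ▸ Split ∘ points) (k ∘ proj₁)
        up = poly-▸ {B = Split ∘ points}
        todo : ∀ x → Split (points x) → Val
        todo x s = listV (List.map (g x) (this s ∷ rest s))
        size-todo : ∀ x (s : Split (points x)) → size (todo x s) ≤ size (vec (g x))
        size-todo x (split ds p rs ps≡) = ≤-trans (size-listV-ʳ++ (g x) ds (p ∷ rs))
          (≤-reflexive (cong size (trans (cong (listV ∘ List.map (g x)) ps≡) (sym (vec-allFin (g x))))))
        size-zipped : ∀ x ps → size (listV (List.map (h x) ps)) ≤
                      size (listV (List.map (f x) ps)) + size (listV (List.map (g x) ps))
        size-zipped x []       = s≤s z≤n
        size-zipped x (p ∷ ps) = begin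
          suc (suc (size (f x p) + size (g x p)) + size (listV (List.map (h x) ps)))
            ≤⟨ s≤s (s≤s (+-monoʳ-≤ (size (f x p) + size (g x p)) (size-zipped x ps))) ⟩
          suc (suc (size (f x p) + size (g x p)) + (size (listV (List.map (f x) ps)) + size (listV (List.map (g x) ps))))
            ≡⟨ shuffle (size (f x p)) (size (g x p)) _ _ ⟩
          size (listV (List.map (f x) (p ∷ ps))) + size (listV (List.map (g x) (p ∷ ps))) ∎
          where
          shuffle : ∀ a b c d → suc (suc (a + b) + (c + d)) ≡ suc (a + c) + suc (b + d)
          shuffle = solve-∀
        v : Γ ▸ Split ∘ points ⊩ _ ↝ (λ (x , s) → f x (this s) ∷ (todo x s ∷ listV (List.map (h x) (done s))) ∷ i x)
        v = var (poly-suc (poly-+ (poly-this {i = i} f points (poly-out (toList l)))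
          (poly-suc (poly-+ (poly-suc (poly-+ (poly-≤ (λ (x , s) → size-todo x s) (up (poly-out m)))
              (poly-≤ (λ (x , s) → ≤-trans (size-zipped x (done s)) (+-mono-≤ (size-done (f x) s) (size-done (g x) s)))
                (up (poly-+ (poly-out (toList l)) (poly-out (toList m)))))))
            (up (poly-in l))))))

    list-cong : ∀ {n} {f g : Fin n → Val} → (∀ p → f p ≡ g p) → list f ≡ list g
    list-cong {zero}  f≗g = refl
    list-cong {suc n} f≗g = cong₂ _∷_ (f≗g zero) (list-cong (f≗g ∘ suc))

    vec-cong : ∀ {n} {f g : Fin n → Val} → (∀ p → f p ≡ g p) → vec f ≡ vec g
    vec-cong {f = f} {g} f≗g = trans (vec≡list f) (trans (list-cong f≗g) (sym (vec≡list g)))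

    -- Calls of given algorithms, and minima

    module _ {X : Set₁} {inp : X → Val} {Spec : X → Val → Set} where

      -- A specification may admit many outputs. Naming the one that the program returns makes it a
      -- function of the index, as the output of a derivation has to be.
      answer : PolyTime inp Spec → X → Val
      answer (_ , _ , _ , run) x = proj₁ (run x)

      answer-correct : (P : PolyTime inp Spec) → ∀ x → Spec x (answer P x)
      answer-correct (_ , _ , _ , run) x = let _ , _ , _ , _ , spec = run x in spec

    ⊩⇒PolyTime : ∀ {X : Set₁} {inp o : X → Val} {Spec : X → Val → Set} →
                 family X inp ⊩ inp ↝ o → (∀ x → Spec x (o x)) → PolyTime inp Spec
    ⊩⇒PolyTime record { prog = p ; poly = (c , e , time≤) ; run = run } correct = p , c , e , λ x →
      let t , r , t≤ = run x in _ , t , r , ≤-trans t≤ (time≤ x) , correct x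

    module _ {Γ : Family} {i : Index Γ → Val} where

      anyₑ : {n : Index Γ → ℕ} (c : ∀ x → Fin (n x) → Bool) → Γ ⊩ i ↝ (λ x → vec (bool ∘ c x)) →
             Γ ⊩ i ↝ (λ x → bool (any (c x) (allFin (n x))))
      anyₑ {n} c l = foldₑ (λ x → bool ∘ c x) points (λ x ps → bool (any (c x) ps)) l′ (nilₑ l)
        (convert (λ (x , s) → or (c x (this s)) (any (c x) (rest s)))
          (ifₑ (fst v) (fst v) (fst (snd v))))
        where
        points : ∀ x → List (Fin (n x))
        points x = allFin (n x)
        l′ = convert (λ x → vec-allFin (bool ∘ c x)) l
        size-bool : ∀ t → size (bool t) ≤ 3
        size-bool false = s≤s z≤n
        size-bool true  = ≤-refl
        v = var (poly-fold-input (λ x → bool ∘ c x) points {st = λ x ps → bool (any (c x) ps)} l′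
              (poly-≤ (λ _ → size-bool _) (poly-const 3)))
        or : ∀ s t → ifV (bool s) (bool s) (bool t) ≡ bool (s ∨ t)
        or false t = refl
        or true  t = refl

      -- Polynomials compose: the bound of the called program refers to the size of its own
      -- argument, and that size is polynomial in the outer input by `poly-out`.
      callₑ : ∀ {X : Set₁} {inp : X → Val} {Spec : X → Val → Set} (P : PolyTime inp Spec)
              (h : Index Γ → X) → Γ ⊩ i ↝ inp ∘ h →
              Γ ⊩ i ↝ answer P ∘ h
      callₑ (p , c , e , run) h a = a ⨟ record
        { prog = p
        ; poly = poly-* (poly-const c) (poly-^ e (poly-out a))
        ; run = λ x → let _ , t , r , t≤ , _ = run (h x) in t , r , t≤ }

    open OrderedField F using () renaming (Carrier to K; _≤?_ to _⊑?_)

    module _ {A : Set} where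

      -- Here `nothing` acts as an infinite value.
      better : Maybe (K × A) → Maybe (K × A) → Maybe (K × A)
      better (just (u , a)) (just (v , b)) = if does (u ⊑? v) then just (u , a) else just (v , b)
      better (just a)       nothing        = just a
      better nothing        b              = b

      argmin : List (Maybe (K × A)) → Maybe (K × A)
      argmin = List.foldr better nothing

      encodeMaybe : (A → Val) → Maybe (K × A) → Val
      encodeMaybe enc nothing        = nil
      encodeMaybe enc (just (v , a)) = num v ∷ enc a

      private
        size-better : ∀ enc m m′ → size (encodeMaybe enc (better m m′)) ≤
                                   size (encodeMaybe enc m) + size (encodeMaybe enc m′)
        size-better enc (just (u , a)) (just (v , _)) with does (u ⊑? v)
        ... | true  = m≤m+n _ _
        ... | false = m≤n+m _ (size (encodeMaybe enc (just (u , a))))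
        size-better enc (just _) nothing = m≤m+n _ _
        size-better enc nothing  m       = m≤n+m _ 1

      size-argmin : ∀ enc ms → size (encodeMaybe enc (argmin ms)) ≤ size (listV (List.map (encodeMaybe enc) ms))
      size-argmin enc []       = ≤-refl
      size-argmin enc (m ∷ ms) = m≤n⇒m≤1+n (≤-trans (size-better enc m (argmin ms))
        (+-monoʳ-≤ (size (encodeMaybe enc m)) (size-argmin enc ms)))

    module _ {Γ : Family} {i : Index Γ → Val} {A : Index Γ → Set} (enc : ∀ x → A x → Val) where

      argminₑ : (ms : ∀ x → List (Maybe (K × A x))) →
                Γ ⊩ i ↝ (λ x → listV (List.map (encodeMaybe (enc x)) (ms x))) →
                Γ ⊩ i ↝ (λ x → encodeMaybe (enc x) (argmin (ms x)))
      argminₑ ms l = foldₑ enc? ms st l (nilₑ l)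
        (convert (λ (x , s) → step (enc x) (this s) (argmin (rest s)))
          (ifₑ (fst v) (ifₑ (fst (snd v)) (ifₑ (leₑ (headₑ _ (fst v)) (headₑ _ (fst (snd v)))) (fst v) (fst (snd v))) (fst v))
            (fst (snd v))))
        where
        enc? : ∀ x → Maybe (K × A x) → Val
        enc? x = encodeMaybe (enc x)
        st : ∀ x → List (Maybe (K × A x)) → Val
        st x ms = enc? x (argmin ms)
        v = var (poly-fold-input enc? ms {st = st} l (poly-≤
              (λ (x , s) → ≤-trans (size-argmin (enc x) (rest s)) (size-rest (enc? x) s))
              (poly-▸ {B = Split ∘ ms} (poly-out l))))
        step : ∀ {B : Set} (e : B → Val) m m′ →
               let a = encodeMaybe e m ; b = encodeMaybe e m′ in
               ifV a (ifV b (ifV (apply ≤ₚ (apply headₚ a ∷ apply headₚ b)) a b) a) b ≡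
               encodeMaybe e (better m m′)
        step e (just (u , _)) (just (v , _)) with does (u ⊑? v)
        ... | true  = refl
        ... | false = refl
        step e (just _) nothing = refl
        step e nothing  m       = refl

      vargminₑ : {n : Index Γ → ℕ} (ms : ∀ x → Fin (n x) → Maybe (K × A x)) →
                 Γ ⊩ i ↝ (λ x → vec (encodeMaybe (enc x) ∘ ms x)) →
                 Γ ⊩ i ↝ (λ x → encodeMaybe (enc x) (argmin (List.map (ms x) (allFin (n x)))))
      vargminₑ ms l = argminₑ (λ x → List.map (ms x) (allFin _))
        (convert (λ x → trans (vec-allFin (encodeMaybe (enc x) ∘ ms x)) (cong listV (List.map-∘ {g = encodeMaybe (enc x)} {f = ms x} (allFin _)))) l)

  -- Prim's algorithm and the dynamic program

  module Algorithm where
    open import Relation.Binary.PropositionalEquality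
    open OrderedField F using (Carrier; _≤?_; 0#; _+_)
    open Clustering F L
    open Feasible
    open Length L using (len; slack; len-+)

    some : ∀ {n} → Subset n → Bool
    some {n} C = any (lookup C) (allFin n)

    infixl 6 _∖_
    _∖_ : ∀ {n} → Subset n → Subset n → Subset n
    S ∖ T = tabulate (λ p → lookup S p ∧ not (lookup T p))

    dist : (I : Instance) → Fin (n I) → Fin (n I) → Carrier
    dist I p q = d I (point I p) (point I q)

    -- Point zero, obtained from any given point, so that instances without data points need no
    -- exclusion.
    first : ∀ {n} → Fin n → Fin n
    first {suc n} _ = zero

    prolong : ∀ {n} → Subset n × List (Subset n) → Maybe (Carrier × Subset n) →
              Subset n × List (Subset n)
    prolong (V , Vs) nothing        = V , Vs
    prolong (V , Vs) (just (_ , W)) = W , V ∷ Vs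

    module Growth (I : Instance) where

      -- In a metric this adds the single point q to V.
      grow : Subset (n I) → Fin (n I) → Subset (n I)
      grow V q = tabulate (λ r → lookup V r ∨ does (dist I q r ≤? 0#))

      -- The enlarged set itself is attached to the distance: the minimum then already carries the
      -- next member of the chain, and points never have to be coded by their indices.
      candidate : Subset (n I) → Fin (n I) → Fin (n I) → Maybe (Carrier × Subset (n I))
      candidate V p q = if lookup V q then nothing else just (dist I p q , grow V q)

      candidateFrom : Subset (n I) → Fin (n I) → Maybe (Carrier × Subset (n I))
      candidateFrom V p =
        if lookup V p then argmin (List.map (candidate V p) (allFin (n I))) else nothing

      next : Subset (n I) → Maybe (Carrier × Subset (n I))
      next V = argmin (List.map (candidateFrom V) (allFin (n I)))

      -- In a metric, the singleton of point zero. The matrix shows points only through their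
      -- distances, so equality is tested as distance at most zero.
      start : Subset (n I)
      start = tabulate (λ r → does (dist I (first r) r ≤? 0#))

      chain : ℕ → Subset (n I) × List (Subset (n I))
      chain zero    = start , []
      chain (suc t) = prolong (chain t) (next (proj₁ (chain t)))

      -- The last set of the chain comes first, so that the final answer sits at the head of a row
      -- of the table. As `start` already holds a point, n rounds leave one to spare; `prolong`
      -- idles once nothing is missing.
      sets : List (Subset (n I))
      sets = proj₁ (chain (n I)) ∷ proj₂ (chain (n I))

    Partial : ℕ → Set
    Partial n = Subset n × (Fin n → ℕ)

    fuse : Combination → Carrier → Carrier → Carrier
    fuse weightedSum u v = u + v
    fuse maximum     u v = if does (u ≤? v) then v else u

    -- The first block discards the initial value 0#: as the start of a maximum it would give a
    -- wrong result when all scores are negative.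
    append : Combination → ℕ → Carrier → Carrier → Carrier
    append κ zero    u v = v
    append κ (suc _) u v = fuse κ u v

    -- Points still uncovered move on to `suc j`, so that exactly the new block keeps the label `j`.
    relabel : ∀ {n} → ℕ → Subset n → Subset n → (Fin n → ℕ) → Fin n → ℕ
    relabel j S T lab p = if lookup S p then lab p else (if lookup T p then j else suc j)

    -- Strict inclusion of `S` in `T`. The block `T ∖ S` must be nonempty, both for the result to be
    -- a partition into k clusters and because scores are computed only for nonempty sets.
    admissible : ∀ {n} → Subset n → Subset n → Bool
    admissible S T = some (T ∖ S) ∧ not (some (S ∖ T))

    -- A partial solution covers a set by j blocks; the other points carry the label j.
    module Blocks (κ : Combination) {n : ℕ} (Y : Subset n → Carrier) where

      extend : ℕ → Subset n → Maybe (Carrier × Partial n) → Maybe (Carrier × Partial n)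
      extend j T nothing              = nothing
      extend j T (just (v , S , lab)) =
        if admissible S T then just (append κ j v (Y (T ∖ S)) , T , relabel j S T lab) else nothing

      best : ℕ → List (Maybe (Carrier × Partial n)) → Subset n → Maybe (Carrier × Partial n)
      best j r T = argmin (List.map (extend j T) r)

      -- For each set of the chain, row j holds a cheapest way found to cut it into j successive
      -- differences. Row 0 has a single entry instead, for the empty set.
      row : List (Subset n) → ℕ → List (Maybe (Carrier × Partial n))
      row sets zero    = just (0# , tabulate (λ _ → false) , λ _ → 0) ∷ []
      row sets (suc j) = List.map (best j (row sets j)) sets

    codeSet : ∀ {n} → Subset n → Val
    codeSet C = vec (bool ∘ lookup C)

    codePartial : ∀ {n} → Partial n → Val
    codePartial (S , lab) = codeSet S ∷ vec (unary ∘ lab)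

    -- The steps of Prim's algorithm as programs

    module _ {Γ : Family} {i : Index Γ → Val} (I : Index Γ → Instance) where
      open Growth

      private
        N : Index Γ → ℕ
        N x = n (I x)

      codeMatrix : Index Γ → Val
      codeMatrix x = vec (λ p → vec (λ q → num (dist (I x) p q)))

      subsetₑ : (c : ∀ x → Fin (N x) → Bool) → Γ ⊩ i ↝ (λ x → vec (bool ∘ c x)) →
                Γ ⊩ i ↝ (λ x → codeSet (tabulate (c x)))
      subsetₑ c = convert (λ x → vec-cong (λ p → cong bool (sym (lookup∘tabulate (c x) p))))

      zerosₑ : (f : ∀ x → Fin (N x) → Carrier) → Γ ⊩ i ↝ (λ x → vec (num ∘ f x)) →
               Γ ⊩ i ↝ (λ x → codeSet (tabulate (λ p → does (f x p ≤? 0#))))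
      zerosₑ f l = subsetₑ (λ x p → does (f x p ≤? 0#)) (vmapₑ _ l (leₑ (fst v) (zeroₑ v)))
        where v = var (poly-entry l)

      someₑ : (C : ∀ x → Subset (N x)) → Γ ⊩ i ↝ (λ x → codeSet (C x)) →
              Γ ⊩ i ↝ (λ x → bool (some (C x)))
      someₑ C = anyₑ (λ x → lookup (C x))

      ∖ₑ : (S T : ∀ x → Subset (N x)) → Γ ⊩ i ↝ (λ x → codeSet (S x)) → Γ ⊩ i ↝ (λ x → codeSet (T x)) →
           Γ ⊩ i ↝ (λ x → codeSet (S x ∖ T x))
      ∖ₑ S T s t = subsetₑ _ (vmapₑ _ z (convert
          (λ (x , p) → and (lookup (S x) p) (lookup (T x) p))
          (ifₑ (snd (fst v)) (nilₑ v) (fst (fst v)))))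
        where
        z = vzipₑ s t
        v = var (poly-entry z)
        and : ∀ a b → ifV (bool b) nil (bool a) ≡ bool (a ∧ not b)
        and false false = refl
        and false true  = refl
        and true  false = refl
        and true  true  = refl

      growₑ : (V : ∀ x → Subset (N x)) → Γ ⊩ i ↝ codeMatrix → Γ ⊩ i ↝ (λ x → codeSet (V x)) →
              Γ ⊩ i ↝ (λ x → vec (λ q → codeSet (grow (I x) (V x) q)))
      growₑ V m w = vmapₑ _ m (convert
          (λ (x , q) → vec-cong (λ r → cong bool (sym (lookup∘tabulate _ r))))
          (vmapₑ _ z (convert
            (λ ((x , q) , r) → or (lookup (V x) r) (does (dist (I x) q r ≤? 0#)))
            (ifₑ (fst (fst w′)) (fst (fst w′)) (leₑ (snd (fst w′)) (zeroₑ w′))))))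
        where
        v = var (poly-entry m)
        z = vzipₑ (snd v ⨟ under w) (fst v)
        w′ = var (poly-entry z)
        or : ∀ a b → ifV (bool a) (bool a) (bool b) ≡ bool (a ∨ b)
        or false b = refl
        or true  b = refl

      nextₑ : (V : ∀ x → Subset (N x)) → Γ ⊩ i ↝ codeMatrix → Γ ⊩ i ↝ (λ x → codeSet (V x)) →
              Γ ⊩ i ↝ (λ x → encodeMaybe codeSet (next (I x) (V x)))
      nextₑ V m w = vargminₑ (λ _ → codeSet) (λ x → candidateFrom (I x) (V x))
        (vmapₑ _ z (convert
          (λ (x , p) → outer (lookup (V x) p) _)
          (ifₑ (fst (fst v))
            (vargminₑ (λ _ → codeSet) (λ (x , p) → candidate (I x) (V x) p)
              (vmapₑ _ z′ (convert
                (λ ((x , p) , q) → inner (lookup (V x) q))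
                (ifₑ (fst (snd (fst u))) (nilₑ u) (fst (fst u) ,ₑ snd (snd (fst u)))))))
            (nilₑ v))))
        where
        z = vzipₑ w m
        v = var (poly-entry z)
        z′ = vzipₑ (snd (fst v)) (vzipₑ (snd v ⨟ under w) (snd v ⨟ under (growₑ V m w)))
        u = var (poly-entry z′)
        outer : ∀ {n} b (m : Maybe (Carrier × Subset n)) →
                ifV (bool b) (encodeMaybe codeSet m) nil ≡
                encodeMaybe codeSet (if b then m else nothing)
        outer false m = refl
        outer true  m = refl
        inner : ∀ {n} b {u : Carrier} {W : Subset n} →
                ifV (bool b) nil (num u ∷ codeSet W) ≡
                encodeMaybe codeSet (if b then nothing else just (u , W))
        inner false = refl
        inner true  = refl

      codeChain : ∀ x → ℕ → Val
      codeChain x t = listV (List.map codeSet (proj₁ (chain (I x) t) ∷ proj₂ (chain (I x) t)))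

      startₑ : Γ ⊩ i ↝ codeMatrix → Γ ⊩ i ↝ (λ x → codeSet (start (I x)))
      startₑ m = zerosₑ (λ x r → dist (I x) (first r) r) (convert
        (λ x → head-row (λ p q → num (dist (I x) p q)))
        (headₑ codeMatrix m))
        where
        head-row : ∀ {n} (f : Fin n → Fin n → Val) →
                   apply headₚ (vec (λ p → vec (f p))) ≡ vec (λ r → f (first r) r)
        head-row {zero}  f = trans (cong (apply headₚ) (vec≡list _)) (sym (vec≡list _))
        head-row {suc n} f = cong (apply headₚ) (vec≡list (λ p → vec (f p)))

    size-list-≤ : ∀ {n} (f : Fin n → Val) B → (∀ p → size (f p) ℕ.≤ B) → size (list f) ℕ.≤ suc (n ℕ.* suc B)
    size-list-≤ {zero}  f B h = ℕ.≤-refl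
    size-list-≤ {suc n} f B h = ℕ.s≤s (ℕ.≤-trans
      (ℕ.+-mono-≤ (h zero) (size-list-≤ (f ∘ suc) B (h ∘ suc))) (ℕ.≤-reflexive (ℕ.+-suc B _)))

    n≤size-list : ∀ {n} (f : Fin n → Val) → n ℕ.≤ size (list f)
    n≤size-list {zero}  f = ℕ.z≤n
    n≤size-list {suc n} f = ℕ.s≤s (ℕ.m≤n⇒m≤o+n _ (n≤size-list (f ∘ suc)))

    size-codeSet : ∀ {n} (C : Subset n) → size (codeSet C) ℕ.≤ suc (n ℕ.* 4)
    size-codeSet C = ℕ.≤-trans (ℕ.≤-reflexive (cong size (vec≡list _)))
      (size-list-≤ _ 3 (λ p → size-bool (lookup C p)))
      where
      size-bool : ∀ t → size (bool t) ℕ.≤ 3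
      size-bool false = ℕ.s≤s ℕ.z≤n
      size-bool true  = ℕ.≤-refl

    length-allFin : ∀ n → length (allFin n) ≡ n
    length-allFin n = List.length-tabulate {n = n} id

    module _ {Γ : Family} {i : Index Γ → Val} (I : Index Γ → Instance) where
      open Growth

      poly-N : Γ ⊩ i ↝ codeMatrix {Γ} {i} I → Poly Γ (n ∘ I)
      poly-N m = poly-≤ (λ x → ℕ.≤-trans (n≤size-list _) (ℕ.≤-reflexive (cong size (sym (vec≡list (λ p → vec (λ q → num (dist (I x) p q)))))))) (poly-out m)

      chain-length : ∀ x t → length (proj₂ (chain (I x) t)) ℕ.≤ t
      chain-length x zero    = ℕ.z≤n
      chain-length x (suc t) with next (I x) (proj₁ (chain (I x) t))
      ... | nothing = ℕ.m≤n⇒m≤1+n (chain-length x t)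
      ... | just _  = ℕ.s≤s (chain-length x t)

      -- The rows of the matrix serve only as a counter of n rounds: the state depends on the number
      -- of rows consumed, not on which they are.
      setsₑ : Γ ⊩ i ↝ codeMatrix {Γ} {i} I → Γ ⊩ i ↝ (λ x → listV (List.map codeSet (sets (I x))))
      setsₑ m = convert (λ x → cong (codeChain {Γ} {i} I x) (length-allFin (n (I x))))
        (foldₑ codeRow points st (convert (λ x → vec-allFin (codeRow x)) m)
          (startₑ I m ,ₑ nilₑ m)
          (convert (λ (x , s) → step (chain (I x) (length (rest s))) _)
            (ifₑ e (tailₑ _ e ,ₑ fst (snd v)) (fst (snd v)))))
        where
        codeRow : ∀ x → Fin (n (I x)) → Val
        codeRow x p = vec (λ q → num (dist (I x) p q))
        points : ∀ x → List (Fin (n (I x)))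
        points x = allFin (n (I x))
        st : ∀ x → List (Fin (n (I x))) → Val
        st x ps = codeChain {Γ} {i} I x (length ps)
        m′ = convert (λ x → vec-allFin (codeRow x)) m
        P : Poly Γ (n ∘ I)
        P = poly-N m
        v = var (poly-fold-input codeRow points {st = st} m′ (poly-≤
              (λ (x , s) → ℕ.≤-trans
                (size-listV-≤ codeSet (suc (n (I x) ℕ.* 4))
                  (let c = chain (I x) (length (rest s)) in proj₁ c ∷ proj₂ c) (λ {C} _ → size-codeSet C))
                (ℕ.s≤s (ℕ.*-monoˡ-≤ (suc (suc (n (I x) ℕ.* 4))) (ℕ.s≤s (ℕ.≤-trans (chain-length x _)
                  (ℕ.≤-trans (length≤size (codeRow x) (rest s)) (size-rest (codeRow x) s)))))))
              (poly-▸ {B = Split ∘ points} (poly-suc (poly-* (poly-suc (poly-out m′))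
                (poly-suc (poly-suc (poly-* P (poly-const 4)))))))))
        e = nextₑ (I ∘ proj₁) (λ (x , s) → proj₁ (chain (I x) (length (rest s))))
              (snd (snd v) ⨟ under m) (fst (fst (snd v)))
        step : ∀ {k} (c : Subset k × List (Subset k)) m →
               let (V , Vs) = c ; w = encodeMaybe codeSet m ; u = listV (List.map codeSet (V ∷ Vs)) in
               ifV w (apply tailₚ w ∷ u) u ≡
               listV (List.map codeSet (let (W , Ws) = prolong c m in W ∷ Ws))
        step c nothing  = refl
        step c (just _) = refl

    module _ {Γ : Family} {i : Index Γ → Val} where

      fuseₑ : ∀ κ {u v : Index Γ → Carrier} → Γ ⊩ i ↝ num ∘ u → Γ ⊩ i ↝ num ∘ v →
              Γ ⊩ i ↝ (λ x → num (fuse κ (u x) (v x)))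
      fuseₑ weightedSum e e′ = addₑ e e′
      fuseₑ maximum {u} {v} e e′ = convert (λ x → max (u x) (v x)) (ifₑ (leₑ e e′) e′ e)
        where
        max : ∀ u v → ifV (apply ≤ₚ (num u ∷ num v)) (num v) (num u) ≡ num (fuse maximum u v)
        max u v with does (u ≤? v)
        ... | true  = refl
        ... | false = refl

      appendₑ : ∀ κ {j : Index Γ → ℕ} {u v : Index Γ → Carrier} → Γ ⊩ i ↝ unary ∘ j →
                Γ ⊩ i ↝ num ∘ u → Γ ⊩ i ↝ num ∘ v →
                Γ ⊩ i ↝ (λ x → num (append κ (j x) (u x) (v x)))
      appendₑ κ {j} {u} {v} e e₁ e₂ =
        convert (λ x → by-cases (j x) (u x) (v x)) (ifₑ e (fuseₑ κ e₁ e₂) e₂)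
        where
        by-cases : ∀ j u v → ifV (unary j) (num (fuse κ u v)) (num v) ≡ num (append κ j u v)
        by-cases zero    u v = refl
        by-cases (suc j) u v = refl

    -- The table of the dynamic program as a program

    Candidate : ℕ → Set
    Candidate n = Maybe (Carrier × Partial n)

    codeCandidate : ∀ {n} → Candidate n → Val
    codeCandidate = encodeMaybe codePartial

    value-of : ∀ {n} → Candidate n → Carrier
    value-of = maybe proj₁ 0#

    covered : ∀ {n} → Candidate n → Subset n
    covered = maybe (proj₁ ∘ proj₂) (tabulate (λ _ → false))

    labels : ∀ {n} → Candidate n → Fin n → ℕ
    labels = maybe (proj₂ ∘ proj₂) (λ _ → 0)

    -- Scores are available on nonempty sets alone, so each use lies behind a test, which `whenₑ`
    -- turns into the hypothesis on `some C`.
    Scores : (Γ : Family) (I : Index Γ → Instance) (Y : ∀ x → Subset (n (I x)) → Carrier)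
             (i : Index Γ → Val) → Set₁
    Scores Γ I Y i = Γ ▸ (λ x → Σ[ C ∈ Subset (n (I x)) ] some C ≡ true) ⊩
      (λ (x , C , _) → codeSet C ∷ i x) ↝ (λ (x , C , _) → num (Y x C))

    pull-scores : ∀ {Γ Γ′ I Y i i′} (h : Index Γ′ → Index Γ) → (∀ y → input Γ (h y) ≡ input Γ′ y) →
                  Γ′ ⊩ i′ ↝ i ∘ h → Scores Γ I Y i → Scores Γ′ (I ∘ h) (Y ∘ h) i′
    pull-scores {Γ} {Γ′} {I} {Y} {i} {i′} h eq e score =
      (fst v ,ₑ (snd v ⨟ under e)) ⨟ score′
      where
      C′ : Index Γ′ → Set
      C′ y = Σ[ C ∈ Subset (n (I (h y))) ] some C ≡ true
      score′ = pull {Γ′ = Γ′ ▸ C′} (λ (y , C) → h y , C) (eq ∘ proj₁) score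
      v : Γ′ ▸ C′ ⊩ (λ (y , C , _) → codeSet C ∷ i′ y) ↝ (λ (y , C , _) → codeSet C ∷ i′ y)
      v = var (poly-≤ (λ (y , C , _) → ℕ.s≤s (ℕ.+-monoˡ-≤ (size (i′ y)) (ℕ.m≤n⇒m≤1+n (ℕ.m≤m+n _ (size (i (h y)))))))
            (poly-suc (poly-+ (poly-in score′) (poly-▸ {B = C′} (poly-in e)))))

    module _ {Γ : Family} {i : Index Γ → Val} (I : Index Γ → Instance) (κ : Combination)
             (Y : ∀ x → Subset (n (I x)) → Carrier) where
      open Blocks κ

      extendₑ : (j : Index Γ → ℕ) (T : ∀ x → Subset (n (I x))) (m : ∀ x → Candidate (n (I x))) →
                Scores Γ I Y i → Γ ⊩ i ↝ unary ∘ j → Γ ⊩ i ↝ (λ x → codeSet (T x)) →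
                Γ ⊩ i ↝ (λ x → codeCandidate (m x)) →
                Γ ⊩ i ↝ (λ x → codeCandidate (extend (Y x) (j x) (T x) (m x)))
      extendₑ j T m score eⱼ eₜ eₘ =
        whenₑ (is-just ∘ m) (convert (λ x → is-pair (m x)) (isPairₑ _ eₘ))
          (convert (λ (x , m≡) → extend-just (j x) (T x) (m x) m≡)
            (whenₑ (λ (x , _) → admissible (U x) (T x))
              (convert (λ (x , _) → both (some (T x ∖ U x)) _) (ifₑ (someₑ (I ∘ proj₁) (λ (x , _) → T x ∖ U x) block)
                (ifₑ (someₑ (I ∘ proj₁) (λ (x , _) → U x ∖ T x) block′) (nilₑ block) (someₑ (I ∘ proj₁) (λ (x , _) → T x ∖ U x) block)) (nilₑ block)))
              (convert (λ (_ , ok) → extend-ok ok)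
                (appendₑ κ (under (under eⱼ)) (under value′)
                   (((under block ,ₑ var (poly-in (under block))) ⨟
                     pull (λ ((x , m≡) , ok) → x , T x ∖ U x , ∧-true ok) (λ _ → refl) score))
                 ,ₑ under (under eₜ)
                 ,ₑ vmapₑ (λ ((x , m≡) , ok) p → unary (relabel (j x) (U x) (T x) (labels (m x)) p)) zipped (convert
                      (λ (((x , _) , _) , p) → relabelled (lookup (U x) p) (lookup (T x) p))
                      (ifₑ (fst (snd (fst v))) (fst (fst v)) (ifₑ (snd (snd (fst v))) j′ (nilₑ v ,ₑ j′))))))
              (λ _ ok → extend-not-ok ok)))
          (λ x → nothing-case (m x))
        where
        U : ∀ x → Subset (n (I x))
        U x = covered (m x)

        is-pair : ∀ {n} (m : Candidate n) → apply isPairₚ (codeCandidate m) ≡ bool (is-just m)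
        is-pair (just _) = refl
        is-pair nothing  = refl

        entry : Γ ▸ (λ x → is-just (m x) ≡ true) ⊩ i ∘ proj₁ ↝
                (λ (x , _) → num (value-of (m x)) ∷ codeSet (U x) ∷ vec (unary ∘ labels (m x)))
        entry = convert (λ (x , m≡) → open-just (m x) m≡) (under eₘ)
          where
          open-just : ∀ {n} (m : Candidate n) → is-just m ≡ true →
            codeCandidate m ≡ num (value-of m) ∷ codeSet (covered m) ∷ vec (unary ∘ labels m)
          open-just (just _) refl = refl

        value′ = fst entry
        block  = ∖ₑ (I ∘ proj₁) (T ∘ proj₁) (U ∘ proj₁) (under eₜ) (fst (snd entry))
        block′ = ∖ₑ (I ∘ proj₁) (U ∘ proj₁) (T ∘ proj₁) (fst (snd entry)) (under eₜ)

        zipped = under {B = λ (x , _) → admissible (U x) (T x) ≡ true}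
                   (vzipₑ (snd (snd entry)) (vzipₑ (fst (snd entry)) (under eₜ)))
        v = var (poly-entry zipped)
        j′ = snd v ⨟ under (under (under eⱼ))

        both : ∀ a b → ifV (bool a) (ifV (bool b) nil (bool a)) nil ≡ bool (a ∧ not b)
        both false b     = refl
        both true  false = refl
        both true  true  = refl

        ∧-true : ∀ {a b} → a ∧ b ≡ true → a ≡ true
        ∧-true {true} _ = refl

        relabelled : ∀ a b {k j} → ifV (bool a) (unary k) (ifV (bool b) (unary j) (nil ∷ unary j)) ≡
                     unary (if a then k else (if b then j else suc j))
        relabelled true  b     = refl
        relabelled false true  = refl
        relabelled false false = refl

        extension : ∀ x → Bool → Candidate (n (I x))
        extension x b = if b then just (append κ (j x) (value-of (m x)) (Y x (T x ∖ U x)) ,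
                                        T x , relabel (j x) (U x) (T x) (labels (m x))) else nothing

        extend-just : ∀ {n} {Y : Subset n → Carrier} j T (m : Candidate n) → is-just m ≡ true →
          codeCandidate (if admissible (covered m) T
            then just (append κ j (value-of m) (Y (T ∖ covered m)) , T , relabel j (covered m) T (labels m))
            else nothing) ≡ codeCandidate (extend Y j T m)
        extend-just j T (just _) refl = refl

        extend-ok : ∀ {x b} → b ≡ true →
          num (append κ (j x) (value-of (m x)) (Y x (T x ∖ U x))) ∷ codeSet (T x) ∷
            vec (λ p → unary (relabel (j x) (U x) (T x) (labels (m x)) p)) ≡ codeCandidate (extension x b)
        extend-ok refl = refl

        extend-not-ok : ∀ {x b} → b ≡ false → codeCandidate (extension x b) ≡ nil
        extend-not-ok refl = refl

        nothing-case : ∀ {n} {Y : Subset n → Carrier} {j T} (m : Candidate n) → is-just m ≡ false →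
                       codeCandidate (extend Y j T m) ≡ nil
        nothing-case nothing refl = refl

    argmin-∈ : ∀ {A : Set} (ms : List (Maybe (Carrier × A))) {e} → argmin ms ≡ just e → just e ∈ᴸ ms
    argmin-∈ (m ∷ ms) eq with m | argmin ms in eq′
    ... | nothing      | _            = there (argmin-∈ ms (trans eq′ eq))
    ... | just _       | nothing      = here (sym eq)
    ... | just (u , _) | just (v , _) with does (u ≤? v)
    ...   | true  = here (sym eq)
    ...   | false = there (argmin-∈ ms (trans eq′ eq))

    module _ (κ : Combination) {n : ℕ} (Y : Subset n → Carrier) where
      open Blocks κ Y

      extend-just⁻ : ∀ j T m {e} → extend j T m ≡ just e → ∃[ v ] ∃[ S ] ∃[ lab ]
        (m ≡ just (v , S , lab) × some (T ∖ S) ≡ true × some (S ∖ T) ≡ false ×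
         e ≡ (append κ j v (Y (T ∖ S)) , T , relabel j S T lab))
      extend-just⁻ j T (just (v , S , lab)) eq with some (T ∖ S) in ok | some (S ∖ T) in ok′
      extend-just⁻ j T (just (v , S , lab)) refl | true | false = v , S , lab , refl , ok , ok′ , refl

      best-just⁻ : ∀ sets j T {e} → best j (row sets j) T ≡ just e → ∃[ v ] ∃[ S ] ∃[ lab ]
        (just (v , S , lab) ∈ᴸ row sets j × some (T ∖ S) ≡ true × some (S ∖ T) ≡ false ×
         e ≡ (append κ j v (Y (T ∖ S)) , T , relabel j S T lab))
      best-just⁻ sets j T eq =
        let m , m∈ , eq′ = ∈-map⁻ (extend j T) (argmin-∈ (List.map (extend j T) (row sets j)) eq)
            v , S , lab , m≡ , rest = extend-just⁻ j T m (sym eq′)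
        in v , S , lab , subst (_∈ᴸ row sets j) m≡ m∈ , rest

      module _ (B : ℕ) (Y≤ : ∀ C → some C ≡ true → len (Y C) ℕ.≤ B) where

        -- A sum can be about as long as both summands together, so repeated addition of table
        -- entries to each other could double lengths. Each row adds one score of length at most
        -- `B`, hence the growth is linear in the row number.
        Small : ℕ → Carrier × Partial n → Set
        Small j (v , _ , lab) = len v ℕ.≤ len 0# ℕ.+ j ℕ.* (B ℕ.+ slack) × (∀ p → lab p ℕ.≤ j)

        small-append : ∀ j {u v} → len u ℕ.≤ len 0# ℕ.+ j ℕ.* (B ℕ.+ slack) → len v ℕ.≤ B →
                       len (append κ j u v) ℕ.≤ len 0# ℕ.+ suc j ℕ.* (B ℕ.+ slack)
        small-append zero    u≤ v≤ = ℕ.m≤n⇒m≤o+n (len 0#) (ℕ.m≤n⇒m≤n+o _ (ℕ.m≤n⇒m≤n+o slack v≤))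
        small-append (suc j) {u} {v} u≤ v≤ = ℕ.≤-trans (len-fuse κ)
          (ℕ.≤-trans (ℕ.+-monoˡ-≤ slack (ℕ.+-mono-≤ u≤ v≤))
            (ℕ.≤-reflexive (shuffle (len 0#) (suc j ℕ.* (B ℕ.+ slack)) B slack)))
          where
          len-fuse : ∀ κ → len (fuse κ u v) ℕ.≤ len u ℕ.+ len v ℕ.+ slack
          len-fuse weightedSum = len-+ u v
          len-fuse maximum with does (u ≤? v)
          ... | true  = ℕ.m≤n⇒m≤n+o slack (ℕ.m≤n+m (len v) (len u))
          ... | false = ℕ.m≤n⇒m≤n+o slack (ℕ.m≤m+n (len u) (len v))
          shuffle : ∀ z s b σ → z ℕ.+ s ℕ.+ b ℕ.+ σ ≡ z ℕ.+ (b ℕ.+ σ ℕ.+ s)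
          shuffle = solve-∀

        small-row : ∀ sets j {e} → just e ∈ᴸ row sets j → Small j e
        small-row sets zero    (here refl) = ℕ.m≤m+n _ _ , λ _ → ℕ.z≤n
        small-row sets (suc j) e∈ with ∈-map⁻ (best j (row sets j)) e∈
        ... | T , _ , eq with best-just⁻ sets j T (sym eq)
        ... | v , S , lab , v∈ , ok , _ , refl = let v≤ , lab≤ = small-row sets j v∈ in
          small-append j v≤ (Y≤ (T ∖ S) ok) , relabel≤ lab≤
          where
          relabel≤ : (∀ p → lab p ℕ.≤ j) → ∀ p → relabel j S T lab p ℕ.≤ suc j
          relabel≤ lab≤ p with lookup S p
          ... | true = ℕ.m≤n⇒m≤1+n (lab≤ p)
          ... | false with lookup T p
          ...   | true  = ℕ.n≤1+n j
          ...   | false = ℕ.≤-refl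

        -- A Boolean has size at most 3 and a unary label l has size 1 + 2l, each with one more for
        -- its list cell.
        entryBound : ℕ → ℕ
        entryBound j = suc (suc (len 0# ℕ.+ j ℕ.* (B ℕ.+ slack)) ℕ.+
                            suc (suc (n ℕ.* 4) ℕ.+ suc (n ℕ.* suc (suc (j ℕ.* 2)))))

        size-entry : ∀ sets j {m} → m ∈ᴸ row sets j → size (codeCandidate m) ℕ.≤ entryBound j
        size-entry sets j {nothing} m∈ = ℕ.s≤s ℕ.z≤n
        size-entry sets j {just (v , S , lab)} m∈ = let v≤ , lab≤ = small-row sets j m∈ in
          ℕ.s≤s (ℕ.+-mono-≤ (ℕ.s≤s v≤) (ℕ.s≤s (ℕ.+-mono-≤ (size-codeSet S)
            (ℕ.≤-trans (ℕ.≤-reflexive (cong size (vec≡list _)))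
              (size-list-≤ _ _ (λ p → ℕ.≤-trans (size-unary (lab p)) (ℕ.s≤s (ℕ.*-monoˡ-≤ 2 (lab≤ p)))))))))
          where
          size-unary : ∀ l → size (unary l) ℕ.≤ suc (l ℕ.* 2)
          size-unary zero    = ℕ.≤-refl
          size-unary (suc l) = ℕ.s≤s (ℕ.s≤s (size-unary l))

        length-row : ∀ sets j → length (row sets j) ℕ.≤ suc (length sets)
        length-row sets zero    = ℕ.s≤s ℕ.z≤n
        length-row sets (suc j) = ℕ.≤-trans (ℕ.≤-reflexive (List.length-map _ sets)) (ℕ.n≤1+n _)

    module _ {Γ : Family} {i : Index Γ → Val} (I : Index Γ → Instance) (κ : Combination)
             (Y : ∀ x → Subset (n (I x)) → Carrier) where
      open Blocks κ
      open Growth using (sets)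

      -- Since k is coded in unary, its code is also a list of k units to loop over. The state
      -- repeats the row number, which `append` and `relabel` have to know.
      rowₑ : Scores Γ I Y i → Γ ⊩ i ↝ codeMatrix {Γ} {i} I → Γ ⊩ i ↝ unary ∘ k ∘ I →
             Γ ⊩ i ↝ (λ x → listV (List.map codeCandidate (row (Y x) (sets (I x)) (k (I x)))))
      rowₑ score m u = convert
          (λ x → cong (λ j → listV (List.map codeCandidate (row (Y x) (sets (I x)) j))) (List.length-replicate (k (I x))))
          (snd (foldₑ (λ _ _ → nil) units st u′ (nilₑ u ,ₑ initial) step))
        where
        units : ∀ x → List ⊤
        units x = List.replicate (k (I x)) tt

        codeRow : ∀ x → ℕ → Val
        codeRow x j = listV (List.map codeCandidate (row (Y x) (sets (I x)) j))

        st : ∀ x → List ⊤ → Val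
        st x zs = unary (length zs) ∷ codeRow x (length zs)

        u′ = convert (λ x → unary-units (k (I x))) u
          where
          unary-units : ∀ j → unary j ≡ listV (List.map (λ _ → nil) (List.replicate j tt))
          unary-units zero    = refl
          unary-units (suc j) = cong (nil ∷_) (unary-units j)

        zeros : Γ ⊩ i ↝ (λ x → vec {n (I x)} (λ _ → nil))
        zeros = vmapₑ _ m (nilₑ (var (poly-entry m)))

        initial : Γ ⊩ i ↝ (λ x → codeRow x 0)
        initial = (zeroₑ m ,ₑ subsetₑ I (λ _ _ → false) zeros ,ₑ zeros) ,ₑ nilₑ m

        P = poly-out score
        B : Index Γ → ℕ
        B x = proj₁ P ℕ.* size (input Γ x) ℕ.^ proj₁ (proj₂ P)

        Y≤B : ∀ x C → some C ≡ true → len (Y x C) ℕ.≤ B x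
        Y≤B x C ok = ℕ.≤-trans (ℕ.n≤1+n _) (proj₂ (proj₂ P) (x , C , ok))

        poly-units : Poly (Γ ▸ Split ∘ units) (λ (x , s) → length (rest s))
        poly-units = poly-≤ (λ (x , s) → ℕ.≤-trans (length≤size (λ _ → nil) (rest s)) (size-rest (λ _ → nil) s))
          (poly-▸ {B = Split ∘ units} (poly-out u′))

        up : ∀ {f} → Poly Γ f → Poly (Γ ▸ Split ∘ units) (f ∘ proj₁)
        up = poly-▸ {B = Split ∘ units}

        poly-entryBound : Poly (Γ ▸ Split ∘ units) (λ (x , s) → entryBound κ (Y x) (B x) (Y≤B x) (length (rest s)))
        poly-entryBound = poly-suc (poly-+
          (poly-suc (poly-+ (poly-const (len 0#)) (poly-* poly-units
            (poly-+ (up (proj₁ P , proj₁ (proj₂ P) , λ _ → ℕ.≤-refl)) (poly-const slack)))))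
          (poly-suc (poly-+ (poly-suc (poly-* N′ (poly-const 4)))
            (poly-suc (poly-* N′ (poly-suc (poly-suc (poly-* poly-units (poly-const 2)))))))))
          where N′ = up (poly-N I m)

        poly-codeRow : Poly (Γ ▸ Split ∘ units) (λ (x , s) → size (codeRow x (length (rest s))))
        poly-codeRow = poly-≤
          (λ (x , s) → let j = length (rest s) ; E = entryBound κ (Y x) (B x) (Y≤B x) j in
            ℕ.≤-trans (size-listV-≤ codeCandidate E (row (Y x) (sets (I x)) j)
                        (size-entry κ (Y x) (B x) (Y≤B x) (sets (I x)) j))
              (ℕ.s≤s (ℕ.*-monoˡ-≤ (suc E) (ℕ.≤-trans (length-row κ (Y x) (B x) (Y≤B x) (sets (I x)) j)
                (ℕ.s≤s (length≤size codeSet (sets (I x))))))))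
          (poly-suc (poly-* (up (poly-suc (poly-out (setsₑ I m)))) (poly-suc poly-entryBound)))

        poly-unary : Poly (Γ ▸ Split ∘ units) (λ (x , s) → size (unary (length (rest s))))
        poly-unary = poly-≤ (λ (x , s) → size-rest-unary s) (up (poly-out u′))
          where
          unary-length : ∀ (zs : List ⊤) → unary (length zs) ≡ listV (List.map (λ _ → nil) zs)
          unary-length []       = refl
          unary-length (_ ∷ zs) = cong (nil ∷_) (unary-length zs)
          size-rest-unary : ∀ {zs : List ⊤} (s : Split zs) →
            size (unary (length (rest s))) ℕ.≤ size (listV (List.map (λ _ → nil) zs))
          size-rest-unary s = ℕ.≤-trans (ℕ.≤-reflexive (cong size (unary-length (rest s)))) (size-rest (λ _ → nil) s)

        v = var (poly-fold-input (λ _ _ → nil) units {st = st} u′ (poly-suc (poly-+ poly-unary poly-codeRow)))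
        sets′ = snd (snd v) ⨟ under (setsₑ I m)
        w = var (poly-member (λ _ → codeSet) (sets ∘ I ∘ proj₁) sets′)
        row′ = snd w ⨟ under (snd (fst (snd v)))

        table : ∀ x → Split (units x) → List (Candidate (n (I x)))
        table x s = row (Y x) (sets (I x)) (length (rest s))

        step : Γ ▸ Split ∘ units ⊩ (λ (x , s) → nil ∷ st x (rest s) ∷ i x) ↝ (λ (x , s) → st x (this s ∷ rest s))
        step = (fst v ,ₑ fst (fst (snd v))) ,ₑ
          convert (λ (x , s) → cong listV
            (List.map-∘ {g = codeCandidate} {f = best (Y x) (length (rest s)) (table x s)} (sets (I x))))
          (mapₑ (λ _ → codeSet) (sets ∘ I ∘ proj₁) _ sets′
            (argminₑ (λ _ → codePartial) (λ ((x , s) , T , _) → List.map (extend (Y x) (length (rest s)) T) (table x s))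
              (convert (λ ((x , s) , T , _) → cong listV
                (List.map-∘ {g = codeCandidate} {f = extend (Y x) (length (rest s)) T} (table x s)))
                (mapₑ (λ _ → codeCandidate) rows _ row′
                  (let z = var (poly-member (λ _ → codeCandidate) rows row′)
                       y = snd z ⨟ under (snd w ⨟ under v)
                   in extendₑ (λ (((x , _) , _) , _) → I x) κ (λ (((x , _) , _) , _) → Y x)
                     (λ (((x , s) , _) , _) → length (rest s)) (λ ((_ , T , _) , _) → T) (λ (_ , e , _) → e)
                     (pull-scores {I = I} {Y = Y} (λ (((x , _) , _) , _) → x) (λ _ → refl) (snd (snd y)) score)
                     (fst (fst (snd y))) (snd z ⨟ under (fst w)) (fst z))))))
          where
          rows : ∀ x → List (Candidate (n (I (proj₁ (proj₁ x)))))
          rows ((x , s) , _) = table x s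

  -- Ordered fields

  module OrderedFieldProperties where
    open OrderedField F
    open DecTotalOrder decTotalOrder public using (poset)
      renaming (refl to ≤-refl; trans to ≤-trans; reflexive to ≤-reflexive; antisym to ≤-antisym; total to ≤-total)
    open RingProperties ring using (-‿involutive; -‿distribˡ-*; -‿distribʳ-*)
    open Solver commutativeSemiring using (solve; _:=_; _:+_; _:*_)
    open PartialOrderReasoning poset

    ≰⇒≥ : ∀ {x y} → ¬ (x ≤ y) → y ≤ x
    ≰⇒≥ {x} {y} x≰y with ≤-total x y
    ... | inj₁ x≤y = contradiction x≤y x≰y
    ... | inj₂ y≤x = y≤x

    +-mono-≤ : ∀ {x y u v} → x ≤ y → u ≤ v → x + u ≤ y + v
    +-mono-≤ {x} {y} {u} {v} x≤y u≤v = begin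
      x + u ≤⟨ +-monoˡ-≤ u x≤y ⟩
      y + u ≈⟨ +-comm y u ⟩
      u + y ≤⟨ +-monoˡ-≤ y u≤v ⟩
      v + y ≈⟨ +-comm v y ⟩
      y + v ∎

    +-nonNegative : ∀ {x y} → 0# ≤ x → 0# ≤ y → 0# ≤ x + y
    +-nonNegative 0≤x 0≤y = ≤-trans (≤-reflexive (sym (+-identityˡ 0#))) (+-mono-≤ 0≤x 0≤y)

    +-cancelʳ-≤ : ∀ z {x y} → x + z ≤ y + z → x ≤ y
    +-cancelʳ-≤ z {x} {y} h = begin
      x             ≈⟨ cancel x ⟨
      x + z + (- z) ≤⟨ +-monoˡ-≤ (- z) h ⟩
      y + z + (- z) ≈⟨ cancel y ⟩
      y             ∎
      where
      cancel : ∀ x → x + z + (- z) ≈ x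
      cancel x = trans (+-assoc x z (- z)) (trans (+-congˡ (-‿inverseʳ z)) (+-identityʳ x))

    *-monoˡ-≤ : ∀ z {x y} → 0# ≤ z → x ≤ y → z * x ≤ z * y
    *-monoˡ-≤ z {x} {y} 0≤z x≤y = +-cancelʳ-≤ (z * (- x)) (begin
      z * x + z * (- x) ≈⟨ distribˡ z x (- x) ⟨
      z * (x + - x)     ≈⟨ *-congˡ (-‿inverseʳ x) ⟩
      z * 0#            ≈⟨ zeroʳ z ⟩
      0#                ≤⟨ *-nonNegative 0≤z (≤-trans (≤-reflexive (sym (-‿inverseʳ x))) (+-monoˡ-≤ (- x) x≤y)) ⟩
      z * (y + - x)     ≈⟨ distribˡ z y (- x) ⟩
      z * y + z * (- x) ∎)

    *-monoʳ-≤ : ∀ z {x y} → 0# ≤ z → x ≤ y → x * z ≤ y * z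
    *-monoʳ-≤ z {x} {y} 0≤z x≤y =
      ≤-trans (≤-reflexive (*-comm x z)) (≤-trans (*-monoˡ-≤ z 0≤z x≤y) (≤-reflexive (*-comm z y)))

    0≤1 : 0# ≤ 1#
    0≤1 with ≤-total 0# 1#
    ... | inj₁ 0≤1 = 0≤1
    ... | inj₂ 1≤0 = begin
      0#              ≤⟨ *-nonNegative 0≤-1 0≤-1 ⟩
      - 1# * - 1#     ≈⟨ -‿distribˡ-* 1# (- 1#) ⟨
      - (1# * - 1#)   ≈⟨ -‿cong (*-identityˡ (- 1#)) ⟩
      - (- 1#)        ≈⟨ -‿involutive 1# ⟩
      1#              ∎
      where
      0≤-1 : 0# ≤ - 1#
      0≤-1 = begin
        0#          ≈⟨ -‿inverseʳ 1# ⟨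
        1# + - 1#   ≤⟨ +-monoˡ-≤ (- 1#) 1≤0 ⟩
        0# + - 1#   ≈⟨ +-identityˡ (- 1#) ⟩
        - 1#        ∎

    *-cancelˡ-≤ : ∀ z {x y} → 0# ≤ z → ¬ (z ≈ 0#) → z * x ≤ z * y → x ≤ y
    *-cancelˡ-≤ z {x} {y} 0≤z z≉0 zx≤zy with ≤-total x y
    ... | inj₁ x≤y = x≤y
    ... | inj₂ y≤x = ≤-reflexive (begin-equality
      x               ≈⟨ cancel x ⟨
      z ⁻¹ * (z * x)  ≈⟨ *-congˡ (≤-antisym zx≤zy (*-monoˡ-≤ z 0≤z y≤x)) ⟩
      z ⁻¹ * (z * y)  ≈⟨ cancel y ⟩
      y               ∎)
      where
      cancel : ∀ x → z ⁻¹ * (z * x) ≈ x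
      cancel x = trans (sym (*-assoc (z ⁻¹) z x))
        (trans (*-congʳ (trans (*-comm (z ⁻¹) z) (*-inverseʳ z z≉0))) (*-identityˡ x))

    x-y+y : ∀ x y → x - y + y ≈ x
    x-y+y x y = trans (+-assoc x (- y) y) (trans (+-congˡ (-‿inverseˡ y)) (+-identityʳ x))

    -- x and x′ are the distances of two points of a cluster from its center, D and y those of a
    -- point outside from the first one and from its own center, E is the distance of the two
    -- centers, and γ = α - 1.
    module Gap {γ x x′ y D E : Carrier} (0≤γ : 0# ≤ γ) (0≤x : 0# ≤ x) (0≤y : 0# ≤ y) (0≤D : 0# ≤ D)
               (x-far : ¬ (D + y ≤ γ * x + x)) (y-far : γ * y + y ≤ D + x)
               (x′-far : γ * x′ + x′ ≤ x′ + E) (E≤ : E ≤ x + D + y) where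

      private
        two : Carrier → Carrier
        two u = u + u

        -- Add `x-far` and `y-far` and cancel x + y. The strictness of `x-far` survives here, and
        -- this is what admits equality in the thresholds for α.
        sum-bound : ¬ (two D ≤ γ * (x + y))
        sum-bound h = x-far (+-cancelʳ-≤ (D + x) (begin
          D + y + (D + x)           ≈⟨ solve 3 (λ D x y → D :+ y :+ (D :+ x) := D :+ D :+ (x :+ y)) refl D x y ⟩
          two D + (x + y)           ≤⟨ +-monoˡ-≤ (x + y) h ⟩
          γ * (x + y) + (x + y)
            ≈⟨ solve 3 (λ γ x y → γ :* (x :+ y) :+ (x :+ y) := γ :* x :+ x :+ (γ :* y :+ y)) refl γ x y ⟩
          γ * x + x + (γ * y + y)   ≤⟨ +-mono-≤ ≤-refl y-far ⟩
          γ * x + x + (D + x)       ∎))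

        2+γ≉0 : ¬ (γ + (1# + 1#) ≈ 0#)
        2+γ≉0 eq = 0≉1 (≤-antisym 0≤1 (begin
          1#               ≈⟨ +-identityˡ 1# ⟨
          0# + 1#          ≤⟨ +-mono-≤ (+-nonNegative 0≤γ 0≤1) ≤-refl ⟩
          γ + 1# + 1#      ≈⟨ +-assoc γ 1# 1# ⟩
          γ + (1# + 1#)    ≈⟨ eq ⟩
          0#               ∎))

        γ+2 : ∀ u → (γ + (1# + 1#)) * u ≈ γ * u + two u
        γ+2 u = trans (distribʳ u γ (1# + 1#)) (+-congˡ (trans (distribʳ u 1# 1#) (+-cong (*-identityˡ u) (*-identityˡ u))))

        -- To eliminate y, take γ + 1 times `x-far` and add `y-far`: this leaves (γ + 2)γx ≤ (γ +
        -- 2)D.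
        γx≤D : γ * x ≤ D
        γx≤D = *-cancelˡ-≤ (γ + (1# + 1#)) (+-nonNegative 0≤γ (+-nonNegative 0≤1 0≤1)) 2+γ≉0
          (+-cancelʳ-≤ x (begin
            (γ + (1# + 1#)) * (γ * x) + x          ≈⟨ +-congʳ (γ+2 (γ * x)) ⟩
            γ * (γ * x) + two (γ * x) + x
              ≈⟨ solve 2 (λ γ x → γ :* (γ :* x) :+ (γ :* x :+ γ :* x) :+ x
                          := γ :* (γ :* x :+ x) :+ (γ :* x :+ x)) refl γ x ⟩
            γ * (γ * x + x) + (γ * x + x)          ≤⟨ +-mono-≤ (*-monoˡ-≤ γ 0≤γ (≰⇒≥ x-far)) (≰⇒≥ x-far) ⟩
            γ * (D + y) + (D + y)
              ≈⟨ solve 3 (λ γ D y → γ :* (D :+ y) :+ (D :+ y) := γ :* D :+ D :+ (γ :* y :+ y)) refl γ D y ⟩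
            γ * D + D + (γ * y + y)                ≤⟨ +-mono-≤ ≤-refl y-far ⟩
            γ * D + D + (D + x)
              ≈⟨ solve 3 (λ γ D x → γ :* D :+ D :+ (D :+ x) := γ :* D :+ (D :+ D) :+ x) refl γ D x ⟩
            γ * D + two D + x                      ≈⟨ +-congʳ (γ+2 D) ⟨
            (γ + (1# + 1#)) * D + x                ∎))

        γγx′ : γ * (γ * x′) ≤ γ * (x + y) + γ * D
        γγx′ = begin
          γ * (γ * x′)             ≤⟨ *-monoˡ-≤ γ 0≤γ (+-cancelʳ-≤ x′ (≤-trans x′-far (≤-reflexive (+-comm x′ E)))) ⟩
          γ * E                    ≤⟨ *-monoˡ-≤ γ 0≤γ E≤ ⟩
          γ * (x + D + y)          ≈⟨ solve 4 (λ γ x D y → γ :* (x :+ D :+ y) := γ :* (x :+ y) :+ γ :* D) refl γ x D y ⟩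
          γ * (x + y) + γ * D      ∎

      -- From D ≤ x, `y-far` would give y ≤ 2x ≤ γx, against `x-far`. It serves the case of a center
      -- that is a data point not yet reached.
      x<D : (∀ {u} → 0# ≤ u → two u ≤ γ * u) → ¬ (D ≤ x)
      x<D 2≤γ D≤x = x-far (begin
        D + y           ≤⟨ +-mono-≤ D≤x y≤γx ⟩
        x + γ * x       ≈⟨ +-comm x (γ * x) ⟩
        γ * x + x       ∎)
        where
        y≤γx : y ≤ γ * x
        y≤γx = begin
          y             ≈⟨ +-identityˡ y ⟨
          0# + y        ≤⟨ +-monoˡ-≤ y (*-nonNegative 0≤γ 0≤y) ⟩
          γ * y + y     ≤⟨ y-far ⟩
          D + x         ≤⟨ +-monoˡ-≤ x D≤x ⟩
          two x         ≤⟨ 2≤γ 0≤x ⟩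
          γ * x         ∎

      -- For a center that is a data point already reached. The condition γ² - γ - 2 = (γ - 2)(γ +
      -- 1) ≥ 0 is where the threshold 3 for α originates.
      x′<D : γ * D + two D ≤ γ * (γ * D) → ¬ (D ≤ x′)
      x′<D γ+2≤γ² D≤x′ = sum-bound (+-cancelʳ-≤ (γ * D) (begin
        two D + γ * D             ≈⟨ +-comm (two D) (γ * D) ⟩
        γ * D + two D             ≤⟨ γ+2≤γ² ⟩
        γ * (γ * D)               ≤⟨ *-monoˡ-≤ γ 0≤γ (*-monoˡ-≤ γ 0≤γ D≤x′) ⟩
        γ * (γ * x′)              ≤⟨ γγx′ ⟩
        γ * (x + y) + γ * D       ∎))

      -- For a center outside the data, where the two points are joined only through it. The
      -- condition γ² ≥ 2γ + 2 has the positive root 1 + √3, hence the threshold 2 + √3 for α.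
      x+x′<D : two (γ * D) + two D ≤ γ * (γ * D) → ¬ (D ≤ x + x′)
      x+x′<D 2γ+2≤γ² D≤x+x′ = sum-bound (+-cancelʳ-≤ (two (γ * D)) (begin
        two D + two (γ * D)               ≈⟨ +-comm (two D) (two (γ * D)) ⟩
        two (γ * D) + two D               ≤⟨ 2γ+2≤γ² ⟩
        γ * (γ * D)                       ≤⟨ *-monoˡ-≤ γ 0≤γ (*-monoˡ-≤ γ 0≤γ D≤x+x′) ⟩
        γ * (γ * (x + x′))
          ≈⟨ solve 3 (λ γ x z → γ :* (γ :* (x :+ z)) := γ :* (γ :* x) :+ γ :* (γ :* z)) refl γ x x′ ⟩
        γ * (γ * x) + γ * (γ * x′)        ≤⟨ +-mono-≤ (*-monoˡ-≤ γ 0≤γ γx≤D) γγx′ ⟩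
        γ * D + (γ * (x + y) + γ * D)
          ≈⟨ solve 2 (λ u v → u :+ (v :+ u) := v :+ (u :+ u)) refl (γ * D) (γ * (x + y)) ⟩
        γ * (x + y) + two (γ * D)         ∎))

  -- Center proximity

  module Objectives where
    open OrderedField F
    open Clustering F L
    open OrderedFieldProperties
    import Algebra.Construct.NaturalChoice.Max totalOrder as Max

    ∈-tabulate⁻ : ∀ {n} {f : Fin n → Bool} {p} → p ∈ tabulate f → f p ≡ true
    ∈-tabulate⁻ {f = f} {p} p∈ = ≡.trans (≡.sym (lookup∘tabulate f p)) ([]=⇒lookup p∈)

    does-true : ∀ {A : Set} (A? : Dec A) → does A? ≡ true → A
    does-true (yes a) _ = a

    ∈-cluster⁻ : ∀ I a i {p} → p ∈ cluster I a i → a p ≡ i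
    ∈-cluster⁻ I a i {p} p∈ = does-true (a p ≟ i) (∈-tabulate⁻ p∈)

    choose : ∀ {A P : Set} → Dec P → A → A → A
    choose (yes _) u v = u
    choose (no _)  u v = v

    weigh : Combination → Carrier → Carrier → Carrier
    weigh weightedSum w s = w * s
    weigh maximum     w s = s

    total : Combination → ∀ {k} → Vector Carrier k → Carrier
    total weightedSum = sumOver
    total maximum     = maxOver

    weigh-mono : ∀ κ {w s t} → 0# ≤ w → s ≤ t → weigh κ w s ≤ weigh κ w t
    weigh-mono weightedSum 0≤w s≤t = *-monoˡ-≤ _ 0≤w s≤t
    weigh-mono maximum     0≤w s≤t = s≤t

    total-mono : ∀ κ {k} {f g : Vector Carrier k} → (∀ i → f i ≤ g i) → total κ f ≤ total κ g
    total-mono weightedSum {zero}  f≤g = ≤-refl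
    total-mono weightedSum {suc k} f≤g = +-mono-≤ (f≤g zero) (total-mono weightedSum (f≤g ∘ suc))
    total-mono maximum {zero}  f≤g = ≤-refl
    total-mono maximum {suc k} f≤g = go (f≤g zero) (f≤g ∘ suc)
      where
      open MaxOp Max.maxOperator using (⊔-mono-≤)
      go : ∀ {k u v} {f g : Vector Carrier k} → u ≤ v → (∀ i → f i ≤ g i) →
           foldr _⊔_ u f ≤ foldr _⊔_ v g
      go {zero}  u≤v f≤g = u≤v
      go {suc k} u≤v f≤g = ⊔-mono-≤ (f≤g zero) (go u≤v (f≤g ∘ suc))

    -- The nearest point outside a proper part of a cluster lies in the same cluster.
    Separated : (I : Instance) → Labelling I → Set
    Separated I a = ∀ (V : Fin (n I) → Bool) {v z q} → V v ≡ true → V z ≡ false → a z ≡ a v → a q ≢ a v →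
      ∃[ v′ ] ∃[ w ] (V v′ ≡ true × a v′ ≡ a v × V w ≡ false × a w ≡ a v ×
        ¬ (d I (point I v) (point I q) ≤ d I (point I v′) (point I w)))

    module WithObjective (Φ : Objective) where
      open Objective Φ

      term : (I : Instance) → Subset (n I) → S I → Carrier
      term I C c = weigh combination (weight (description I) C) (costFrom Φ I C c)

      value-total : ∀ I a c → value Φ I a c ≡ total combination (λ i → term I (cluster I a i) (c i))
      value-total I a c with combination
      ... | weightedSum = ≡.refl
      ... | maximum     = ≡.refl

      value-mono : ∀ I d′ d″ a c c′ →
        (∀ i → term (I [ d′ ]) (cluster I a i) (c i) ≤ term (I [ d″ ]) (cluster I a i) (c′ i)) →
        value Φ (I [ d′ ]) a c ≤ value Φ (I [ d″ ]) a c′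
      value-mono I d′ d″ a c c′ h =
        ≡.subst₂ _≤_ (≡.sym (value-total (I [ d′ ]) a c)) (≡.sym (value-total (I [ d″ ]) a c′))
          (total-mono combination h)

    module Proximity (Φ : Objective) (Φ-centerBased : IsCenterBased Φ) (I : Instance) (I-metric : IsMetric I)
                     (weight≥0 : ∀ C → 0# ≤ Objective.weight Φ (description I) {n I} C)
                     (α : Carrier) (1≤α : 1# ≤ α) (a : Labelling I)
                     (resilient : ∀ d′ → IsPerturbation Φ α I d′ → IsOptimal Φ (I [ d′ ]) a ×
                                    (∀ b → IsOptimal Φ (I [ d′ ]) b → SamePartition I b a)) where
      open WithObjective Φ
      open IsCenterBased Φ-centerBased
      open IsGeneralMetric I-metric using (nonNegative; ≈⇒0; 0⇒≈) renaming (sym to d-sym; triangle to d-triangle)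
      open PartialOrderReasoning poset

      0≤α : 0# ≤ α
      0≤α = ≤-trans 0≤1 1≤α

      ≤α* : ∀ {u} → 0# ≤ u → u ≤ α * u
      ≤α* {u} 0≤u = ≤-trans (≤-reflexive (sym (*-identityˡ u))) (*-monoʳ-≤ u 0≤u 1≤α)

      αd : S I → S I → Carrier
      αd x y = α * d I x y

      αd-perturbation : IsPerturbation Φ α I αd
      αd-perturbation x y = ≤α* nonNegative , ≤-refl

      αd≥0 : ∀ x s → 0# ≤ αd x s
      αd≥0 x s = ≤-trans nonNegative (proj₁ (αd-perturbation x s))

      abstract
        -- The metric decides equality in the space; a perturbation at a single pair has to test it.
        _≟ₛ_ : DecidableEquality (S I)
        x ≟ₛ y = map′ (λ h → 0⇒≈ (≤-antisym h nonNegative)) (≤-reflexive ∘ ≈⇒0) (d I x y ≤? 0#)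

      -- Only such a point can move to another cluster while all k clusters stay nonempty.
      Accompanied : Fin (n I) → Set
      Accompanied p = ∃[ q ] (q ≢ p × a q ≡ a p)

      accompanied? : ∀ p → Dec (Accompanied p)
      accompanied? p = any? (λ q → ¬? (q ≟ p) ×-dec (a q ≟ a p))

      partition : IsPartition I a
      partition = let (_ , P , _) , _ = resilient αd αd-perturbation in P

      term-mono : ∀ d′ c d″ c′ i → (∀ p → a p ≡ i → 0# ≤ d′ (point I p) c) →
                  (∀ p → a p ≡ i → d′ (point I p) c ≤ d″ (point I p) c′) →
                  term (I [ d′ ]) (cluster I a i) c ≤ term (I [ d″ ]) (cluster I a i) c′
      term-mono d′ c d″ c′ i 0≤ ≤″ = weigh-mono (Objective.combination Φ) (weight≥0 _)
        (cost-mono _ (cluster I a i) _ _ (λ p p∈ → 0≤ p (∈-cluster⁻ I a i p∈)) (λ p p∈ → ≤″ p (∈-cluster⁻ I a i p∈)))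

      -- Otherwise p could be moved to the cluster j, and the optimum would not be unique.
      strictly-nearest : ∀ {d′} → IsPerturbation Φ α I d′ → ∀ {g} → IsOptimalWith Φ (I [ d′ ]) a g →
                         ∀ {p j} → Accompanied p → j ≢ a p →
                         ¬ (d′ (point I p) (g j) ≤ d′ (point I p) (g (a p)))
      strictly-nearest {d′} P {g} opt {p} {j} (p₂ , p₂≢p , ap₂≡ap) j≢ nearer = j≢ j≡ap
        where
        b : Labelling I
        b q with q ≟ p
        ... | yes _ = j
        ... | no  _ = a q

        b-p : b p ≡ j
        b-p with p ≟ p
        ... | yes _ = ≡.refl
        ... | no p≢p = contradiction ≡.refl p≢p

        b-other : ∀ {q} → q ≢ p → b q ≡ a q
        b-other {q} q≢p with q ≟ p
        ... | yes q≡p = contradiction q≡p q≢p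
        ... | no _    = ≡.refl

        b-partition : IsPartition I b
        b-partition i with i ≟ a p
        ... | yes i≡ap = p₂ , λ { ≡.refl → ≡.trans (b-other p₂≢p) (≡.trans ap₂≡ap (≡.sym i≡ap)) }
        ... | no i≢ap = let q , aq = partition i in
          q , λ { ≡.refl → ≡.trans (b-other (λ q≡p → i≢ap (≡.trans (≡.sym (aq ≡.refl)) (≡.cong a q≡p)))) (aq ≡.refl) }

        b-nearer : ∀ q → d′ (point I q) (g (b q)) ≤ d′ (point I q) (g (a q))
        b-nearer q with q ≟ p
        ... | yes ≡.refl = nearer
        ... | no _       = ≤-refl

        same : SamePartition I b a
        same = proj₂ (resilient d′ P) b (g , reassign (I [ d′ ]) (λ x y → ≤-trans nonNegative (proj₁ (P x y)))
                 a b g opt b-partition b-nearer)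

        j≡ap : j ≡ a p
        j≡ap = ≡.trans (≡.sym b-p)
          (≡.trans (Equivalence.from (same p p₂) (≡.sym ap₂≡ap)) (≡.trans (b-other p₂≢p) ap₂≡ap))

      -- If the second inequality failed, αd could be lowered at (p , g j) alone so that p is
      -- as near to g j as to its own center, while a and g stay optimal.
      center-proximity : ∀ {g} → IsOptimalWith Φ (I [ αd ]) a g → ∀ {p j} → Accompanied p → j ≢ a p →
                         ¬ (d I (point I p) (g j) ≤ α * d I (point I p) (g (a p)))
      center-proximity {g} opt {p} {j} acc@(p₂ , p₂≢p , ap₂≡ap) j≢ near =
        strictly-nearest d′-perturbation d′-optimal acc j≢ (≤-reflexive (trans at-j (sym at-i)))
        where
        i = a p

        Special : S I → S I → Set
        Special x s = x ≡ point I p × s ≡ g j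

        special? : ∀ x s → Dec (Special x s)
        special? x s = (x ≟ₛ point I p) ×-dec (s ≟ₛ g j)

        d′ : S I → S I → Carrier
        d′ x s = choose (special? x s) (αd (point I p) (g i)) (αd x s)

        -- As p is accompanied, all points of its cluster are, and `strictly-nearest` under `αd`
        -- applies to each. At p this keeps `d′` below `αd`; for the whole cluster it pays for
        -- replacing the center `g j` by `g i`.
        farther : ∀ {q} → a q ≡ i → αd (point I q) (g i) ≤ αd (point I q) (g j)
        farther {q} aq with accompanied? q
        ... | yes acc-q = ≰⇒≥ (λ h → strictly-nearest αd-perturbation opt acc-q
                            (λ j≡ → j≢ (≡.trans j≡ aq)) (≤-trans h (≤-reflexive (reflexive (≡.cong (αd _ ∘ g) (≡.sym aq))))))
        ... | no single with q ≟ p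
        ...   | yes ≡.refl = contradiction acc single
        ...   | no q≢p     = contradiction (p , (λ p≡q → q≢p (≡.sym p≡q)) , ≡.sym aq) single

        d′-perturbation : IsPerturbation Φ α I d′
        d′-perturbation x s with special? x s
        ... | yes (≡.refl , ≡.refl) = near , farther ≡.refl
        ... | no _                  = αd-perturbation x s

        at-j : d′ (point I p) (g j) ≈ αd (point I p) (g i)
        at-j with special? (point I p) (g j)
        ... | yes _ = refl
        ... | no ¬s = contradiction (≡.refl , ≡.refl) ¬s

        at-i : d′ (point I p) (g i) ≈ αd (point I p) (g i)
        at-i with special? (point I p) (g i)
        ... | yes _ = refl
        ... | no  _ = refl

        d′≥0 : ∀ x s → 0# ≤ d′ x s
        d′≥0 x s = ≤-trans nonNegative (proj₁ (d′-perturbation x s))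

        -- Resilience yields these centers without any relation to g. The detour from `d′` to `αd`
        -- and back in `d′-optimal` shows that g is as good.
        d′-centers : ∃ (IsOptimalWith Φ (I [ d′ ]) a)
        d′-centers = proj₁ (resilient d′ d′-perturbation)
        c′ = proj₁ d′-centers

        -- The lowered pair helps `c′` only where it serves the cluster i from `g j`. There `g i`
        -- under `αd` does at least as well; at all other clusters `d′` and `αd` agree on the
        -- distances to `c′` that matter.
        e : Fin (k I) → S I
        e l = choose ((l ≟ i) ×-dec (c′ l ≟ₛ g j)) (g i) (c′ l)

        e-cheaper : ∀ l → term (I [ αd ]) (cluster I a l) (e l) ≤ term (I [ d′ ]) (cluster I a l) (c′ l)
        e-cheaper l with (l ≟ i) ×-dec (c′ l ≟ₛ g j)
        ... | yes (≡.refl , c′l≡) = term-mono αd (g i) d′ (c′ i) i (λ _ _ → αd≥0 _ _) nearer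
          where
          nearer : ∀ q → a q ≡ i → αd (point I q) (g i) ≤ d′ (point I q) (c′ i)
          nearer q aq with special? (point I q) (c′ i)
          ... | yes (q≡ , _) = ≤-reflexive (reflexive (≡.cong (λ x → αd x (g i)) q≡))
          ... | no _         = ≤-trans (farther aq) (≤-reflexive (reflexive (≡.cong (αd (point I q)) (≡.sym c′l≡))))
        ... | no ¬replaced = term-mono αd (c′ l) d′ (c′ l) l (λ _ _ → αd≥0 _ _) nearer
          where
          nearer : ∀ q → a q ≡ l → αd (point I q) (c′ l) ≤ d′ (point I q) (c′ l)
          nearer q aq with special? (point I q) (c′ l)
          ... | yes (q≡ , c′l≡) = contradiction (≡.trans (≡.sym aq) (≡.cong a (point-inj I q≡)) , c′l≡) ¬replaced
          ... | no _            = ≤-refl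

        d′-optimal : IsOptimalWith Φ (I [ d′ ]) a g
        d′-optimal = partition , λ b e′ b-partition → begin
          value Φ (I [ d′ ]) a g     ≤⟨ value-mono I d′ αd a g g (λ l → term-mono d′ (g l) αd (g l) l (λ _ _ → d′≥0 _ _) (λ _ _ → proj₂ (d′-perturbation _ _))) ⟩
          value Φ (I [ αd ]) a g     ≤⟨ proj₂ opt a e partition ⟩
          value Φ (I [ αd ]) a e     ≤⟨ value-mono I αd d′ a e c′ e-cheaper ⟩
          value Φ (I [ d′ ]) a c′    ≤⟨ proj₂ (proj₂ d′-centers) b e′ b-partition ⟩
          value Φ (I [ d′ ]) b e′    ∎

      -- The substitute for center proximity at points that are not accompanied.
      Lonely : (Fin (k I) → S I) → Set
      Lonely g = ∀ p → ¬ Accompanied p → d I (point I p) (g (a p)) ≤ 0#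

      -- Points that form a cluster of their own may serve as its center.
      centers : ∃[ g ] (IsOptimalWith Φ (I [ αd ]) a g × Lonely g)
      centers = g , (partition , optimal) , lonely
        where
        g₀ = proj₁ (proj₁ (resilient αd αd-perturbation))
        opt₀ = proj₂ (proj₁ (resilient αd αd-perturbation))

        rep : Fin (k I) → Fin (n I)
        rep l = proj₁ (partition l)

        a-rep : ∀ l → a (rep l) ≡ l
        a-rep l = proj₂ (partition l) ≡.refl

        g : Fin (k I) → S I
        g l = choose (accompanied? (rep l)) (g₀ l) (point I (rep l))

        self : ∀ {p q} → p ≡ q → d I (point I p) (point I q) ≤ 0#
        self p≡q = ≤-reflexive (≈⇒0 (≡.cong (point I) p≡q))

        lonely : Lonely g
        lonely p single with rep (a p) ≟ p
        ... | no rep≢p = contradiction (rep (a p) , rep≢p , a-rep (a p)) single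
        ... | yes rep≡p with accompanied? (rep (a p))
        ...   | yes acc = contradiction (≡.subst Accompanied rep≡p acc) single
        ...   | no _    = self (≡.sym rep≡p)

        nearer : ∀ l q → a q ≡ l → αd (point I q) (g l) ≤ αd (point I q) (g₀ l)
        nearer l q aq with accompanied? (rep l)
        ... | yes _ = ≤-refl
        ... | no single with q ≟ rep l
        ...   | yes q≡ = *-monoˡ-≤ α 0≤α (≤-trans (self q≡) nonNegative)
        ...   | no q≢  = contradiction (q , q≢ , ≡.trans aq (≡.sym (a-rep l))) single

        optimal : ∀ b e → IsPartition I b → value Φ (I [ αd ]) a g ≤ value Φ (I [ αd ]) b e
        optimal b e b-partition = ≤-trans
          (value-mono I αd αd a g g₀ (λ l → term-mono αd (g l) αd (g₀ l) l (λ _ _ → αd≥0 _ _) (nearer l)))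
          (proj₂ opt₀ b e b-partition)

      γ : Carrier
      γ = α - 1#

      0≤γ : 0# ≤ γ
      0≤γ = ≤-trans (≤-reflexive (sym (-‿inverseʳ 1#))) (+-monoˡ-≤ (- 1#) 1≤α)

      α*≈ : ∀ u → α * u ≈ γ * u + u
      α*≈ u = trans (*-congʳ (sym (x-y+y α 1#))) (trans (distribʳ u γ 1#) (+-congˡ (*-identityˡ u)))

      -- The conditions γ ≥ 2 and γ² ≥ 2γ + 2, multiplied by an arbitrary distance, as `Gap` uses
      -- them.
      Wide : Set
      Wide = ((∀ {u} → 0# ≤ u → u + u ≤ γ * u) × OnlyDataPoints I)
           ⊎ (∀ {u} → 0# ≤ u → γ * u + γ * u + (u + u) ≤ γ * (γ * u))

      D : Fin (n I) → Fin (n I) → Carrier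
      D p q = d I (point I p) (point I q)

      separated : Wide → Separated I a
      separated wide V {v} {z} {q} Vv Vz az≡av aq≢av = go wide
        where
        g = proj₁ centers
        opt = proj₁ (proj₂ centers)
        i = a v
        j = a q
        x = d I (point I v) (g i)
        x′ = d I (point I z) (g i)
        y = d I (point I q) (g j)

        z≢v : z ≢ v
        z≢v z≡v with ≡.trans (≡.sym Vv) (≡.trans (≡.cong V (≡.sym z≡v)) Vz)
        ... | ()

        farther : ∀ {p l} → Accompanied p → l ≢ a p → ¬ (d I (point I p) (g l) ≤ γ * d I (point I p) (g (a p)) + d I (point I p) (g (a p)))
        farther acc l≢ h = center-proximity opt acc l≢ (≤-trans h (≤-reflexive (sym (α*≈ _))))

        -- Strictness is lost to cover points alone in their cluster, whose own center is at
        -- distance zero. The point q may be one of them.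
        weakly-farther : ∀ p {l} → l ≢ a p → γ * d I (point I p) (g (a p)) + d I (point I p) (g (a p)) ≤ d I (point I p) (g l)
        weakly-farther p {l} l≢ with accompanied? p
        ... | yes acc = ≰⇒≥ (farther acc l≢)
        ... | no single = begin
          γ * u + u     ≈⟨ α*≈ u ⟨
          α * u         ≤⟨ *-monoˡ-≤ α 0≤α (proj₂ (proj₂ centers) p single) ⟩
          α * 0#        ≈⟨ zeroʳ α ⟩
          0#            ≤⟨ nonNegative ⟩
          d I (point I p) (g l) ∎
          where u = d I (point I p) (g (a p))

        v-accompanied : Accompanied v
        v-accompanied = z , z≢v , az≡av

        open Gap {γ} {x} {x′} {y} {D v q} {d I (g i) (g j)} 0≤γ nonNegative nonNegative nonNegative
          (λ h → farther v-accompanied aq≢av (≤-trans (d-triangle _ _ _) h))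
          (≤-trans (weakly-farther q (λ i≡j → aq≢av (≡.sym i≡j)))
            (≤-trans (d-triangle _ (point I v) _) (+-monoˡ-≤ x (≤-reflexive (d-sym _ _)))))
          (≤-trans (≡.subst (λ l → γ * d I (point I z) (g l) + d I (point I z) (g l) ≤ d I (point I z) (g j)) az≡av
                     (weakly-farther z (λ j≡ → aq≢av (≡.trans j≡ az≡av))))
            (d-triangle _ (g i) _))
          (≤-trans (d-triangle _ (point I q) _) (+-monoˡ-≤ y
            (≤-trans (d-triangle _ (point I v) _) (+-monoˡ-≤ (D v q) (≤-reflexive (d-sym _ _))))))

        go : Wide → ∃[ v′ ] ∃[ w ] (V v′ ≡ true × a v′ ≡ a v × V w ≡ false × a w ≡ a v × ¬ (D v q ≤ D v′ w))
        go (inj₂ 2γ+2≤γ²) = v , z , Vv , ≡.refl , Vz , az≡av , λ h → x+x′<D (2γ+2≤γ² nonNegative)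
          (≤-trans h (≤-trans (d-triangle _ (g i) _) (+-mono-≤ ≤-refl (≤-reflexive (d-sym _ _)))))
        go (inj₁ (2≤γ , onlyData)) with onlyData (g i)
        ... | c , point-c = by-membership (V c) ≡.refl
          where
          c≡ : point I c ≡ g i
          c≡ = point-c ≡.refl

          -- In another cluster, c would be at distance zero from the foreign center `g i`, hence by
          -- proximity also from its own center. Both centers would coincide, and v would have a
          -- foreign center as near as its own.
          ac≡i : a c ≡ i
          ac≡i with a c ≟ i
          ... | yes eq = eq
          ... | no ac≢i = contradiction (begin
              d I (point I v) (g (a c)) ≈⟨ reflexive (≡.cong (d I (point I v)) g≡) ⟩
              x                         ≈⟨ +-identityˡ x ⟨
              0# + x                    ≤⟨ +-monoˡ-≤ x (*-nonNegative 0≤γ nonNegative) ⟩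
              γ * x + x                 ∎) (farther v-accompanied ac≢i)
            where
            u = d I (point I c) (g (a c))
            u≤0 : u ≤ 0#
            u≤0 = begin
              u             ≈⟨ +-identityˡ u ⟨
              0# + u        ≤⟨ +-monoˡ-≤ u (*-nonNegative 0≤γ nonNegative) ⟩
              γ * u + u     ≤⟨ weakly-farther c (λ i≡ → ac≢i (≡.sym i≡)) ⟩
              d I (point I c) (g i) ≈⟨ ≈⇒0 c≡ ⟩
              0#            ∎
            g≡ : g (a c) ≡ g i
            g≡ = ≡.trans (≡.sym (0⇒≈ (≤-antisym u≤0 nonNegative))) c≡

          γ+2≤γ² : γ * D v q + (D v q + D v q) ≤ γ * (γ * D v q)
          γ+2≤γ² = ≤-trans (+-mono-≤ ≤-refl (2≤γ nonNegative)) (2≤γ (*-nonNegative 0≤γ nonNegative))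

          -- If the center c is already reached, the edge from c to z beats the one from v to q;
          -- otherwise the edge from v to c does.
          by-membership : ∀ b → V c ≡ b → ∃[ v′ ] ∃[ w ] (V v′ ≡ true × a v′ ≡ a v × V w ≡ false × a w ≡ a v × ¬ (D v q ≤ D v′ w))
          by-membership true  Vc = c , z , Vc , ac≡i , Vz , az≡av , λ h → x′<D γ+2≤γ²
            (≤-trans h (≤-reflexive (trans (reflexive (≡.cong (λ s → d I s (point I z)) c≡)) (d-sym _ _))))
          by-membership false Vc = v , c , Vv , ≡.refl , Vc , ac≡i , λ h → x<D 2≤γ
            (≤-trans h (≤-reflexive (reflexive (≡.cong (d I (point I v)) c≡))))

  -- Prim's algorithm visits the clusters one after the other

  module Correctness where
    open OrderedField F
    open Clustering F L
    open OrderedFieldProperties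
    open Feasible using (argmin)
    open Objectives using (Separated)
    open Algorithm

    lookup-ext : ∀ {n} {V W : Subset n} → (∀ p → lookup V p ≡ lookup W p) → V ≡ W
    lookup-ext {V = V} {W} h = ≡.trans (≡.sym (tabulate∘lookup V)) (≡.trans (tabulate-cong h) (tabulate∘lookup W))

    true≢false : ∀ {b} → b ≡ true → b ≡ false → ⊥
    true≢false ≡.refl ()

    ¬true⇒false : ∀ {b} → ¬ (b ≡ true) → b ≡ false
    ¬true⇒false = Bool.¬-not

    argmin-≤ : ∀ {A : Set} {ms : List (Maybe (Carrier × A))} {v e} → just (v , e) ∈ᴸ ms →
               ∃[ u ] ∃[ c ] (argmin ms ≡ just (u , c) × u ≤ v)
    argmin-≤ {ms = just (v , e) ∷ ms} (here ≡.refl) with argmin ms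
    ... | nothing      = v , e , ≡.refl , ≤-refl
    ... | just (u , c) with v ≤? u
    ...   | yes v≤u = v , e , ≡.refl , ≤-refl
    ...   | no v≰u  = u , c , ≡.refl , ≰⇒≥ v≰u
    argmin-≤ {ms = m ∷ ms} (there e∈) with argmin-≤ e∈
    argmin-≤ {ms = m ∷ ms} (there e∈) | u , c , eq , u≤v rewrite eq with m
    ... | nothing        = u , c , ≡.refl , u≤v
    ... | just (u′ , c′) with u′ ≤? u
    ...   | yes u′≤u = u′ , c′ , ≡.refl , ≤-trans u′≤u u≤v
    ...   | no _     = u , c , ≡.refl , u≤v

    module Chain (I : Instance) (I-metric : IsMetric I) (a : Labelling I)
                 (separated : Separated I a) where
      open IsGeneralMetric I-metric using (nonNegative; ≈⇒0; 0⇒≈) renaming (sym to d-sym)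
      open Growth I

      N : ℕ
      N = n I

      infix 4 _∋_ _∌_
      _∋_ _∌_ : Subset N → Fin N → Set
      V ∋ p = lookup V p ≡ true
      V ∌ p = lookup V p ≡ false

      zero-dist⁻ : ∀ {q r} → does (dist I q r ≤? 0#) ≡ true → r ≡ q
      zero-dist⁻ {q} {r} h with dist I q r ≤? 0#
      ... | yes d≤0 = ≡.sym (point-inj I (0⇒≈ (≤-antisym d≤0 nonNegative)))
      zero-dist⁻ () | no _

      zero-dist⁺ : ∀ {q r} → r ≡ q → does (dist I q r ≤? 0#) ≡ true
      zero-dist⁺ {q} ≡.refl with dist I q q ≤? 0#
      ... | yes _  = ≡.refl
      ... | no d≰0 = contradiction (≤-reflexive (≈⇒0 ≡.refl)) d≰0

      grow⁻ : ∀ V q {r} → grow V q ∋ r → V ∋ r ⊎ r ≡ q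
      grow⁻ V q {r} h with lookup V r | ≡.trans (≡.sym (lookup∘tabulate _ r)) h
      ... | true  | _  = inj₁ ≡.refl
      ... | false | h′ = inj₂ (zero-dist⁻ h′)

      grow-⊇ : ∀ V q {r} → V ∋ r → grow V q ∋ r
      grow-⊇ V q {r} h = ≡.trans (lookup∘tabulate _ r) (≡.cong (_∨ _) h)

      grow-∋ : ∀ V q → grow V q ∋ q
      grow-∋ V q = ≡.trans (lookup∘tabulate _ q) (≡.trans (≡.cong (lookup V q ∨_) (zero-dist⁺ ≡.refl)) (Bool.∨-zeroʳ _))

      grow-∌ : ∀ V q {r} → grow V q ∌ r → V ∌ r
      grow-∌ V q ∌r = ¬true⇒false (λ h → true≢false (grow-⊇ V q h) ∌r)

      next-≤ : ∀ V {p q} → V ∋ p → V ∌ q → ∃[ u ] ∃[ W ] (next V ≡ just (u , W) × u ≤ dist I p q)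
      next-≤ V {p} {q} Vp Vq =
        let u , W , eq , u≤ = argmin-≤ {ms = List.map (candidate V p) (allFin N)}
              (≡.subst (_∈ᴸ _) cand (∈-map⁺ (candidate V p) (∈-allFin q)))
            u′ , W′ , eq′ , u′≤ = argmin-≤ {ms = List.map (candidateFrom V) (allFin N)}
              (≡.subst (_∈ᴸ _) (≡.trans from eq) (∈-map⁺ (candidateFrom V) (∈-allFin p)))
        in u′ , W′ , eq′ , ≤-trans u′≤ u≤
        where
        cand : candidate V p q ≡ just (dist I p q , grow V q)
        cand rewrite Vq = ≡.refl
        from : candidateFrom V p ≡ argmin (List.map (candidate V p) (allFin N))
        from rewrite Vp = ≡.refl

      next-just⁻ : ∀ V {u W} → next V ≡ just (u , W) →
        ∃[ p ] ∃[ q ] (V ∋ p × V ∌ q × W ≡ grow V q ×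
          (∀ {p′ q′} → V ∋ p′ → V ∌ q′ → dist I p q ≤ dist I p′ q′))
      next-just⁻ V {u} {W} eq with ∈-map⁻ (candidateFrom V) (argmin-∈ (List.map (candidateFrom V) (allFin N)) eq)
      ... | p , _ , eq₁ with lookup V p in Vp
      ... | true with ∈-map⁻ (candidate V p) (argmin-∈ (List.map (candidate V p) (allFin N)) (≡.sym eq₁))
      ... | q , _ , eq₂ with lookup V q in Vq
      next-just⁻ V {u} {W} eq | p , _ , eq₁ | true | q , _ , ≡.refl | false =
        p , q , Vp , Vq , ≡.refl , minimal
        where
        minimal : ∀ {p′ q′} → V ∋ p′ → V ∌ q′ → dist I p q ≤ dist I p′ q′
        minimal Vp′ Vq′ with next-≤ V Vp′ Vq′
        ... | u′ , W′ , eq′ , u′≤ with ≡.trans (≡.sym eq) eq′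
        ... | ≡.refl = u′≤

      -- A union of clusters of a that is built up through members of the chain.
      data Route : List (Fin (k I)) → Subset N → Set where
        empty : Route [] (tabulate (λ _ → false))
        block : ∀ {js V i T} → Route js V → i ∉ js → T ∈ᴸ sets →
                (∀ {p} → T ∋ p → V ∋ p ⊎ a p ≡ i) → (∀ {p} → V ∋ p → T ∋ p) →
                (∀ {p} → a p ≡ i → T ∋ p) → Route (i ∷ js) T

      covers⁻ : ∀ {js V} → Route js V → ∀ {p} → V ∋ p → a p ∈ᴸ js
      covers⁻ empty {p} h = ⊥-elim (true≢false h (lookup∘tabulate _ p))
      covers⁻ (block r _ _ T⊆ _ _) h with T⊆ h
      ... | inj₁ h′   = there (covers⁻ r h′)
      ... | inj₂ ap≡i = here ap≡i

      covers⁺ : ∀ {js V} → Route js V → ∀ {p} → a p ∈ᴸ js → V ∋ p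
      covers⁺ (block r _ _ _ V⊆T C⊆T) (here ap≡i) = C⊆T ap≡i
      covers⁺ (block r _ _ _ V⊆T C⊆T) (there ap∈) = V⊆T (covers⁺ r ap∈)

      -- The cluster i was entered at q, by an edge that was shortest at that time; the
      -- edges that leave the rest W of V have not become shorter since.
      record Entered (V : Subset N) : Set where
        field
          {js}     : List (Fin (k I))
          {W}      : Subset N
          i        : Fin (k I)
          q z      : Fin N
          route    : Route js W
          i∉js     : i ∉ js
          V⊆       : ∀ {p} → V ∋ p → W ∋ p ⊎ a p ≡ i
          W⊆V      : ∀ {p} → W ∋ p → V ∋ p
          V∋q      : V ∋ q
          aq≡i     : a q ≡ i
          V∌z      : V ∌ z
          az≡i     : a z ≡ i
          shortest : ∀ {w z′} → V ∋ w → a w ≢ i → V ∌ z′ → ∃[ u ] (a u ≢ i × dist I q u ≤ dist I w z′)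

      Inv : Subset N → Set
      Inv V = ∃ (λ js → Route js V) ⊎ Entered V

      -- Every step ends here: a point of the cluster i that is still missing keeps the cluster
      -- entered, and its absence makes the set a new stage of the route.
      settle : ∀ {js V W i} q → V ∈ᴸ sets → Route js W → i ∉ js → (∀ {p} → V ∋ p → W ∋ p ⊎ a p ≡ i) →
               (∀ {p} → W ∋ p → V ∋ p) → V ∋ q → a q ≡ i →
               (∀ {w z} → V ∋ w → a w ≢ i → V ∌ z → ∃[ u ] (a u ≢ i × dist I q u ≤ dist I w z)) → Inv V
      settle {V = V} {i = i} q V∈ route i∉js V⊆ W⊆V V∋q aq≡i shortest
        with any? (λ z → (a z ≟ i) ×-dec (lookup V z Bool.≟ false))
      ... | yes (z , az≡i , V∌z) = inj₂ record
        { i = i ; q = q ; z = z ; route = route ; i∉js = i∉js ; V⊆ = V⊆ ; W⊆V = W⊆V ; V∋q = V∋q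
        ; aq≡i = aq≡i ; V∌z = V∌z ; az≡i = az≡i ; shortest = shortest }
      ... | no ¬z = inj₁ (_ , block route i∉js V∈ V⊆ W⊆V
        (λ {p} ap≡i → Bool.¬-not (λ V∌p → ¬z (p , ap≡i , V∌p))))

      step : ∀ {V u V′} → Inv V → next V ≡ just (u , V′) → V′ ∈ᴸ sets → Inv V′
      step {V} (inj₁ (js , route)) eq V′∈ with next-just⁻ V eq
      ... | p , q , V∋p , V∌q , ≡.refl , minimal =
        settle q V′∈ route aq∉js V′⊆ (grow-⊇ V q) (grow-∋ V q) ≡.refl shortest
        where
        aq∉js : a q ∉ js
        aq∉js aq∈ = true≢false (covers⁺ route aq∈) V∌q
        V′⊆ : ∀ {r} → grow V q ∋ r → V ∋ r ⊎ a r ≡ a q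
        V′⊆ h with grow⁻ V q h
        ... | inj₁ h′     = inj₁ h′
        ... | inj₂ ≡.refl = inj₂ ≡.refl
        shortest : ∀ {w z} → grow V q ∋ w → a w ≢ a q → grow V q ∌ z → ∃[ u ] (a u ≢ a q × dist I q u ≤ dist I w z)
        shortest V′∋w aw≢ V′∌z with V′⊆ V′∋w
        ... | inj₂ aw≡  = contradiction aw≡ aw≢
        ... | inj₁ V∋w = p , (λ ap≡ → aq∉js (≡.subst (_∈ᴸ js) ap≡ (covers⁻ route V∋p))) ,
          ≤-trans (≤-reflexive (d-sym _ _)) (minimal V∋w (grow-∌ V q V′∌z))
      step {V} (inj₂ entered) eq V′∈ with next-just⁻ V eq
      ... | p , q′ , V∋p , V∌q′ , ≡.refl , minimal =
        settle q V′∈ route i∉js V′⊆ (grow-⊇ V q′ ∘ W⊆V) (grow-⊇ V q′ V∋q) aq≡i shortest′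
        where
        open Entered entered
        separate : ∀ {v u} → V ∋ v → a v ≡ i → a u ≢ i → ¬ (∀ {p′ q′} → V ∋ p′ → V ∌ q′ → dist I v u ≤ dist I p′ q′)
        separate V∋v av≡i au≢i h =
          let v′ , w , V∋v′ , _ , V∌w , _ , far = separated (lookup V) V∋v V∌z (≡.trans az≡i (≡.sym av≡i))
                (λ au≡av → au≢i (≡.trans au≡av av≡i))
          in far (h V∋v′ V∌w)
        -- A shortest edge from p to some q′ outside the cluster contradicts separation. If p lies
        -- in the cluster, apply it at p and q′. If not, `shortest` gives a foreign u at least as
        -- near to q as q′ is to p, and it applies at q and u.
        aq′≡i : a q′ ≡ i
        aq′≡i with a q′ ≟ i | a p ≟ i
        ... | yes eq | _        = eq
        ... | no aq′≢i | yes ap≡i = ⊥-elim (separate V∋p ap≡i aq′≢i minimal)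
        ... | no aq′≢i | no ap≢i  =
          let u , au≢i , le = shortest V∋p ap≢i V∌q′ in
          ⊥-elim (separate V∋q aq≡i au≢i (λ V∋p′ V∌q″ → ≤-trans le (minimal V∋p′ V∌q″)))
        V′⊆ : ∀ {r} → grow V q′ ∋ r → W ∋ r ⊎ a r ≡ i
        V′⊆ h with grow⁻ V q′ h
        ... | inj₁ h′     = V⊆ h′
        ... | inj₂ ≡.refl = inj₂ aq′≡i
        shortest′ : ∀ {w z} → grow V q′ ∋ w → a w ≢ i → grow V q′ ∌ z → ∃[ u ] (a u ≢ i × dist I q u ≤ dist I w z)
        shortest′ {w} V′∋w aw≢ V′∌z with grow⁻ V q′ V′∋w
        ... | inj₁ V∋w    = shortest V∋w aw≢ (grow-∌ V q′ V′∌z)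
        ... | inj₂ ≡.refl = contradiction aq′≡i aw≢

      first-const : ∀ {n} (p q : Fin n) → first p ≡ first q
      first-const {suc n} p q = ≡.refl

      start⁻ : ∀ {r} p → start ∋ r → r ≡ first p
      start⁻ {r} p h = ≡.trans (zero-dist⁻ (≡.trans (≡.sym (lookup∘tabulate _ r)) h)) (first-const r p)

      start⁺ : ∀ p → start ∋ first p
      start⁺ p = ≡.trans (lookup∘tabulate _ (first p)) (zero-dist⁺ (first-const p (first p)))

      point? : Fin N ⊎ ¬ Fin N
      point? with any? {n = N} (λ _ → yes ≡.refl)
      ... | yes (p , _ ) = inj₁ p
      ... | no ¬p = inj₂ (λ p → ¬p (p , ≡.refl {x = p}))

      start-inv : start ∈ᴸ sets → Inv start
      start-inv start∈ with point?
      ... | inj₂ ¬p = inj₁ ([] , ≡.subst (Route []) (lookup-ext (λ p → ⊥-elim (¬p p))) empty)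
      -- The first cluster was entered by no edge; its condition on shortest edges is vacuous, since
      -- nothing outside the cluster is reached.
      ... | inj₁ p = settle (first p) start∈ empty (λ ()) (λ h → inj₂ (≡.cong a (start⁻ p h)))
        (λ {r} h → ⊥-elim (true≢false h (lookup∘tabulate _ r))) (start⁺ p) ≡.refl
        (λ h aw≢ _ → contradiction (≡.cong a (start⁻ p h)) aw≢)

      setsAt : ℕ → List (Subset N)
      setsAt t = proj₁ (chain t) ∷ proj₂ (chain t)

      setsAt-suc : ∀ t {V} → V ∈ᴸ setsAt t → V ∈ᴸ setsAt (suc t)
      setsAt-suc t V∈ with next (proj₁ (chain t))
      ... | nothing = V∈
      ... | just _  = there V∈

      setsAt-mono : ∀ s t {V} → V ∈ᴸ setsAt t → V ∈ᴸ setsAt (s ℕ.+ t)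
      setsAt-mono zero    t V∈ = V∈
      setsAt-mono (suc s) t V∈ = setsAt-suc (s ℕ.+ t) (setsAt-mono s t V∈)

      -- A route refers to the final list of sets, although it is built up while the chain is still
      -- growing.
      current∈ : ∀ {t} → t ℕ.≤ N → proj₁ (chain t) ∈ᴸ sets
      current∈ {t} t≤N = ≡.subst (λ s → proj₁ (chain t) ∈ᴸ setsAt s) (ℕ.m∸n+n≡m t≤N) (setsAt-mono (N ℕ.∸ t) t (here ≡.refl))

      chain-inv : ∀ t → t ℕ.≤ N → Inv (proj₁ (chain t))
      chain-inv zero    t≤N = start-inv (current∈ {0} t≤N)
      chain-inv (suc t) t≤N with next (proj₁ (chain t)) in eq | current∈ {suc t} t≤N
      ... | nothing      | _  = chain-inv t (ℕ.≤-trans (ℕ.n≤1+n t) t≤N)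
      ... | just (_ , W) | W∈ = step (chain-inv t (ℕ.≤-trans (ℕ.n≤1+n t) t≤N)) eq W∈

      Full : Subset N → Set
      Full V = ∀ p → V ∋ p

      -- Each step adds a point until none is missing, so at `t = N` only fullness remains. The
      -- reached point in the first alternative is needed for `next` to find an edge whenever a
      -- point is missing.
      chain-grows : ∀ t → (t ℕ.< ∣ proj₁ (chain t) ∣ × ∃ (proj₁ (chain t) ∋_)) ⊎ Full (proj₁ (chain t))
      chain-grows zero with point?
      ... | inj₂ ¬p = inj₂ (λ p → ⊥-elim (¬p p))
      ... | inj₁ p  = inj₁ (ℕ.≤-trans (ℕ.s≤s ℕ.z≤n) (x∈p⇒∣p-x∣<∣p∣ (lookup⇒[]= (first p) start (start⁺ p))) , first p , start⁺ p)
      chain-grows (suc t) with next (proj₁ (chain t)) in eq | chain-grows t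
      ... | nothing | inj₂ full = inj₂ full
      ... | nothing | inj₁ (_ , p , V∋p) = inj₂ (λ q → Bool.¬-not (λ V∌q →
              let _ , _ , eq′ , _ = next-≤ (proj₁ (chain t)) V∋p V∌q in just≢nothing (≡.trans (≡.sym eq′) eq)))
        where
        just≢nothing : ∀ {A : Set} {x : A} → just x ≢ nothing
        just≢nothing ()
      ... | just (_ , W) | grown with next-just⁻ (proj₁ (chain t)) eq
      ... | p , q , V∋p , V∌q , ≡.refl , _ with grown
      ...   | inj₂ full = ⊥-elim (true≢false (full q) V∌q)
      ...   | inj₁ (t< , _) = inj₁ (ℕ.≤-trans (ℕ.s≤s t<) (p⊂q⇒∣p∣<∣q∣ V⊂) , p , grow-⊇ V q V∋p)
        where
        V = proj₁ (chain t)
        V⊂ : V ⊂ grow V q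
        V⊂ = (λ {r} h → lookup⇒[]= r (grow V q) (grow-⊇ V q ([]=⇒lookup h))) ,
             q , lookup⇒[]= q (grow V q) (grow-∋ V q) , λ h → true≢false ([]=⇒lookup h) V∌q

      last-full : Full (proj₁ (chain N))
      last-full with chain-grows N
      ... | inj₂ full     = full
      ... | inj₁ (N< , _) = contradiction (∣p∣≤n (proj₁ (chain N))) (ℕ.<⇒≱ N<)

      full-route : ∃[ js ] Route js (proj₁ (chain N))
      full-route with chain-inv N ℕ.≤-refl
      ... | inj₁ r = r
      ... | inj₂ e = ⊥-elim (true≢false (last-full _) (Entered.V∌z e))

  -- Optimality of the dynamic program

  module Aggregation where
    open OrderedField F
    open Clustering F L
    open OrderedFieldProperties
    open Objectives using (total)
    open Algorithm using (fuse; append)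
    open PartialOrderReasoning poset
    import Algebra.Construct.NaturalChoice.Max totalOrder as Max
    open MaxOp Max.maxOperator using (x≤x⊔y; x≤y⊔x; ⊔-lub)

    -- The value of a list of scores as the table accumulates it, with the latest block at the head.
    aggregate : Combination → List Carrier → Carrier
    aggregate κ []       = 0#
    aggregate κ (y ∷ ys) = append κ (length ys) (aggregate κ ys) y

    fuse-upperˡ : ∀ u v → u ≤ fuse maximum u v
    fuse-upperˡ u v with u ≤? v
    ... | yes u≤v = u≤v
    ... | no _    = ≤-refl

    fuse-upperʳ : ∀ u v → v ≤ fuse maximum u v
    fuse-upperʳ u v with u ≤? v
    ... | yes _  = ≤-refl
    ... | no u≰v = ≰⇒≥ u≰v

    fuse-lub : ∀ {u v z} → u ≤ z → v ≤ z → fuse maximum u v ≤ z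
    fuse-lub {u} {v} u≤z v≤z with u ≤? v
    ... | yes _ = v≤z
    ... | no _  = u≤z

    append-mono : ∀ κ j {u u′} v → u ≤ u′ → append κ j u v ≤ append κ j u′ v
    append-mono κ           zero    v u≤u′ = ≤-refl
    append-mono weightedSum (suc j) v u≤u′ = +-monoˡ-≤ v u≤u′
    append-mono maximum     (suc j) v u≤u′ = fuse-lub (≤-trans u≤u′ (fuse-upperˡ _ v)) (fuse-upperʳ _ v)

    sumᴸ : List Carrier → Carrier
    sumᴸ = List.foldr _+_ 0#

    aggregate-sum : ∀ ys → aggregate weightedSum ys ≈ sumᴸ ys
    aggregate-sum []                = refl
    aggregate-sum (y ∷ [])          = sym (+-identityʳ y)
    aggregate-sum (y ∷ ys@(_ ∷ _)) = trans (+-comm _ y) (+-congˡ (aggregate-sum ys))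

    aggregate-upper : ∀ {y ys} → y ∈ᴸ ys → y ≤ aggregate maximum ys
    aggregate-upper {ys = y ∷ []}     (here ≡.refl) = ≤-refl
    aggregate-upper {ys = y ∷ _ ∷ _} (here ≡.refl) = fuse-upperʳ _ y
    aggregate-upper {ys = y ∷ _ ∷ _} (there y∈)    = ≤-trans (aggregate-upper y∈) (fuse-upperˡ _ y)

    aggregate-lub : ∀ {y ys z} → (∀ {y′} → y′ ∈ᴸ y ∷ ys → y′ ≤ z) → aggregate maximum (y ∷ ys) ≤ z
    aggregate-lub {ys = []}    h = h (here ≡.refl)
    aggregate-lub {ys = _ ∷ _} h = fuse-lub (aggregate-lub (h ∘ there)) (h (here ≡.refl))

    maxOver-upper : ∀ {k} (f : Vector Carrier k) i → f i ≤ maxOver f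
    maxOver-upper f zero    = init-≤ (f zero) (f ∘ suc)
      where
      init-≤ : ∀ {k} u (f : Vector Carrier k) → u ≤ foldr _⊔_ u f
      init-≤ {zero}  u f = ≤-refl
      init-≤ {suc k} u f = ≤-trans (init-≤ u (f ∘ suc)) (x≤y⊔x (f zero) _)
    maxOver-upper f (suc i) = elem-≤ (f zero) (f ∘ suc) i
      where
      elem-≤ : ∀ {k} u (f : Vector Carrier k) i → f i ≤ foldr _⊔_ u f
      elem-≤ u f zero    = x≤x⊔y (f zero) _
      elem-≤ u f (suc i) = ≤-trans (elem-≤ u (f ∘ suc) i) (x≤y⊔x (f zero) _)

    maxOver-lub : ∀ {k} (f : Vector Carrier (suc k)) {z} → (∀ i → f i ≤ z) → maxOver f ≤ z
    maxOver-lub f {z} h = go (f zero) (f ∘ suc) (h zero) (h ∘ suc)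
      where
      go : ∀ {k} u (f : Vector Carrier k) → u ≤ z → (∀ i → f i ≤ z) → foldr _⊔_ u f ≤ z
      go {zero}  u f u≤z h = u≤z
      go {suc k} u f u≤z h = ⊔-lub (h zero) (go u (f ∘ suc) u≤z (h ∘ suc))

    total≤aggregate : ∀ κ k (f : ℕ → Carrier) →
                      total κ {k} (f ∘ toℕ) ≤ aggregate κ (List.map f (downFrom k))
    total≤aggregate weightedSum k f =
      ≤-reflexive (trans (go k) (sym (aggregate-sum (List.map f (downFrom k)))))
      where
      open MonoidSum +-monoid using (sum-init-last; sum-cong-≗)
      go : ∀ k → sumOver {k} (f ∘ toℕ) ≈ sumᴸ (List.map f (downFrom k))
      go zero    = refl
      go (suc k) = begin-equality
        sumOver {suc k} (f ∘ toℕ)                     ≈⟨ sum-init-last {k} (f ∘ toℕ) ⟩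
        sumOver {k} (f ∘ toℕ ∘ inject₁) + f (toℕ (fromℕ k))
          ≈⟨ +-cong (reflexive (sum-cong-≗ {k} (≡.cong f ∘ toℕ-inject₁))) (reflexive (≡.cong f (toℕ-fromℕ k))) ⟩
        sumOver {k} (f ∘ toℕ) + f k                   ≈⟨ +-comm _ (f k) ⟩
        f k + sumOver {k} (f ∘ toℕ)                   ≈⟨ +-congˡ (go k) ⟩
        f k + sumᴸ (List.map f (downFrom k))          ∎
    total≤aggregate maximum zero    f = ≤-refl
    total≤aggregate maximum (suc k) f =
      maxOver-lub {k} (f ∘ toℕ) (λ i → aggregate-upper (∈-map⁺ f (∈-downFrom (toℕ<n i))))
      where
      ∈-downFrom : ∀ {m n} → m ℕ.< n → m ∈ᴸ downFrom n
      ∈-downFrom {m} {suc n} m<n with m ℕ.≟ n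
      ... | yes ≡.refl = here ≡.refl
      ... | no m≢n     = there (∈-downFrom (ℕ.≤∧≢⇒< (ℕ.s≤s⁻¹ m<n) m≢n))

    -- A route meets the clusters in the order of the visit, not of their labels; neither a sum nor
    -- a maximum depends on that order.
    aggregate≤total : ∀ κ {k js} (f : Fin k → Carrier) → js ↭ allFin k →
                      aggregate κ (List.map f js) ≤ total κ f
    aggregate≤total weightedSum {k} {js} f js↭ = ≤-reflexive (trans (aggregate-sum (List.map f js))
      (trans (permute js↭) (trans (reflexive (≡.cong sumᴸ (List.map-tabulate id f))) (over f))))
      where
      permute : ∀ {is js} → is ↭ js → sumᴸ (List.map f is) ≈ sumᴸ (List.map f js)
      permute Perm.refl         = refl
      permute (Perm.prep i p)   = +-congˡ (permute p)
      permute (Perm.swap {xs = xs} {ys} i j p) = begin-equality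
        f i + (f j + sumᴸ (List.map f xs)) ≈⟨ +-assoc (f i) (f j) _ ⟨
        f i + f j + sumᴸ (List.map f xs)   ≈⟨ +-cong (+-comm (f i) (f j)) (permute p) ⟩
        f j + f i + sumᴸ (List.map f ys)   ≈⟨ +-assoc (f j) (f i) _ ⟩
        f j + (f i + sumᴸ (List.map f ys)) ∎
      permute (Perm.trans p q)  = trans (permute p) (permute q)
      over : ∀ {k} (f : Fin k → Carrier) → sumᴸ (List.tabulate f) ≈ sumOver f
      over {zero}  f = refl
      over {suc k} f = +-congˡ (over (f ∘ suc))
    aggregate≤total maximum {zero}  {[]}     f js↭ = ≤-refl
    aggregate≤total maximum {suc k} {[]}     f js↭ with ↭-length js↭
    ... | ()
    aggregate≤total maximum {k}     {j ∷ js} f js↭ = aggregate-lub {f j} {List.map f js} (λ y∈ →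
      let i , _ , y≡ = ∈-map⁻ f y∈ in ≤-trans (≤-reflexive (reflexive y≡)) (maxOver-upper f i))

  module DynamicProgram where
    open OrderedField F
    open Clustering F L
    open OrderedFieldProperties
    open Objectives using (does-true)
    open Algorithm
    open Aggregation
    open Correctness

    does-false : ∀ {A : Set} (A? : Dec A) → does A? ≡ false → ¬ A
    does-false (no ¬a) _ = ¬a

    reflects : ∀ {A : Set} (A? : Dec A) {b} → (b ≡ true → A) → (b ≡ false → ¬ A) → b ≡ does A?
    reflects (yes a) {true}  t f = ≡.refl
    reflects (yes a) {false} t f = ⊥-elim (f ≡.refl a)
    reflects (no ¬a) {true}  t f = ⊥-elim (¬a (t ≡.refl))
    reflects (no ¬a) {false} t f = ≡.refl

    any-true⁺ : ∀ {A : Set} (f : A → Bool) {x xs} → x ∈ᴸ xs → f x ≡ true → any f xs ≡ true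
    any-true⁺ f {x} {xs = _ ∷ xs} (here ≡.refl) fx = ≡.cong (_∨ any f xs) fx
    any-true⁺ f {x} {xs = y ∷ _} (there x∈)    fx = ≡.trans (≡.cong (f y ∨_) (any-true⁺ f x∈ fx)) (Bool.∨-zeroʳ (f y))

    any-true⁻ : ∀ {A : Set} (f : A → Bool) xs → any f xs ≡ true → ∃[ x ] f x ≡ true
    any-true⁻ f (x ∷ xs) h with f x in fx
    ... | true  = x , fx
    ... | false = any-true⁻ f xs h

    some⁺ : ∀ {n} (C : Subset n) {p} → lookup C p ≡ true → some C ≡ true
    some⁺ C {p} = any-true⁺ (lookup C) (∈-allFin p)

    some⁻ : ∀ {n} (C : Subset n) → some C ≡ true → ∃[ p ] lookup C p ≡ true
    some⁻ {n} C = any-true⁻ (lookup C) (allFin n)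

    some-false⁺ : ∀ {n} (C : Subset n) → (∀ p → lookup C p ≡ false) → some C ≡ false
    some-false⁺ C h = ¬true⇒false (λ e → let p , Cp = some⁻ C e in true≢false Cp (h p))

    lookup-∖ : ∀ {n} (S T : Subset n) p → lookup (S ∖ T) p ≡ lookup S p ∧ not (lookup T p)
    lookup-∖ S T = lookup∘tabulate (λ p → lookup S p ∧ not (lookup T p))

    class : ∀ {n} → (Fin n → ℕ) → ℕ → Subset n
    class lab l = tabulate (λ p → does (lab p ℕ.≟ l))

    module _ {κ : Combination} {n : ℕ} (Y : Subset n → Carrier) (sets : List (Subset n)) where
      open Blocks κ Y

      -- The soundness half: the value of an entry is realized by a division of its set into j
      -- nonempty classes, namely by its own labels.
      record Sound (j : ℕ) (v : Carrier) (S : Subset n) (lab : Fin n → ℕ) : Set where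
        field
          inside  : ∀ p → lookup S p ≡ true → lab p ℕ.< j
          outside : ∀ p → lookup S p ≡ false → lab p ≡ j
          onto    : ∀ l → l ℕ.< j → ∃[ p ] lab p ≡ l
          v≡      : v ≡ aggregate κ (List.map (Y ∘ class lab) (downFrom j))

      -- Labels change only outside `S`, where all of them were `j`. So the classes below `j`
      -- survive, and what remains of class `j` is the new block.
      relabel-sound : ∀ {j v S lab} T → Sound j v S lab → some (T ∖ S) ≡ true → some (S ∖ T) ≡ false →
                      Sound (suc j) (append κ j v (Y (T ∖ S))) T (relabel j S T lab)
      relabel-sound {j} {v} {S} {lab} T sound new old = record
        { inside  = λ p Tp → inside′ p Tp
        ; outside = outside′
        ; onto    = onto′
        ; v≡      = ≡.trans (≡.cong₂ (λ l u → append κ l u (Y (T ∖ S))) (≡.sym len≡)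
                      (≡.trans v≡ (≡.cong (aggregate κ) old-classes)))
                    (≡.cong (λ C → append κ (length ys) (aggregate κ ys) (Y C)) new-class)
        }
        where
        open Sound sound
        lab′ = relabel j S T lab
        ys = List.map (Y ∘ class lab′) (downFrom j)

        S⊆T : ∀ p → lookup S p ≡ true → lookup T p ≡ true
        S⊆T p Sp = Bool.¬-not (λ Tp → true≢false
          (some⁺ (S ∖ T) {p} (≡.trans (lookup-∖ S T p) (≡.cong₂ (λ a b → a ∧ not b) Sp Tp))) old)

        lab′-old : ∀ p → lookup S p ≡ true → lab′ p ≡ lab p
        lab′-old p Sp rewrite Sp = ≡.refl

        lab′-new : ∀ p → lookup S p ≡ false → lookup T p ≡ true → lab′ p ≡ j
        lab′-new p Sp Tp rewrite Sp | Tp = ≡.refl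

        outside′ : ∀ p → lookup T p ≡ false → lab′ p ≡ suc j
        outside′ p Tp with lookup S p in Sp
        ... | true  = ⊥-elim (true≢false (S⊆T p Sp) Tp)
        ... | false rewrite Tp = ≡.refl

        inside′ : ∀ p → lookup T p ≡ true → lab′ p ℕ.< suc j
        inside′ p Tp = by-cases (lookup S p) ≡.refl
          where
          by-cases : ∀ b → lookup S p ≡ b → lab′ p ℕ.< suc j
          by-cases true  Sp = ≡.subst (ℕ._< suc j) (≡.sym (lab′-old p Sp)) (ℕ.m≤n⇒m≤1+n (inside p Sp))
          by-cases false Sp = ≡.subst (ℕ._< suc j) (≡.sym (lab′-new p Sp Tp)) ℕ.≤-refl

        old-S : ∀ {p l} → l ℕ.< j → lab p ≡ l → lookup S p ≡ true
        old-S {p} l<j lp = Bool.¬-not (λ Sp → ℕ.<-irrefl (≡.trans (≡.sym lp) (outside p Sp)) l<j)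

        onto′ : ∀ l → l ℕ.< suc j → ∃[ p ] lab′ p ≡ l
        onto′ l l<1+j with l ℕ.≟ j
        ... | no l≢j = let l<j = ℕ.≤∧≢⇒< (ℕ.s≤s⁻¹ l<1+j) l≢j ; p , lp = onto l l<j in
          p , ≡.trans (lab′-old p (old-S l<j lp)) lp
        ... | yes ≡.refl with some⁻ (T ∖ S) new
        ...   | p , T∖Sp with lookup T p in Tp | lookup S p in Sp | ≡.trans (≡.sym (lookup-∖ T S p)) T∖Sp
        ...     | true | false | _ = p , lab′-new p Sp Tp

        class-lookup : ∀ lab l p → lookup (class lab l) p ≡ does (lab p ℕ.≟ l)
        class-lookup lab l = lookup∘tabulate (λ p → does (lab p ℕ.≟ l))

        old-class : ∀ {l} → l ℕ.< j → class lab l ≡ class lab′ l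
        old-class {l} l<j = lookup-ext (λ p → ≡.trans (class-lookup lab l p) (≡.trans
          (reflects (lab′ p ℕ.≟ _) (fwd p) (bwd p)) (≡.sym (class-lookup lab′ l p))))
          where
          fwd : ∀ p → does (lab p ℕ.≟ l) ≡ true → lab′ p ≡ l
          fwd p h = let lp = does-true (lab p ℕ.≟ l) h in ≡.trans (lab′-old p (old-S l<j lp)) lp
          bwd : ∀ p → does (lab p ℕ.≟ l) ≡ false → lab′ p ≢ l
          bwd p h with lookup S p in Sp | lookup T p in Tp
          ... | true  | _     = does-false (lab p ℕ.≟ l) h
          ... | false | true  = λ j≡l → ℕ.<-irrefl (≡.sym j≡l) l<j
          ... | false | false = λ j≡l → ℕ.<-irrefl (≡.sym j≡l) (ℕ.m≤n⇒m≤1+n l<j)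

        old-classes : List.map (Y ∘ class lab) (downFrom j) ≡ List.map (Y ∘ class lab′) (downFrom j)
        old-classes = go j ℕ.≤-refl
          where
          go : ∀ m → m ℕ.≤ j → List.map (Y ∘ class lab) (downFrom m) ≡ List.map (Y ∘ class lab′) (downFrom m)
          go zero    _   = ≡.refl
          go (suc m) m<j = ≡.cong₂ _∷_ (≡.cong Y (old-class m<j)) (go m (ℕ.<⇒≤ m<j))

        len≡ : length (List.map (Y ∘ class lab′) (downFrom j)) ≡ j
        len≡ = ≡.trans (List.length-map _ (downFrom j)) (List.length-downFrom j)

        new-class : T ∖ S ≡ class lab′ j
        new-class = lookup-ext (λ p → ≡.trans (lookup-∖ T S p) (≡.trans (reflects (lab′ p ℕ.≟ _) (fwd p) (bwd p)) (≡.sym (class-lookup lab′ j p))))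
          where
          fwd : ∀ p → lookup T p ∧ not (lookup S p) ≡ true → lab′ p ≡ j
          fwd p h with lookup T p in Tp | lookup S p in Sp
          ... | true | false = ≡.refl
          bwd : ∀ p → lookup T p ∧ not (lookup S p) ≡ false → lab′ p ≢ j
          bwd p h with lookup S p in Sp | lookup T p in Tp
          ... | true  | _     = λ lp → ℕ.<-irrefl lp (inside p Sp)
          ... | false | false = λ ()

      row-sound : ∀ j {v S lab} → just (v , S , lab) ∈ᴸ row sets j → Sound j v S lab
      row-sound zero (here ≡.refl) = record
        { inside  = λ p Sp → ⊥-elim (true≢false Sp (lookup∘tabulate _ p))
        ; outside = λ _ _ → ≡.refl
        ; onto    = λ _ ()
        ; v≡      = ≡.refl }
      row-sound (suc j) e∈ with ∈-map⁻ (best j (row sets j)) e∈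
      ... | T , _ , eq with best-just⁻ κ Y sets j T (≡.sym eq)
      ... | v , S , lab , v∈ , new , old , ≡.refl = relabel-sound T (row-sound j v∈) new old

  -- Comparison of the computed clustering with the optimal one

  module Solving where
    open OrderedField F
    open Clustering F L
    open OrderedFieldProperties
    open Objectives
    open Feasible using (listV; list-cong; vec≡list)
    open Algorithm
    open Aggregation
    open Correctness
    open DynamicProgram
    open PartialOrderReasoning poset

    module Solution (Φ : Objective) (I : Instance) (I-metric : IsMetric I) (a : Labelling I)
      (partition : IsPartition I a) (separated : Separated I a) (Y : Subset (n I) → Carrier)
      (Y-attained : ∀ C → some C ≡ true → ∃[ c ] WithObjective.term Φ I C c ≤ Y C)
      (Y-minimal : ∀ C → some C ≡ true → ∀ c → Y C ≤ WithObjective.term Φ I C c)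
      (a-optimal : IsOptimal Φ I a) where
      open WithObjective Φ
      open Chain I I-metric a separated
      open Growth I using (sets; chain)
      κ = Objective.combination Φ
      open Blocks κ Y

      bound : List (Fin (k I)) → Carrier
      bound js = aggregate κ (List.map (Y ∘ cluster I a) js)

      cluster-nonempty : ∀ b → IsPartition I b → ∀ i → some (cluster I b i) ≡ true
      cluster-nonempty b b-partition i = let p , bp≡i = b-partition i in
        some⁺ (cluster I b i) {p} (≡.trans (lookup∘tabulate _ p) (does-≡ (b p ≟ i) (bp≡i ≡.refl)))
        where
        does-≡ : ∀ {A : Set} (A? : Dec A) → A → does A? ≡ true
        does-≡ (yes _) _ = ≡.refl
        does-≡ (no ¬a) a = contradiction a ¬a

      -- The completeness half: along a route each optimal cluster is an admissible block, so the
      -- minima in the table are no larger than the bound of these clusters. The labels stored there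
      -- may belong to another division.
      complete : ∀ {js V} → Route js V → ∃[ v ] ∃[ lab ]
                 (just (v , V , lab) ∈ᴸ row sets (length js) × v ≤ bound js)
      complete-best : ∀ {i js T} → Route (i ∷ js) T → ∃[ v ] ∃[ lab ]
                      (best (length js) (row sets (length js)) T ≡ just (v , T , lab) × v ≤ bound (i ∷ js))

      complete empty = 0# , _ , here ≡.refl , ≤-refl
      complete r@(block {js} _ _ T∈ _ _ _) =
        let v , lab , eq , v≤ = complete-best r in
        v , lab , ≡.subst (_∈ᴸ row sets (suc (length js))) eq (∈-map⁺ (best (length js) (row sets (length js))) T∈) , v≤

      complete-best (block {js} {V} {i} {T} r i∉js _ T⊆ V⊆T C⊆T) =
        let v , lab , v∈ , v≤ = complete r
            j = length js
            u , c , eq , u≤ = argmin-≤ {ms = List.map (extend j T) (row sets j)}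
              (≡.subst (_∈ᴸ _) (extended v lab) (∈-map⁺ (extend j T) v∈))
            _ , _ , _ , _ , _ , _ , c≡ = best-just⁻ κ Y sets j T eq
        in u , proj₂ c , ≡.trans eq (≡.cong (λ S → just (u , S , proj₂ c)) (≡.cong (proj₁ ∘ proj₂) c≡)) , (begin
          u                                                  ≤⟨ u≤ ⟩
          append κ j v (Y (cluster I a i))                   ≤⟨ append-mono κ j _ v≤ ⟩
          append κ j (bound js) (Y (cluster I a i))
            ≈⟨ reflexive (≡.cong (λ l → append κ l (bound js) (Y (cluster I a i))) (≡.sym (List.length-map _ js))) ⟩
          bound (i ∷ js)                                     ∎)
        where
        fresh : ∀ {p} → a p ≡ i → lookup V p ≡ false
        fresh ap≡i = ¬true⇒false (λ Vp → i∉js (≡.subst (_∈ᴸ js) ap≡i (covers⁻ r Vp)))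

        new-cluster : T ∖ V ≡ cluster I a i
        new-cluster = lookup-ext (λ p → ≡.trans (lookup-∖ T V p)
          (≡.trans (reflects (a p ≟ i) (fwd p) (bwd p)) (≡.sym (lookup∘tabulate _ p))))
          where
          fwd : ∀ p → lookup T p ∧ not (lookup V p) ≡ true → a p ≡ i
          fwd p h with lookup T p in Tp | lookup V p in Vp
          ... | true | false with T⊆ Tp
          ...   | inj₁ Vp′  = ⊥-elim (true≢false Vp′ Vp)
          ...   | inj₂ ap≡i = ap≡i
          bwd : ∀ p → lookup T p ∧ not (lookup V p) ≡ false → a p ≢ i
          bwd p h ap≡i rewrite C⊆T ap≡i | fresh ap≡i with h
          ... | ()

        V∖T-empty : some (V ∖ T) ≡ false
        V∖T-empty = some-false⁺ (V ∖ T) (λ p → ≡.trans (lookup-∖ V T p) (absent p))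
          where
          absent : ∀ p → lookup V p ∧ not (lookup T p) ≡ false
          absent p with lookup V p in Vp
          ... | false = ≡.refl
          ... | true rewrite V⊆T Vp = ≡.refl

        T∖V-nonempty : some (T ∖ V) ≡ true
        T∖V-nonempty = ≡.trans (≡.cong some new-cluster) (cluster-nonempty a partition i)

        extended : ∀ v lab → extend (length js) T (just (v , V , lab)) ≡
                   just (append κ (length js) v (Y (cluster I a i)) , T , relabel (length js) V T lab)
        extended v lab rewrite T∖V-nonempty | V∖T-empty | new-cluster = ≡.refl

      route-unique : ∀ {js V} → Route js V → Unique js
      route-unique empty = []
      route-unique (block {js} r i∉js _ _ _ _) = ¬Any⇒All¬ js i∉js ∷ route-unique r

      -- The program reads the head of the row. For a nonempty route this is the entry of the last
      -- set of the chain, and for the empty route the only entry of row 0.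
      head-solution : ∀ {js V} → Route js V → V ≡ proj₁ (chain (n I)) → ∃[ v ] ∃[ lab ] ∃[ es ]
                      (row sets (length js) ≡ just (v , V , lab) ∷ es × v ≤ bound js)
      head-solution empty _ = 0# , (λ _ → 0) , [] , ≡.refl , ≤-refl
      head-solution r@(block {js} _ _ _ _ _ _) ≡.refl = let v , lab , eq , v≤ = complete-best r in
        v , lab , es , ≡.cong (λ m → m ∷ es) eq , v≤
        where
        es : List (Candidate (n I))
        es = List.map (best (length js) (row sets (length js))) (proj₂ (chain (n I)))

      solution : ∃[ v ] ∃[ S ] ∃[ lab ] ∃[ es ]
                 (row sets (k I) ≡ just (v , S , lab) ∷ es × Full S × v ≤ total κ (Y ∘ cluster I a))
      solution =
        let js , r = full-route
            js↭ = permutation r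
            v , lab , es , eq , v≤ = head-solution r ≡.refl
        in v , proj₁ (chain (n I)) , lab , es
         , ≡.subst (λ j → row sets j ≡ just (v , proj₁ (chain (n I)) , lab) ∷ es) (≡.trans (↭-length js↭) (length-allFin (k I))) eq
         , last-full , ≤-trans v≤ (aggregate≤total κ (Y ∘ cluster I a) js↭)
        where
        -- A route repeats no cluster, and one that ends in the full set omits none, because every
        -- cluster contains a point.
        permutation : ∀ {js} → Route js (proj₁ (chain (n I))) → js ↭ allFin (k I)
        permutation {js} r = ∼bag⇒↭ (unique∧set⇒bag (route-unique r) (allFin⁺ (k I)) (λ {i} →
          mk⇔ (λ _ → ∈-allFin i) (λ _ → let p , ap≡i = partition i in
            ≡.subst (_∈ᴸ js) (ap≡i ≡.refl) (covers⁻ r (last-full p)))))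

      decode : Val → Val
      decode v = apply tailₚ (apply tailₚ (apply headₚ v))

      solved : ∃[ b ] (decode (listV (List.map codeCandidate (row sets (k I)))) ≡ codeLabelling I b × IsOptimal Φ I b)
      solved with solution
      ... | v , S , lab , es , eq , S-full , v≤ = b , output , e , b-partition , optimal
        where
        open Sound (row-sound Y sets (k I) {v} {S} {lab} (≡.subst (just (v , S , lab) ∈ᴸ_) (≡.sym eq) (here ≡.refl)))

        lab< : ∀ p → lab p ℕ.< k I
        lab< p = inside p (S-full p)

        b : Labelling I
        b p = fromℕ< (lab< p)

        output : decode (listV (List.map codeCandidate (row sets (k I)))) ≡ codeLabelling I b
        output = ≡.trans (≡.cong (decode ∘ listV ∘ List.map codeCandidate) eq) (≡.trans (vec≡list (unary ∘ lab)) (list-cong (λ p → ≡.cong unary (≡.sym (toℕ-fromℕ< (lab< p))))))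

        b-partition : IsPartition I b
        b-partition i = let p , lp = onto (toℕ i) (toℕ<n i) in
          p , λ { ≡.refl → toℕ-injective (≡.trans (toℕ-fromℕ< (lab< p)) lp) }

        classes : ∀ i → cluster I b i ≡ class lab (toℕ i)
        classes i = lookup-ext (λ p → ≡.trans (lookup∘tabulate _ p) (≡.trans
          (reflects (lab p ℕ.≟ toℕ i)
            (λ h → ≡.trans (≡.sym (toℕ-fromℕ< (lab< p))) (≡.cong toℕ (does-true (b p ≟ i) h)))
            (λ h lp → does-false (b p ≟ i) h (toℕ-injective (≡.trans (toℕ-fromℕ< (lab< p)) lp))))
          (≡.sym (lookup∘tabulate _ p))))

        e : Fin (k I) → Instance.S I
        e i = proj₁ (Y-attained (cluster I b i) (cluster-nonempty b b-partition i))

        c = proj₁ a-optimal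

        optimal : ∀ b′ e′ → IsPartition I b′ → value Φ I b e ≤ value Φ I b′ e′
        optimal b′ e′ b′-partition = begin
          value Φ I b e                                        ≈⟨ reflexive (value-total I b e) ⟩
          total κ (λ i → term I (cluster I b i) (e i))         ≤⟨ total-mono κ (λ i → ≤-trans
            (proj₂ (Y-attained (cluster I b i) (cluster-nonempty b b-partition i)))
            (≤-reflexive (reflexive (≡.cong Y (classes i))))) ⟩
          total κ {k I} (λ i → Y (class lab (toℕ i)))   ≤⟨ total≤aggregate κ (k I) (Y ∘ class lab) ⟩
          aggregate κ (List.map (Y ∘ class lab) (downFrom (k I))) ≈⟨ reflexive (≡.sym v≡) ⟩
          v                                                    ≤⟨ v≤ ⟩
          total κ (Y ∘ cluster I a)                            ≤⟨ total-mono κ (λ i → Y-minimal _ (cluster-nonempty a partition i) (c i)) ⟩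
          total κ (λ i → term I (cluster I a i) (c i))         ≈⟨ reflexive (value-total I a c) ⟨
          value Φ I a c                                        ≤⟨ proj₂ (proj₂ a-optimal) b′ e′ b′-partition ⟩
          value Φ I b′ e′                                      ∎

  -- The constants 3 and 2 + √3 in terms of γ = α - 1

  module Thresholds where
    open OrderedField F
    open OrderedFieldProperties
    open Solver commutativeSemiring using (solve; _:=_; _:+_; _:*_)
    open PartialOrderReasoning poset

    private
      -1+1 : ∀ α u → (α - 1#) * u + u ≈ α * u
      -1+1 α u = trans (+-congˡ (sym (*-identityˡ u))) (trans (sym (distribʳ u (α - 1#) 1#)) (*-congʳ (x-y+y α 1#)))

      2*≈ : ∀ u → 2# * u ≈ u + u
      2*≈ u = trans (distribʳ u 1# 1#) (+-cong (*-identityˡ u) (*-identityˡ u))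

      3*≈ : ∀ u → 3# * u ≈ u + u + u
      3*≈ u = trans (distribʳ u 2# 1#) (+-cong (2*≈ u) (*-identityˡ u))

      1≤2 : 1# ≤ 2#
      1≤2 = ≤-trans (≤-reflexive (sym (+-identityʳ 1#))) (+-mono-≤ ≤-refl 0≤1)

      2≤3 : 2# ≤ 3#
      2≤3 = ≤-trans (≤-reflexive (sym (+-identityʳ 2#))) (+-mono-≤ ≤-refl 0≤1)

    module _ {α : Carrier} where

      3≤α⇒1≤α : 3# ≤ α → 1# ≤ α
      3≤α⇒1≤α = ≤-trans (≤-trans 1≤2 2≤3)

      3≤α⇒2≤γ : 3# ≤ α → ∀ {u} → 0# ≤ u → u + u ≤ (α - 1#) * u
      3≤α⇒2≤γ 3≤α {u} 0≤u = +-cancelʳ-≤ u (begin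
        u + u + u          ≈⟨ 3*≈ u ⟨
        3# * u             ≤⟨ *-monoʳ-≤ u 0≤u 3≤α ⟩
        α * u              ≈⟨ -1+1 α u ⟨
        (α - 1#) * u + u   ∎)

      AtLeast2+√3⇒1≤α : AtLeast2+√3 α → 1# ≤ α
      AtLeast2+√3⇒1≤α (2≤α , _) = ≤-trans 1≤2 2≤α

      -- With δ = α - 2, so γ = δ + 1, the difference γ² - 2γ - 2 equals δ² - 3.
      AtLeast2+√3⇒2γ+2≤γ² : AtLeast2+√3 α → ∀ {u} → 0# ≤ u →
        (α - 1#) * u + (α - 1#) * u + (u + u) ≤ (α - 1#) * ((α - 1#) * u)
      AtLeast2+√3⇒2γ+2≤γ² (2≤α , 3≤δ²) {u} 0≤u = begin
        γ * u + γ * u + (u + u)                      ≈⟨ +-congʳ (+-cong (γ*≈ u) (γ*≈ u)) ⟩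
        δ * u + u + (δ * u + u) + (u + u)
          ≈⟨ solve 2 (λ δu u → δu :+ u :+ (δu :+ u) :+ (u :+ u) := u :+ u :+ u :+ (δu :+ δu :+ u)) refl (δ * u) u ⟩
        u + u + u + (δ * u + δ * u + u)              ≈⟨ +-congʳ (3*≈ u) ⟨
        3# * u + (δ * u + δ * u + u)                 ≤⟨ +-monoˡ-≤ _ (*-monoʳ-≤ u 0≤u 3≤δ²) ⟩
        δ * δ * u + (δ * u + δ * u + u)
          ≈⟨ solve 2 (λ δ u → δ :* δ :* u :+ (δ :* u :+ δ :* u :+ u) := δ :* (δ :* u :+ u) :+ (δ :* u :+ u)) refl δ u ⟩
        δ * (δ * u + u) + (δ * u + u)                ≈⟨ γ*≈ (δ * u + u) ⟨
        γ * (δ * u + u)                              ≈⟨ *-congˡ (γ*≈ u) ⟨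
        γ * (γ * u)                                  ∎
        where
        γ = α - 1#
        δ = α - 2#
        γ≈δ+1 : γ ≈ δ + 1#
        γ≈δ+1 = ≤-antisym (+-cancelʳ-≤ 1# (≤-reflexive eq)) (+-cancelʳ-≤ 1# (≤-reflexive (sym eq)))
          where
          eq : γ + 1# ≈ δ + 1# + 1#
          eq = trans (x-y+y α 1#) (trans (sym (x-y+y α 2#)) (sym (+-assoc δ 1# 1#)))
        γ*≈ : ∀ v → γ * v ≈ δ * v + v
        γ*≈ v = trans (*-congʳ γ≈δ+1) (trans (distribʳ v δ 1#) (+-congˡ (*-identityˡ v)))

  -- The complete program, with weights and scores from the given algorithms

  module Algorithmic where
    open OrderedField F using (Carrier; 0#; _≤_; _≈_; *-congʳ; sym; trans; reflexive)
    open Clustering F L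
    open OrderedFieldProperties
    open Objectives
    open Feasible
    open Algorithm
    open DynamicProgram using (some⁻)
    open Solving

    module _ (Φ : Objective) {𝓘 : Instance → Set} (separable : IsSeparable Φ 𝓘) where
      open WithObjective Φ
      private
        module Sep = IsSeparable separable
        κ = Objective.combination Φ

      module _ (I : Instance) (I∈ : 𝓘 I) where

        nonempty : ∀ {C : Subset (n I)} → some C ≡ true → Nonempty C
        nonempty {C} h = let p , Cp = some⁻ C h in p , lookup⇒[]= p C Cp

        score weight : ∀ C → some C ≡ true → Carrier
        score C h = proj₁ (answer-correct Sep.score-polyTime (I , I∈ , C , nonempty h))
        weight C h = proj₁ (answer-correct Sep.weight-polyTime (I , I∈ , C , nonempty h))

        score-spec : ∀ C h → IsScore Φ I C (score C h)
        score-spec C h = proj₂ (proj₂ (answer-correct Sep.score-polyTime (I , I∈ , C , nonempty h)))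

        weight-spec : ∀ C h → weight C h ≈ Objective.weight Φ (description I) C
        weight-spec C h = proj₂ (proj₂ (answer-correct Sep.weight-polyTime (I , I∈ , C , nonempty h)))

        weighted : ∀ C → some C ≡ true → Carrier
        weighted C h = weigh κ (weight C h) (score C h)

        private
          -- The table wants a function on all subsets, while the given algorithms answer on
          -- nonempty ones. On the empty set 0# is a filler, and `admissible` keeps that set from
          -- being a block.
          Y-if : ∀ C b → some C ≡ b → Carrier
          Y-if C true  h = weighted C h
          Y-if C false h = 0#

        Y : Subset (n I) → Carrier
        Y C = Y-if C (some C) ≡.refl

        -- The computed score formally depends on the proof that C is nonempty, which is part of the
        -- index of the call. Proofs of an equation between Booleans are unique, so the dependence
        -- vanishes.
        Y-nonempty : ∀ C h → weighted C h ≡ Y C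
        Y-nonempty C h = go (some C) ≡.refl
          where
          uip : ∀ {x y : Bool} (p q : x ≡ y) → p ≡ q
          uip ≡.refl ≡.refl = ≡.refl
          go : ∀ b e → weighted C h ≡ Y-if C b e
          go true  e = ≡.cong (weighted C) (uip h e)
          go false e with ≡.trans (≡.sym h) e
          ... | ()

        weigh-congˡ : ∀ κ {w w′} s → w ≈ w′ → weigh κ w s ≈ weigh κ w′ s
        weigh-congˡ weightedSum s w≈w′ = *-congʳ w≈w′
        weigh-congˡ maximum     s w≈w′ = reflexive ≡.refl

        Y-≈ : ∀ C h → Y C ≈ weigh κ (Objective.weight Φ (description I) C) (score C h)
        Y-≈ C h = trans (reflexive (≡.sym (Y-nonempty C h))) (weigh-congˡ κ (score C h) (weight-spec C h))

        weight≥0 : ∀ C → 0# ≤ Objective.weight Φ (description I) {n I} C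
        weight≥0 = Sep.weight-nonNegative I I∈

        Y-attained : ∀ C → some C ≡ true → ∃[ c ] term I C c ≤ Y C
        Y-attained C h = let (c , cost≈) , _ = score-spec C h in
          c , ≤-trans (weigh-mono κ (weight≥0 C) (≤-reflexive cost≈)) (≤-reflexive (sym (Y-≈ C h)))

        Y-minimal : ∀ C → some C ≡ true → ∀ c → Y C ≤ term I C c
        Y-minimal C h c = ≤-trans (≤-reflexive (Y-≈ C h)) (weigh-mono κ (weight≥0 C) (proj₂ (score-spec C h) c))

      module _ (R : Instance → Set) where

        -- The promise `R`, later resilience, belongs to the index but not to the code: the program
        -- cannot consult it, and only the proof of correctness opens it.
        Γ : Family
        Γ = family (Σ[ I ∈ Instance ] 𝓘 I × R I) (code ∘ proj₁)

        inst : Index Γ → Instance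
        inst = proj₁

        codeₑ : Γ ⊩ input Γ ↝ input Γ
        codeₑ = var {Γ} (poly-input {Γ})

        matrixₑ : Γ ⊩ input Γ ↝ codeMatrix {Γ} {input Γ} inst
        matrixₑ = convert (λ (I , _) → to-vec (λ p q → num (dist I p q))) (fst (snd codeₑ))
          where
          to-vec : ∀ {n} (f : Fin n → Fin n → Val) → list (λ p → list (f p)) ≡ vec (λ p → vec (f p))
          to-vec f = ≡.trans (list-cong {f = λ p → list (f p)} {g = λ p → vec (f p)} (λ p → ≡.sym (vec≡list (f p))))
            (≡.sym (vec≡list (λ p → vec (f p))))

        clusterScore : ∀ x → Subset (n (inst x)) → Carrier
        clusterScore (I , I∈ , _) = Y I I∈

        scoresₑ : Scores Γ inst clusterScore (input Γ)
        scoresₑ = convert (λ ((I , I∈ , _) , C , h) → ≡.cong num (Y-nonempty I I∈ C h)) (weighₑ κ)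
          where
          Γ′ = Γ ▸ (λ x → Σ[ C ∈ Subset (n (inst x)) ] some C ≡ true)
          clusterOf : Index Γ′ → Sep.ClusterOf
          clusterOf ((I , I∈ , _) , C , h) = I , I∈ , C , nonempty I I∈ h
          i′ : Index Γ′ → Val
          i′ (x , C , _) = codeSet C ∷ input Γ x
          size-cluster : Poly Γ′ (λ (x , C , _) → size (codeSet C))
          size-cluster = poly-≤ {Γ′} (λ (x , C , _) → size-codeSet C)
            (poly-▸ {Γ} {λ x → Σ[ C ∈ Subset (n (inst x)) ] some C ≡ true}
              (poly-suc {Γ} (poly-* {Γ} (poly-N inst matrixₑ) (poly-const {Γ} 4))))
          v : Γ′ ⊩ i′ ↝ i′
          v = var (poly-suc {Γ′} (poly-+ {Γ′} size-cluster (poly-input {Γ′})))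
          argument : Γ′ ⊩ i′ ↝ Sep.input ∘ clusterOf
          argument = snd v ,ₑ convert (λ (x , C , _) → vec≡list (bool ∘ lookup C)) (fst v)
          scoreₑ : Γ′ ⊩ i′ ↝ (λ ((I , I∈ , _) , C , h) → num (score I I∈ C h))
          scoreₑ = convert (λ y → proj₁ (proj₂ (answer-correct Sep.score-polyTime (clusterOf y))))
            (callₑ Sep.score-polyTime clusterOf argument)
          weightₑ : Γ′ ⊩ i′ ↝ (λ ((I , I∈ , _) , C , h) → num (weight I I∈ C h))
          weightₑ = convert (λ y → proj₁ (proj₂ (answer-correct Sep.weight-polyTime (clusterOf y))))
            (callₑ Sep.weight-polyTime clusterOf argument)
          weighₑ : ∀ κ → Γ′ ⊩ i′ ↝ (λ ((I , I∈ , _) , C , h) → num (weigh κ (weight I I∈ C h) (score I I∈ C h)))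
          weighₑ weightedSum = mulₑ weightₑ scoreₑ
          weighₑ maximum     = scoreₑ

        solve : Γ ⊩ input Γ ↝ (λ x → apply tailₚ (apply tailₚ (apply headₚ (listV (List.map codeCandidate
                  (Blocks.row κ (clusterScore x) (Growth.sets (inst x)) (k (inst x))))))))
        solve = tailₑ _ (tailₑ _ (headₑ _ (rowₑ inst κ clusterScore scoresₑ matrixₑ (fst codeₑ))))

  -- Correctness of the program on resilient instances

  module _ where
    open OrderedField F
    open Clustering F L
    open OrderedFieldProperties
    open Thresholds
    open Feasible using (listV; ⊩⇒PolyTime)
    open Algorithm using (codeCandidate; module Blocks; module Growth)
    open Objectives using (module Proximity)
    open Solving using (module Solution)
    open Algorithmic

    module _ (Φ : Objective) (Φ-centerBased : IsCenterBased Φ) {𝓘 : Instance → Set}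
             (metric : ∀ I → 𝓘 I → IsMetric I) (separable : IsSeparable Φ 𝓘) {α : Carrier}
             (α-large : (3# ≤ α × (∀ I → 𝓘 I → OnlyDataPoints I)) ⊎ AtLeast2+√3 α) where

      1≤α : 1# ≤ α
      1≤α = [ 3≤α⇒1≤α ∘ proj₁ , AtLeast2+√3⇒1≤α ]′ α-large

      correct : ∀ I (I∈ : 𝓘 I) → IsResilient Φ α I → ∃[ b ]
        (apply tailₚ (apply tailₚ (apply headₚ (listV (List.map (codeCandidate)
           (Blocks.row (Objective.combination Φ) (Y Φ separable I I∈) (Growth.sets I) (k I)))))) ≡
         codeLabelling I b × IsOptimal Φ I b)
      correct I I∈ (a , resilient) = Solution.solved Φ I (metric I I∈) a partition (separated wide)
        (Y Φ separable I I∈) (Y-attained Φ separable I I∈) (Y-minimal Φ separable I I∈)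
        -- The metric is a perturbation of itself, as 1 ≤ α; this gives optimality of a for the
        -- original distances.
        (proj₁ (resilient (d I) (λ _ _ → ≤-refl , ≤α* (IsGeneralMetric.nonNegative (metric I I∈)))))
        where
        open Proximity Φ Φ-centerBased I (metric I I∈) (IsSeparable.weight-nonNegative separable I I∈) α 1≤α a resilient
        wide : Wide
        wide = Sum.map (λ (3≤α , onlyData) → 3≤α⇒2≤γ 3≤α , onlyData I I∈) AtLeast2+√3⇒2γ+2≤γ² α-large

      finds-optimal : FindsOptimalClustering Φ α 𝓘
      finds-optimal = ⊩⇒PolyTime (solve Φ separable (IsResilient Φ α))
        (λ (I , I∈ , resilient) → correct I I∈ resilient)

theorem1p4 :
    (F : OrderedField) (L : Length F) →
    let open OrderedField F
        open Clustering F L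
    in
    (Φ : Objective) → IsCenterBased Φ →
    (𝓘 : Instance → Set) → (∀ I → 𝓘 I → IsMetric I) → IsSeparable Φ 𝓘 →
    (α : Carrier) →
    (3# ≤ α × (∀ I → 𝓘 I → OnlyDataPoints I)) ⊎ AtLeast2+√3 α →
    FindsOptimalClustering Φ α 𝓘
theorem1p4 F L Φ Φ-centerBased 𝓘 metric separable α α-large =
  finds-optimal F L Φ Φ-centerBased metric separable α-large
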